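{- The Calculus of constructions, expressed as the following theory of the $\lambda\Pi$-calculus modulo theory, is super-consistent. Constants: $$type:Type,\quad o:type,\quad \eta:type\to Type,\quad \varepsilon:(\eta\,o)\to Type,$$ $$\dot\Pi_{KK}:\Pi x:type\;(((\eta\,x)\to type)\to type),\quad \dot\Pi_{TT}:\Pi x:(\eta\,o)\;(((\varepsilon\,x)\to(\eta\,o))\to(\eta\,o)),$$ $$\dot\Pi_{KT}:\Pi x:type\;(((\eta\,x)\to(\eta\,o))\to(\eta\,o)),\quad \dot\Pi_{TK}:\Pi x:(\eta\,o)\;(((\varepsilon\,x)\to type)\to type);$$ rewrite rules: $$(\eta\,(\dot\Pi_{KK}\,x\,y))\longrightarrow\Pi z:(\eta\,x)\;(\eta\,(y\,z)),\qquad(\varepsilon\,(\dot\Pi_{TT}\,x\,y))\longrightarrow\Pi z:(\varepsilon\,x)\;(\varepsilon\,(y\,z)),$$ $$(\varepsilon\,(\dot\Pi_{KT}\,x\,y))\longrightarrow\Pi z:(\eta\,x)\;(\varepsilon\,(y\,z)),\qquad(\eta\,(\dot\Pi_{TK}\,x\,y))\longrightarrow\Pi z:(\varepsilon\,x)\;(\eta\,(y\,z)),$$ where in each rule the context declares $x$ and $y$ with the types of the two arguments of the corresponding $\dot\Pi$ symbol.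
   Context: **Terms.** Terms are $t ::= x\mid Type\mid Kind\mid \Pi x:t\;t\mid\lambda x:t\;t\mid t\,t$, up to $\alpha$-equivalence; $(u/x)t$ is capture-avoiding substitution; $A\to B$ is $\Pi x:A\;B$ with $x$ not free in $B$. $\beta$ is root $\beta$-reduction. For a relation $r$ on terms, $\longrightarrow^1_r$ is its closure under term formation, $\longrightarrow^*_r$ the reflexive-transitive closure of $\longrightarrow_r^1$, and $\equiv_r$ its reflexive-symmetric-transitive closure. **Theories.** A rewrite rule is a triple $l\longrightarrow^{\Gamma}r$ with $\Gamma$ a context and $l,r$ $\beta$-normal; it is well-typed in a context $\Sigma$ if, in the $\lambda\Pi$-calculus, $\Sigma,\Gamma$ is well-formed and $l,r$ have a common type $A$ in $\Sigma,\Gamma$. A theory $\Sigma,\mathcal R$ is a context $\Sigma$ well-formed in the $\lambda\Pi$-calculus (its variables are called constants) and a set $\mathcal R$ of rewrite rules well-typed in $\Sigma$. $t\,\mathcal R\,u$ (root reduction) means $t=\theta l$, $u=\theta r$ for some rule $l\longrightarrow^\Gamma r$ and substitution $\theta$ of the variables of $\Gamma$. $\beta\mathcal R$ is the union of $\beta$ and $\mathcal R$. **Typing in the $\lambda\Pi$-calculus modulo $\Sigma,\mathcal R$.** (Empty) $[\,]$ is well-formed. (Declaration) if $\Gamma\vdash A:Type$ or $\Gamma\vdash A:Kind$, and $x\notin\Sigma,\Gamma$, then $\Gamma,x:A$ is well-formed. (Sort) if $\Gamma$ is well-formed, $\Gamma\vdash Type:Kind$. (Variable) if $\Gamma$ is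 well-formed and $x:A\in\Sigma,\Gamma$ then $\Gamma\vdash x:A$. For $s\in\{Type,Kind\}$: (Product) if $\Gamma\vdash A:Type$ and $\Gamma,x:A\vdash B:s$ then $\Gamma\vdash\Pi x:A\;B:s$; (Abstraction) if moreover $\Gamma,x:A\vdash t:B$ then $\Gamma\vdash\lambda x:A\;t:\Pi x:A\;B$. (Application) if $\Gamma\vdash t:\Pi x:A\;B$ and $\Gamma\vdash u:A$ then $\Gamma\vdash(t\,u):(u/x)B$. (Conversion) for $s\in\{Type,Kind\}$, if $\Gamma\vdash A:s$, $\Gamma\vdash B:s$, $\Gamma\vdash t:A$ and $A\equiv_{\beta\mathcal R}B$ then $\Gamma\vdash t:B$. The plain $\lambda\Pi$-calculus is the case where $\Sigma$ and $\mathcal R$ are empty. Throughout, $\longrightarrow^1_{\beta\mathcal R}$ is assumed confluent and to have the subject reduction property. **$\Pi$-algebras.** A $\Pi$-algebra is a set $\mathcal B$ with a pre-order $\le$, an element $\tilde\top$, a function $\tilde\wedge:\mathcal B\times\mathcal B\to\mathcal B$, a subset $\mathcal A$ of the set $\mathcal P^+(\mathcal B)$ of non-empty subsets of $\mathcal B$, and a function $\tilde\Pi:\mathcal B\times\mathcal A\to\mathcal B$, such that $a\le\tilde\top$ for all $a$; $a\,\tilde\wedge\,b$ is a greatest lower bound of $\{a,b\}$; and $a\le\tilde\Pi(b,S)$ iff $a\,\tilde\wedge\,b\le c$ for all $c\in S$. It is full if $\mathcal A=\mathcal P^+(\mathcal B)$. It is ordered if equipped with an order relation $\sqsubseteq$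 on $\mathcal B$ such that $a\sqsubseteq b$ implies $\tilde\Pi(b,S)\sqsubseteq\tilde\Pi(a,S)$ for all $S$, and $S\sqsubseteq T$ implies $\tilde\Pi(a,S)\sqsubseteq\tilde\Pi(a,T)$ for all $a$, where $S\sqsubseteq T$ means that for all $a\in S$ there is $b\in T$ with $a\sqsubseteq b$. An ordered $\Pi$-algebra is complete if every subset of $\mathcal B$ has a least upper bound for $\sqsubseteq$. **Models.** A model is a family $\mathcal D^1,\dots,\mathcal D^n$ ($n\ge2$) of functions. $\mathcal D^i$ maps each term $t$ of type $B$ in some context $\Gamma$ (in the calculus modulo $\Sigma,\mathcal R$), and valuations $\phi_1,\dots,\phi_{i-1}$, where $\phi_j$ maps each $x:A$ of $\Gamma$ to an element of $\mathcal D^j_{A,\phi_1,\dots,\phi_{j-1}}$, to some $\mathcal D^i_{t,\phi_1,\dots,\phi_{i-1}}$, which for $i\ge2$ lies in $\mathcal D^{i-1}_{B,\phi_1,\dots,\phi_{i-2}}$; the functions are also defined on $Kind$ (without membership condition). The value depends only on $t$ and on the values of the valuations on variables free in $t$. Write $\llbracket t\rrbracket_{\phi_1,\dots,\phi_{n-1}}$ for $\mathcal D^n_{t,\phi_1,\dots,\phi_{n-1}}$. It is required that, for all $t,u$ and valuations (with $u$ of the declared type of $x$), $$\llbracket(u/x)t\rrbracket_{\phi_1,\dots,\phi_{n-1}}=\llbracket t\rrbracket_{(\phi_1,x=\mathcal D^1_u),\dots,(\phi_{n-1},x=\mathcal D^{n-1}_{u,\phi_1,\dots,\phi_{n-2}})}.$$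 The model is valued in $\mathcal B$ if $\mathcal D^{n-1}_{Kind,\phi_1,\dots,\phi_{n-2}}=\mathcal D^{n-1}_{Type,\phi_1,\dots,\phi_{n-2}}=\mathcal B$, $\llbracket Kind\rrbracket_{\overline\phi}=\llbracket Type\rrbracket_{\overline\phi}=\tilde\top$, and $$\llbracket\Pi x:C\;D\rrbracket_{\overline\phi}=\tilde\Pi(\llbracket C\rrbracket_{\overline\phi},\{\llbracket D\rrbracket_{(\phi_1,x=c_1),\dots,(\phi_{n-1},x=c_{n-1})}\mid c_1\in\mathcal D^1_C,\dots,c_{n-1}\in\mathcal D^{n-1}_{C,\phi_1,\dots,\phi_{n-2}}\}).$$ A model valued in $\mathcal B$ is a model of $\Sigma,\mathcal R$ if $\llbracket A\rrbracket\ge\tilde\top$ for every constant $c:A$ in $\Sigma$, and for all $A,B$ well-typed in a context $\Gamma$ with $A\equiv_{\beta\mathcal R}B$, all $i$ and all valuations $\overline\phi$, $\mathcal D^i_{A,\overline\phi}=\mathcal D^i_{B,\overline\phi}$. **Super-consistency.** A theory $\Sigma,\mathcal R$ is super-consistent if, for every full, ordered and complete $\Pi$-algebra $\mathcal B$, there exists a model of $\Sigma,\mathcal R$ valued in $\mathcal B$.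
   Formalization: In the substitution condition on models, φ_j is extended by x = D^{j+1}_u instead of the printed x = D^j_u, which need not lie in D^j_A as a valuation requires. -}

module Defs where

open import Data.Fin.Base using (Fin; zero; suc)
open import Data.List.Base using (List; []; _∷_; _++_; map)
open import Data.List.Membership.Propositional using (_∈_; _∉_)
open import Data.List.Relation.Binary.Subset.Propositional using (_⊆_)
open import Data.List.Relation.Unary.All using (All; []; _∷_; lookup)
open import Data.List.Relation.Unary.Any using (here; there)
open import Data.Nat.Base using (ℕ; zero; suc; _≤_; _<_)
open import Data.Nat.Properties using (_≟_)
open import Data.List.Membership.DecPropositional _≟_ using (_∈?_)
open import Data.Product.Base using (Σ-syntax; ∃; ∃-syntax; _×_; _,_; proj₁; proj₂)
open import Data.Sum.Base using (_⊎_)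
open import Function.Base using (_∘_)
open import Function.Bundles using (_⇔_)
open import Level using (Level; 0ℓ) renaming (suc to lsuc)
open import Relation.Binary.Construct.Closure.Equivalence using (EqClosure)
open import Relation.Binary.Core using (Rel)
open import Relation.Binary.Definitions using (Maximum)
open import Relation.Binary.Lattice.Definitions using (Infimum)
open import Relation.Binary.PropositionalEquality.Core using (_≡_; refl; sym) renaming (subst to ≡-subst)
open import Relation.Binary.Rewriting using (IsNormalForm; Confluent)
open import Relation.Binary.Structures using (IsPartialOrder; IsPreorder)
open import Relation.Nullary.Decidable.Core using (does; toWitnessFalse; False)
open import Relation.Nullary.Negation.Core using (¬_)
open import Relation.Unary using (Pred; ∅)
open import Data.Bool.Base using (if_then_else_)

------------------------------------------------------------------------
-- Terms up to α-equivalence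

Name : Set
Name = ℕ

data Sort : Set where
  ⋆ □ : Sort

-- Free variables are names and bound variables are de Bruijn indices, so that
-- α-equivalence is _≡_.  The terms of the calculus are the elements of Term 0;
-- Term n additionally has n dangling bound variables.
data Term (n : ℕ) : Set where
  bound : Fin n → Term n
  var   : Name → Term n
  sort  : Sort → Term n
  pi    : Term n → Term (suc n) → Term n
  lam   : Term n → Term (suc n) → Term n
  app   : Term n → Term n → Term n

pattern Type = sort ⋆
pattern Kind = sort □

ext : ∀ {m n} → (Fin m → Fin n) → Fin (suc m) → Fin (suc n)
ext ρ zero    = zero
ext ρ (suc i) = suc (ρ i)

rename : ∀ {m n} → (Fin m → Fin n) → Term m → Term n
rename ρ (bound i) = bound (ρ i)
rename ρ (var x)   = var x
rename ρ (sort s)  = sort s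
rename ρ (pi A B)  = pi (rename ρ A) (rename (ext ρ) B)
rename ρ (lam A t) = lam (rename ρ A) (rename (ext ρ) t)
rename ρ (app t u) = app (rename ρ t) (rename ρ u)

weaken : ∀ {n} → Term n → Term (suc n)
weaken = rename suc

exts : ∀ {m n} → (Fin m → Term n) → Fin (suc m) → Term (suc n)
exts σ zero    = bound zero
exts σ (suc i) = weaken (σ i)

-- Simultaneous substitution of θ for the names and of σ for the dangling
-- bound variables.
subst : ∀ {m n} → (Name → Term n) → (Fin m → Term n) → Term m → Term n
subst θ σ (bound i) = σ i
subst θ σ (var x)   = θ x
subst θ σ (sort s)  = sort s
subst θ σ (pi A B)  = pi (subst θ σ A) (subst (weaken ∘ θ) (exts σ) B)
subst θ σ (lam A t) = lam (subst θ σ A) (subst (weaken ∘ θ) (exts σ) t)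
subst θ σ (app t u) = app (subst θ σ t) (subst θ σ u)

_⟪_⟫ : ∀ {n} → Term 0 → (Name → Term n) → Term n
t ⟪ θ ⟫ = subst θ (λ ()) t

_↦_ : ∀ {n} → Name → Term n → Name → Term n
(x ↦ u) y = if does (y ≟ x) then u else var y

-- t [ u / x ] is the paper's (u/x)t.
_[_/_] : Term 0 → Term 0 → Name → Term 0
t [ u / x ] = t ⟪ x ↦ u ⟫

close : Name → Term 0 → Term 1
close x t = t ⟪ x ↦ bound zero ⟫

instantiate : ∀ {n} → Term (suc n) → Term n → Term n
instantiate t u = subst var (λ { zero → u ; (suc i) → bound i }) t

infix  30 _[_/_]
infixr 20 Π[_∶_]_ ƛ[_∶_]_ _⇒_

Π[_∶_]_ : Name → Term 0 → Term 0 → Term 0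
Π[ x ∶ A ] B = pi A (close x B)

ƛ[_∶_]_ : Name → Term 0 → Term 0 → Term 0
ƛ[ x ∶ A ] t = lam A (close x t)

_⇒_ : Term 0 → Term 0 → Term 0
A ⇒ B = pi A (weaken B)

fv : ∀ {n} → Term n → List Name
fv (bound i) = []
fv (var x)   = x ∷ []
fv (sort s)  = []
fv (pi A B)  = fv A ++ fv B
fv (lam A t) = fv A ++ fv t
fv (app t u) = fv t ++ fv u

------------------------------------------------------------------------
-- Contexts

Context : Set
Context = List (Name × Term 0)

infixl 10 _▸_∶_
pattern _▸_∶_ Γ x A = (x , A) ∷ Γ

-- Contexts grow at the head of the list, so "Δ followed by Γ" is Γ ++ Δ.
_⨾_ : Context → Context → Context
Δ ⨾ Γ = Γ ++ Δ

dom : Context → List Name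
dom = map proj₁

------------------------------------------------------------------------
-- Reduction

RootRelation : Set₁
RootRelation = ∀ {n} → Rel (Term n) 0ℓ

data Step (r : RootRelation) {n : ℕ} : Rel (Term n) 0ℓ where
  root : ∀ {t u} → r t u → Step r t u
  piˡ  : ∀ {A A′ B} → Step r A A′ → Step r (pi A B) (pi A′ B)
  piʳ  : ∀ {A B B′} → Step r B B′ → Step r (pi A B) (pi A B′)
  lamˡ : ∀ {A A′ t} → Step r A A′ → Step r (lam A t) (lam A′ t)
  lamʳ : ∀ {A t t′} → Step r t t′ → Step r (lam A t) (lam A t′)
  appˡ : ∀ {t t′ u} → Step r t t′ → Step r (app t u) (app t′ u)
  appʳ : ∀ {t u u′} → Step r u u′ → Step r (app t u) (app t u′)

data β {n : ℕ} : Rel (Term n) 0ℓ where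
  beta : ∀ {A t u} → β (app (lam A t) u) (instantiate t u)

βNormal : Term 0 → Set
βNormal = IsNormalForm (Step β)

record Rule : Set where
  constructor rule
  field
    context    : Context
    lhs rhs    : Term 0
    lhs-normal : βNormal lhs
    rhs-normal : βNormal rhs

open Rule

-- The terms being rewritten may lie under binders, hence the arbitrary n; θ
-- substitutes for the variables of the rule's context only.
data Rewrite (R : Pred Rule 0ℓ) {n : ℕ} : Rel (Term n) 0ℓ where
  rewrites : ∀ {ρ} → R ρ → (θ : Name → Term n) →
             (∀ {c} → c ∉ dom (context ρ) → θ c ≡ var c) →
             Rewrite R (lhs ρ ⟪ θ ⟫) (rhs ρ ⟪ θ ⟫)

βR : Pred Rule 0ℓ → RootRelation
βR R t u = β t u ⊎ Rewrite R t u

------------------------------------------------------------------------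
-- The λΠ-calculus modulo S, R

module Calculus (S : Context) (R : Pred Rule 0ℓ) where

  infix 4 _⟶_ _≡βR_ _⊢_∶_

  _⟶_ : Rel (Term 0) 0ℓ
  _⟶_ = Step (βR R)

  _≡βR_ : Rel (Term 0) 0ℓ
  _≡βR_ = EqClosure _⟶_

  data WellFormed : Context → Set
  data _⊢_∶_ : Context → Term 0 → Term 0 → Set

  data WellFormed where
    empty       : WellFormed []
    declaration : ∀ {Γ x A s} → Γ ⊢ A ∶ sort s → x ∉ dom (S ⨾ Γ) →
                  WellFormed (Γ ▸ x ∶ A)

  data _⊢_∶_ where
    sorting     : ∀ {Γ} → WellFormed Γ → Γ ⊢ Type ∶ Kind
    variable′   : ∀ {Γ x A} → WellFormed Γ → (x , A) ∈ S ⨾ Γ → Γ ⊢ var x ∶ A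
    product     : ∀ {Γ x A B s} →
                  Γ ⊢ A ∶ Type → Γ ▸ x ∶ A ⊢ B ∶ sort s →
                  Γ ⊢ Π[ x ∶ A ] B ∶ sort s
    abstraction : ∀ {Γ x A B t s} →
                  Γ ⊢ A ∶ Type → Γ ▸ x ∶ A ⊢ B ∶ sort s → Γ ▸ x ∶ A ⊢ t ∶ B →
                  Γ ⊢ ƛ[ x ∶ A ] t ∶ Π[ x ∶ A ] B
    application : ∀ {Γ x A B t u} →
                  Γ ⊢ t ∶ Π[ x ∶ A ] B → Γ ⊢ u ∶ A →
                  Γ ⊢ app t u ∶ B [ u / x ]
    conversion  : ∀ {Γ A B t s} →
                  Γ ⊢ A ∶ sort s → Γ ⊢ B ∶ sort s → Γ ⊢ t ∶ A → A ≡βR B →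
                  Γ ⊢ t ∶ B

  WellTyped : Context → Term 0 → Set
  WellTyped Γ t = ∃[ B ] Γ ⊢ t ∶ B

  SubjectReduction : Set
  SubjectReduction = ∀ {Γ t u A} → Γ ⊢ t ∶ A → t ⟶ u → Γ ⊢ u ∶ A

module Plain = Calculus [] ∅

record Theory : Set₁ where
  field
    constants   : Context
    rules       : Pred Rule 0ℓ
    well-formed : Plain.WellFormed constants
    well-typed  : ∀ {ρ} → rules ρ →
                  Plain.WellFormed (constants ⨾ context ρ) ×
                  ∃[ A ] (constants ⨾ context ρ Plain.⊢ lhs ρ ∶ A ×
                          constants ⨾ context ρ Plain.⊢ rhs ρ ∶ A)

module CalculusOf (T : Theory) = Calculus (Theory.constants T) (Theory.rules T)

------------------------------------------------------------------------
-- Sets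
--
-- In a model, the elements of the sets 𝒟ⁱ_B may themselves be sets whose
-- elements are again used as values.  The ambient set theory is rendered by
-- Aczel's type of iterative sets, with extensional equality.

data 𝕍 (ℓ : Level) : Set (lsuc ℓ) where
  sup : (I : Set ℓ) → (I → 𝕍 ℓ) → 𝕍 ℓ

module _ {ℓ : Level} where

  infix 4 _≈_ _∈ˢ_ _⊆ˢ_

  Index : 𝕍 ℓ → Set ℓ
  Index (sup I f) = I

  elem : (a : 𝕍 ℓ) → Index a → 𝕍 ℓ
  elem (sup I f) = f

  _≈_ : 𝕍 ℓ → 𝕍 ℓ → Set ℓ
  sup I f ≈ sup J g = (∀ i → ∃[ j ] f i ≈ g j) × (∀ j → ∃[ i ] f i ≈ g j)

  _∈ˢ_ : 𝕍 ℓ → 𝕍 ℓ → Set ℓ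
  x ∈ˢ a = ∃[ i ] x ≈ elem a i

  _⊆ˢ_ : 𝕍 ℓ → 𝕍 ℓ → Set ℓ
  a ⊆ˢ b = ∀ i → elem a i ∈ˢ b

  Nonempty : 𝕍 ℓ → Set ℓ
  Nonempty = Index

------------------------------------------------------------------------
-- Π-algebras

-- An element of the set 𝓑 is given by an index; distinct indices may denote
-- the same element, so operations come with their compatibility with _≋_.
record ΠAlgebra (ℓ : Level) : Set (lsuc ℓ) where
  infix 4 _≋_ _≤ᴮ_
  field
    𝓑 : 𝕍 ℓ

  Carrier : Set ℓ
  Carrier = Index 𝓑

  ⟨_⟩ : Carrier → 𝕍 ℓ
  ⟨_⟩ = elem 𝓑

  _≋_ : Rel Carrier ℓ
  a ≋ b = ⟨ a ⟩ ≈ ⟨ b ⟩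

  𝓟⁺ : Pred (𝕍 ℓ) ℓ
  𝓟⁺ S = S ⊆ˢ 𝓑 × Nonempty S

  field
    _≤ᴮ_       : Rel Carrier ℓ
    isPreorder : IsPreorder _≋_ _≤ᴮ_
    ⊤̃          : Carrier
    _∧̃_        : Carrier → Carrier → Carrier
    𝓐          : Pred (𝕍 ℓ) ℓ
    𝓐⊆𝓟⁺       : ∀ {S} → 𝓐 S → 𝓟⁺ S
    Π̃          : Carrier → (S : 𝕍 ℓ) → 𝓐 S → Carrier

    ∧̃-cong     : ∀ {a a′ b b′} → a ≋ a′ → b ≋ b′ → (a ∧̃ b) ≋ (a′ ∧̃ b′)
    𝓐-resp     : ∀ {S T} → S ≈ T → 𝓐 S → 𝓐 T
    Π̃-cong     : ∀ {a b S T} (p : 𝓐 S) (q : 𝓐 T) →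
                 a ≋ b → S ≈ T → Π̃ a S p ≋ Π̃ b T q

    ⊤̃-maximum  : Maximum _≤ᴮ_ ⊤̃
    ∧̃-infimum  : Infimum _≤ᴮ_ _∧̃_
    Π̃-residual : ∀ {a b S} (p : 𝓐 S) →
                 a ≤ᴮ Π̃ b S p ⇔ (∀ c → ⟨ c ⟩ ∈ˢ S → (a ∧̃ b) ≤ᴮ c)

module _ {ℓ : Level} (𝔅 : ΠAlgebra ℓ) where
  open ΠAlgebra 𝔅

  Full : Set (lsuc ℓ)
  Full = ∀ {S} → 𝓟⁺ S → 𝓐 S

  record Ordering : Set (lsuc ℓ) where
    infix 4 _⊑_
    field
      _⊑_            : Rel Carrier ℓ
      isPartialOrder : IsPartialOrder _≋_ _⊑_

    _⊑ˢ_ : 𝕍 ℓ → 𝕍 ℓ → Set ℓ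
    S ⊑ˢ T = ∀ a → ⟨ a ⟩ ∈ˢ S → ∃[ b ] (⟨ b ⟩ ∈ˢ T × a ⊑ b)

    field
      Π̃-antitone : ∀ {a b S} (p : 𝓐 S) → a ⊑ b → Π̃ b S p ⊑ Π̃ a S p
      Π̃-monotone : ∀ {a S T} (p : 𝓐 S) (q : 𝓐 T) →
                   S ⊑ˢ T → Π̃ a S p ⊑ Π̃ a T q

  Complete : Ordering → Set (lsuc ℓ)
  Complete O = ∀ S → S ⊆ˢ 𝓑 →
    ∃[ l ] ((∀ a → ⟨ a ⟩ ∈ˢ S → a ⊑ l) ×
            (∀ u → (∀ a → ⟨ a ⟩ ∈ˢ S → a ⊑ u) → l ⊑ u))
    where open Ordering O

------------------------------------------------------------------------
-- Models

-- Levels are counted from 0: φ j is the paper's φ_{j+1}.  Only the values of φ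
-- on the variables of the context at hand are meaningful.
Valuations : (ℓ : Level) → Set (lsuc ℓ)
Valuations ℓ = ℕ → Name → 𝕍 ℓ

_⟨_≔_⟩ : ∀ {ℓ} → Valuations ℓ → Name → (ℕ → 𝕍 ℓ) → Valuations ℓ
(φ ⟨ x ≔ c ⟩) j y = if does (y ≟ x) then c j else φ j y

-- The family 𝒟¹,…,𝒟ⁿ with n = top + 1 and top = k + 1, so that n ≥ 2 and
-- D i is 𝒟ⁱ⁺¹.  For convenience D is total: i ranges over ℕ, and D i t φ is
-- defined for all t and φ, but it is constrained only where the paper's
-- 𝒟ⁱ⁺¹ is defined, i.e. if i ≤ top, t is Kind or well-typed in some Γ, and φ 0,
-- …, φ (i-1) are valuations for Γ; its other values are irrelevant.
record Model (T : Theory) (ℓ : Level) : Set (lsuc ℓ) where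
  open CalculusOf T

  field
    k : ℕ

  top : ℕ
  top = suc k

  field
    D : ℕ → Term 0 → Valuations ℓ → 𝕍 ℓ

  -- φ 0, …, φ (i-1) are valuations for Γ.
  _⊨[_]_ : Valuations ℓ → ℕ → Context → Set ℓ
  φ ⊨[ i ] Γ = ∀ {j x A} → j < i → (x , A) ∈ Γ → φ j x ∈ˢ D j A φ

  Defined : Context → Term 0 → Set
  Defined Γ t = WellTyped Γ t ⊎ (WellFormed Γ × t ≡ Kind)

  ⟦_⟧ : Term 0 → Valuations ℓ → 𝕍 ℓ
  ⟦ t ⟧ φ = D top t φ

  field
    membership : ∀ {Γ t B i φ} → Γ ⊢ t ∶ B → i < top → φ ⊨[ suc i ] Γ →
                 D (suc i) t φ ∈ˢ D i B φ

    -- A free variable of t is either a constant or a variable of Γ, and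
    -- valuations are given on the latter only.
    locality : ∀ {Γ Γ′ t i φ φ′} → Defined Γ t → Defined Γ′ t → i ≤ top →
               φ ⊨[ i ] Γ → φ′ ⊨[ i ] Γ′ →
               (∀ {j x} → j < i → x ∈ fv t → x ∈ dom Γ → φ j x ≈ φ′ j x) →
               D i t φ ≈ D i t φ′

    -- Since φ_j maps x : A into 𝒟ʲ_A, and it is 𝒟ʲ⁺¹_u which belongs to 𝒟ʲ_A, the
    -- valuation φ_j is extended by x = 𝒟ʲ⁺¹_u.  The equation is required
    -- whenever both of its sides are defined.
    substitution : ∀ {Γ Γ′ x A t u φ} →
                   Defined Γ′ t → (x , A) ∈ Γ′ → Γ ⊢ u ∶ A →
                   Defined Γ (t [ u / x ]) → φ ⊨[ top ] Γ →
                   let φ′ = φ ⟨ x ≔ (λ j → D (suc j) u φ) ⟩ in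
                   φ′ ⊨[ top ] Γ′ →
                   ⟦ t [ u / x ] ⟧ φ ≈ ⟦ t ⟧ φ′

module _ {T : Theory} {ℓ : Level} (M : Model T ℓ) (𝔅 : ΠAlgebra ℓ) where
  open CalculusOf T
  open Model M
  open ΠAlgebra 𝔅

  -- z belongs to { ⟦B⟧_{(φ₁,x=c₁),…} | c₁ ∈ 𝒟¹_A, …, c_{n-1} ∈ 𝒟ⁿ⁻¹_A }.
  Instance : Valuations ℓ → Name → Term 0 → Term 0 → 𝕍 ℓ → Set (lsuc ℓ)
  Instance φ x A B z =
    ∃[ c ] ((∀ {j} → j < top → c j ∈ˢ D j A φ) × z ≈ ⟦ B ⟧ (φ ⟨ x ≔ c ⟩))

  record ValuedIn : Set (lsuc ℓ) where
    field
      D-Kind : ∀ φ → D k Kind φ ≈ 𝓑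
      D-Type : ∀ φ → D k Type φ ≈ 𝓑
      ⟦Kind⟧ : ∀ φ → ⟦ Kind ⟧ φ ≈ ⟨ ⊤̃ ⟩
      ⟦Type⟧ : ∀ φ → ⟦ Type ⟧ φ ≈ ⟨ ⊤̃ ⟩
      ⟦Π⟧    : ∀ {Γ x A B s φ} →
               Γ ⊢ A ∶ Type → Γ ▸ x ∶ A ⊢ B ∶ sort s → φ ⊨[ top ] Γ →
               Σ[ a ∈ Carrier ] Σ[ S ∈ 𝕍 ℓ ] Σ[ p ∈ 𝓐 S ]
                 (⟦ A ⟧ φ ≈ ⟨ a ⟩ ×
                  (∀ z → z ∈ˢ S ⇔ Instance φ x A B z) ×
                  ⟦ Π[ x ∶ A ] B ⟧ φ ≈ ⟨ Π̃ a S p ⟩)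

  record IsModelOf : Set (lsuc ℓ) where
    field
      valued-in : ValuedIn
      validity  : ∀ {c A} → (c , A) ∈ Theory.constants T →
                  ∀ φ → ∃[ a ] (⟦ A ⟧ φ ≈ ⟨ a ⟩ × ⊤̃ ≤ᴮ a)
      convertibility : ∀ {Γ A B i φ} →
                       WellTyped Γ A → WellTyped Γ B → A ≡βR B →
                       i ≤ top → φ ⊨[ i ] Γ → D i A φ ≈ D i B φ

SuperConsistent : (ℓ : Level) → Theory → Set (lsuc ℓ)
SuperConsistent ℓ T =
  (𝔅 : ΠAlgebra ℓ) → Full 𝔅 → (O : Ordering 𝔅) → Complete 𝔅 O →
  Σ[ M ∈ Model T ℓ ] IsModelOf M 𝔅

------------------------------------------------------------------------
-- The Calculus of constructions

private
  ‵type ‵o ‵η ‵ε ‵KK ‵TT ‵KT ‵TK ‵x ‵y ‵z : Name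
  ‵type = 0
  ‵o    = 1
  ‵η    = 2
  ‵ε    = 3
  ‵KK   = 4
  ‵TT   = 5
  ‵KT   = 6
  ‵TK   = 7
  ‵x    = 8
  ‵y    = 9
  ‵z    = 10

type o x y z : Term 0
type = var ‵type
o    = var ‵o
x    = var ‵x
y    = var ‵y
z    = var ‵z

η ε : Term 0 → Term 0
η t = app (var ‵η) t
ε t = app (var ‵ε) t

Π̇KK Π̇TT Π̇KT Π̇TK : Term 0 → Term 0 → Term 0
Π̇KK t u = app (app (var ‵KK) t) u
Π̇TT t u = app (app (var ‵TT) t) u
Π̇KT t u = app (app (var ‵KT) t) u
Π̇TK t u = app (app (var ‵TK) t) u

signature₀ signature : Context
signature₀ = []
  ▸ ‵type ∶ Type
  ▸ ‵o    ∶ type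
  ▸ ‵η    ∶ type ⇒ Type
  ▸ ‵ε    ∶ η o ⇒ Type
signature = signature₀
  ▸ ‵KK   ∶ Π[ ‵x ∶ type ] (η x ⇒ type) ⇒ type
  ▸ ‵TT   ∶ Π[ ‵x ∶ η o ]  (ε x ⇒ η o)  ⇒ η o
  ▸ ‵KT   ∶ Π[ ‵x ∶ type ] (η x ⇒ η o)  ⇒ η o
  ▸ ‵TK   ∶ Π[ ‵x ∶ η o ]  (ε x ⇒ type) ⇒ type

private
  βnf-var : ∀ {n a} → IsNormalForm (Step β {n}) (var a)
  βnf-var (_ , root ())

  βnf-bound : ∀ {n i} → IsNormalForm (Step β {n}) (bound i)
  βnf-bound (_ , root ())

  βnf-pi : ∀ {n A B} → IsNormalForm (Step β {n}) A → IsNormalForm (Step β) B →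
           IsNormalForm (Step β) (pi A B)
  βnf-pi nA nB (_ , root ())
  βnf-pi nA nB (_ , piˡ r) = nA (_ , r)
  βnf-pi nA nB (_ , piʳ r) = nB (_ , r)

  βnf-app-var : ∀ {n a u} → IsNormalForm (Step β {n}) u →
                IsNormalForm (Step β) (app (var a) u)
  βnf-app-var nu (_ , root ())
  βnf-app-var nu (_ , appˡ r) = βnf-var (_ , r)
  βnf-app-var nu (_ , appʳ r) = nu (_ , r)

  βnf-app-app : ∀ {n t u v} → IsNormalForm (Step β {n}) (app t u) →
                IsNormalForm (Step β) v →
                IsNormalForm (Step β) (app (app t u) v)
  βnf-app-app nt nv (_ , root ())
  βnf-app-app nt nv (_ , appˡ r) = nt (_ , r)
  βnf-app-app nt nv (_ , appʳ r) = nv (_ , r)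

  lhs-βnf : ∀ {a b} → βNormal (app (var a) (app (app (var b) x) y))
  lhs-βnf = βnf-app-var (βnf-app-app (βnf-app-var βnf-var) βnf-var)

  rhs-βnf : ∀ {a b} →
            βNormal (pi (app (var a) x) (app (var b) (app (var ‵y) (bound zero))))
  rhs-βnf = βnf-pi (βnf-app-var βnf-var)
                   (βnf-app-var (βnf-app-var βnf-bound))

ruleKK ruleTT ruleKT ruleTK : Rule
ruleKK = rule ([] ▸ ‵x ∶ type ▸ ‵y ∶ η x ⇒ type)
  (η (Π̇KK x y)) (Π[ ‵z ∶ η x ] η (app y z)) lhs-βnf rhs-βnf
ruleTT = rule ([] ▸ ‵x ∶ η o ▸ ‵y ∶ ε x ⇒ η o)
  (ε (Π̇TT x y)) (Π[ ‵z ∶ ε x ] ε (app y z)) lhs-βnf rhs-βnf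
ruleKT = rule ([] ▸ ‵x ∶ type ▸ ‵y ∶ η x ⇒ η o)
  (ε (Π̇KT x y)) (Π[ ‵z ∶ η x ] ε (app y z)) lhs-βnf rhs-βnf
ruleTK = rule ([] ▸ ‵x ∶ η o ▸ ‵y ∶ ε x ⇒ type)
  (η (Π̇TK x y)) (Π[ ‵z ∶ ε x ] η (app y z)) lhs-βnf rhs-βnf

CoCRules : List Rule
CoCRules = ruleKK ∷ ruleTT ∷ ruleKT ∷ ruleTK ∷ []

private
  open Plain

  Undeclared : Name → Context → Set
  Undeclared a Γ = False (a ∈? dom ([] ⨾ Γ))

  record Extends₀ (Γ : Context) : Set where
    constructor extends₀
    field
      wf        : WellFormed Γ
      inclusion : signature₀ ⊆ [] ⨾ Γ
  open Extends₀

  declare : ∀ {Γ a A s} → Γ ⊢ A ∶ sort s → {Undeclared a Γ} →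
            WellFormed (Γ ▸ a ∶ A)
  declare ⊢A {fresh} = declaration ⊢A (toWitnessFalse fresh)

  extend : ∀ {Γ a A s} → Extends₀ Γ → Γ ⊢ A ∶ sort s → {Undeclared a Γ} →
           Extends₀ (Γ ▸ a ∶ A)
  extend E ⊢A {fresh} = extends₀ (declare ⊢A {fresh}) (there ∘ inclusion E)

  ⊢arrow : ∀ {Γ A B s} a → close a B ≡ weaken B →
           Γ ⊢ A ∶ Type → Γ ▸ a ∶ A ⊢ B ∶ sort s → Γ ⊢ A ⇒ B ∶ sort s
  ⊢arrow {Γ} {A} {s = s} a eq ⊢A ⊢B =
    ≡-subst (λ B → Γ ⊢ pi A B ∶ sort s) eq (product ⊢A ⊢B)

  ⊢app : ∀ {Γ A B t u} a → close a B ≡ weaken B → B [ u / a ] ≡ B →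
         Γ ⊢ t ∶ A ⇒ B → Γ ⊢ u ∶ A → Γ ⊢ app t u ∶ B
  ⊢app {Γ} {A} {B} {t} {u} a eq eq′ ⊢t ⊢u =
    ≡-subst (λ B → Γ ⊢ app t u ∶ B) eq′
      (application {x = a} {B = B}
        (≡-subst (λ B → Γ ⊢ t ∶ pi A B) (sym eq) ⊢t) ⊢u)

  ⊢type : ∀ {Γ} → Extends₀ Γ → Γ ⊢ type ∶ Type
  ⊢type E = variable′ (wf E) (inclusion E (there (there (there (here refl)))))

  ⊢o : ∀ {Γ} → Extends₀ Γ → Γ ⊢ o ∶ type
  ⊢o E = variable′ (wf E) (inclusion E (there (there (here refl))))

  ⊢η : ∀ {Γ t} → Extends₀ Γ → Γ ⊢ t ∶ type → Γ ⊢ η t ∶ Type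
  ⊢η E = ⊢app ‵z refl refl
           (variable′ (wf E) (inclusion E (there (here refl))))

  ⊢ηo : ∀ {Γ} → Extends₀ Γ → Γ ⊢ η o ∶ Type
  ⊢ηo E = ⊢η E (⊢o E)

  ⊢ε : ∀ {Γ t} → Extends₀ Γ → Γ ⊢ t ∶ η o → Γ ⊢ ε t ∶ Type
  ⊢ε E = ⊢app ‵z refl refl (variable′ (wf E) (inclusion E (here refl)))

  E₀ : Extends₀ signature₀
  E₀ = extends₀ wf₄ (λ i → i)
    where
    wf₁ : WellFormed ([] ▸ ‵type ∶ Type)
    wf₁ = declare (sorting empty)
    wf₂ : WellFormed ([] ▸ ‵type ∶ Type ▸ ‵o ∶ type)
    wf₂ = declare (variable′ wf₁ (here refl))
    ⊢type₂ = variable′ wf₂ (there (here refl))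
    wf₃ : WellFormed ([] ▸ ‵type ∶ Type ▸ ‵o ∶ type ▸ ‵η ∶ type ⇒ Type)
    wf₃ = declare (⊢arrow ‵z refl ⊢type₂ (sorting (declare ⊢type₂)))
    ⊢ηo₃ = ⊢app ‵z refl refl (variable′ wf₃ (here refl))
             (variable′ wf₃ (there (here refl)))
    wf₄ : WellFormed signature₀
    wf₄ = declare (⊢arrow ‵z refl ⊢ηo₃ (sorting (declare ⊢ηo₃)))

  -- The type of each Π̇ symbol is Π x:P ((Q → R) → R), where P and R are type
  -- or η o and Q is η x or ε x, and the context of its rule is x : P, y : Q → R.
  module Shape
    (P Q R : Term 0)
    (⊢P : ∀ {Γ} → Extends₀ Γ → Γ ⊢ P ∶ Type)
    (⊢Q : ∀ {Γ} → Extends₀ Γ → Γ ⊢ x ∶ P → Γ ⊢ Q ∶ Type)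
    (⊢R : ∀ {Γ} → Extends₀ Γ → Γ ⊢ R ∶ Type)
    (z∉R : close ‵z R ≡ weaken R)
    where

    module _ {Γ} (E : Extends₀ Γ) {x-fresh : Undeclared ‵x Γ} where

      E₁ : Extends₀ (Γ ▸ ‵x ∶ P)
      E₁ = extend E (⊢P E) {x-fresh}

      ⊢Q₁ : Γ ▸ ‵x ∶ P ⊢ Q ∶ Type
      ⊢Q₁ = ⊢Q E₁ (variable′ (wf E₁) (here refl))

      ⊢Q⇒R : {Undeclared ‵z (Γ ▸ ‵x ∶ P)} → Γ ▸ ‵x ∶ P ⊢ Q ⇒ R ∶ Type
      ⊢Q⇒R {z-fresh} = ⊢arrow ‵z z∉R ⊢Q₁ (⊢R (extend E₁ ⊢Q₁ {z-fresh}))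

      formation : {Undeclared ‵z (Γ ▸ ‵x ∶ P)} →
                  Γ ⊢ Π[ ‵x ∶ P ] (Q ⇒ R) ⇒ R ∶ Type
      formation {z-fresh} =
        product (⊢P E)
          (⊢arrow ‵z z∉R (⊢Q⇒R {z-fresh})
            (⊢R (extend E₁ (⊢Q⇒R {z-fresh}) {z-fresh})))

    module _
      (c : Name) (G : Term 0 → Term 0)
      (⊢G : ∀ {Γ t} → Extends₀ Γ → Γ ⊢ t ∶ R → Γ ⊢ G t ∶ Type)
      (x∉type : ((Q ⇒ R) ⇒ R) [ x / ‵x ] ≡ (Q ⇒ R) ⇒ R)
      (y∉R : R [ y / ‵z ] ≡ R) (z∉R′ : R [ z / ‵z ] ≡ R)
      {Γ} (E : Extends₀ Γ)
      (c∈ : (c , Π[ ‵x ∶ P ] (Q ⇒ R) ⇒ R) ∈ [] ⨾ Γ)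
      {x-fresh : Undeclared ‵x Γ} {z-fresh : Undeclared ‵z (Γ ▸ ‵x ∶ P)}
      {y-fresh : Undeclared ‵y (Γ ▸ ‵x ∶ P)}
      {z-fresh′ : Undeclared ‵z (Γ ▸ ‵x ∶ P ▸ ‵y ∶ Q ⇒ R)}
      where

      private
        Γ₂ : Context
        Γ₂ = Γ ▸ ‵x ∶ P ▸ ‵y ∶ Q ⇒ R

        E₂ : Extends₀ Γ₂
        E₂ = extend (E₁ E {x-fresh}) (⊢Q⇒R E {x-fresh} {z-fresh}) {y-fresh}

        ⊢x : Γ₂ ⊢ x ∶ P
        ⊢x = variable′ (wf E₂) (there (here refl))

        ⊢y : Γ₂ ⊢ y ∶ Q ⇒ R
        ⊢y = variable′ (wf E₂) (here refl)

        ⊢cx : Γ₂ ⊢ app (var c) x ∶ (Q ⇒ R) ⇒ R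
        ⊢cx = ≡-subst (λ B → Γ₂ ⊢ app (var c) x ∶ B) x∉type
                (application {x = ‵x} {B = (Q ⇒ R) ⇒ R}
                  (variable′ (wf E₂) (there (there c∈))) ⊢x)

        E₃ : Extends₀ (Γ₂ ▸ ‵z ∶ Q)
        E₃ = extend E₂ (⊢Q E₂ ⊢x) {z-fresh′}

        ⊢yz : Γ₂ ▸ ‵z ∶ Q ⊢ app y z ∶ R
        ⊢yz = ⊢app ‵z z∉R z∉R′ (variable′ (wf E₃) (there (here refl)))
                (variable′ (wf E₃) (here refl))

      rule-typed :
        WellFormed Γ₂ ×
        ∃[ A ] (Γ₂ ⊢ G (app (app (var c) x) y) ∶ A ×
                Γ₂ ⊢ Π[ ‵z ∶ Q ] G (app y z) ∶ A)
      rule-typed =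
        wf E₂ , Type ,
        ⊢G E₂ (⊢app ‵z z∉R y∉R ⊢cx ⊢y) ,
        product (⊢Q E₂ ⊢x) (⊢G E₃ ⊢yz)

  module KK = Shape type (η x) type ⊢type ⊢η ⊢type refl
  module TT = Shape (η o) (ε x) (η o) ⊢ηo ⊢ε ⊢ηo refl
  module KT = Shape type (η x) (η o) ⊢type ⊢η ⊢ηo refl
  module TK = Shape (η o) (ε x) type ⊢ηo ⊢ε ⊢type refl

  E₄ = extend {a = ‵KK} E₀ (KK.formation E₀)
  E₅ = extend {a = ‵TT} E₄ (TT.formation E₄)
  E₆ = extend {a = ‵KT} E₅ (KT.formation E₅)

  E : Extends₀ signature
  E = extend {a = ‵TK} E₆ (TK.formation E₆)

  CoCRules-typed : All (λ ρ →
    WellFormed (signature ⨾ context ρ) ×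
    ∃[ A ] (signature ⨾ context ρ ⊢ lhs ρ ∶ A ×
            signature ⨾ context ρ ⊢ rhs ρ ∶ A)) CoCRules
  CoCRules-typed =
    KK.rule-typed ‵KK η ⊢η refl refl refl E (there (there (there (here refl)))) ∷
    TT.rule-typed ‵TT ε ⊢ε refl refl refl E (there (there (here refl))) ∷
    KT.rule-typed ‵KT ε ⊢ε refl refl refl E (there (here refl)) ∷
    TK.rule-typed ‵TK η ⊢η refl refl refl E (here refl) ∷
    []

CoC : Theory
CoC = record
  { constants   = signature
  ; rules       = _∈ CoCRules
  ; well-formed = wf E
  ; well-typed  = lookup CoCRules-typed
  }

{-# OPTIONS --safe #-}
module Submission where

-- The model consists of four functions D 0, …, D 3 (numbered as in Model), each
-- of which is defined by recursion on raw terms, so that substitution and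
-- locality hold independently of typing.  D 2 interprets a type as a set of
-- possible values of its elements at the last level, where types take values
-- in 𝓑.  The sets needed at D 2 are named by codes: U₀, the value D 1 of the
-- constant type, contains the simple types over 𝓑, and the Π̇ symbols act on
-- it; U₁, the value D 1 of Type, contains U₀ and is closed under dependent
-- products; U₂ = D 0 Type contains U₀, {∅} and their function spaces.
-- Propositions have no relevant proofs: D 1 and D 2 of ε p are {∅}.  This
-- agrees with the rewrite rules since, with functions encoded by their traces,
-- the functions from any set to {∅} form {∅} again.
--
-- β-reduction is only valid for arguments in the domain, so that soundness of
-- typing and invariance under conversion depend on each other.  The levels
-- break this circle: for D (j + 1), typing requires invariance of D j, and
-- invariance requires typing at the levels up to j + 1.

open import Data.Bool.Base using (Bool; true; false; if_then_else_; not) renaming (T to IsTrue)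
open import Data.Empty using (⊥; ⊥-elim)
open import Data.Empty.Polymorphic using () renaming (⊥ to ⊥ₗ; ⊥-elim to ⊥ₗ-elim)
open import Data.Fin.Base using (Fin; zero; suc)
open import Data.List.Base using (List; []; _∷_; _++_)
open import Data.List.Membership.Propositional using (_∈_; _∉_)
open import Data.List.Membership.Propositional.Properties using (∈-++⁺ˡ; ∈-++⁺ʳ; ∈-++⁻; ∈-map⁺)
open import Data.List.Properties using (map-++)
open import Data.List.Relation.Unary.Any using (here; there)
open import Data.Maybe.Base using (Maybe; just; nothing; fromMaybe; maybe)
open import Data.Maybe.Properties using (just-injective)
open import Data.Nat.Base using (ℕ; zero; suc; _<_; _≤_; z≤n; s≤s; z<s; s<s)
open import Data.Nat.Properties using (_≟_; <-≤-trans; ≤-refl; ≤-trans; n≤1+n; <⇒≤; m<1+n⇒m<n∨m≡n)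
open import Data.List.Membership.DecPropositional _≟_ using (_∈?_)
open import Data.Product.Base using (Σ-syntax; ∃-syntax; _×_; _,_; proj₁; proj₂)
open import Data.Sum.Base using (_⊎_; inj₁; inj₂; [_,_]′)
open import Data.Unit.Base using (⊤)
open import Data.Unit.Polymorphic.Base using () renaming (⊤ to ⊤ₗ; tt to ttₗ)
open import Function.Base using (_∘_; id)
open import Function.Bundles using (_⇔_; mk⇔; Equivalence)
open import Level using (Level; Lift; lift; 0ℓ)
open import Relation.Binary.Core using (Rel)
open import Relation.Binary.Construct.Closure.Equivalence using (EqClosure)
open import Relation.Binary.Construct.Closure.ReflexiveTransitive using (Star; _◅_; _◅◅_; gmap; reverse) renaming (ε to ε*)
open import Relation.Binary.Construct.Closure.Symmetric using (fwd; bwd)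
import Relation.Binary.Construct.Closure.Symmetric as SymClosure
open import Relation.Binary.PropositionalEquality using (_≡_; _≢_; refl; sym; trans; cong; cong₂; module ≡-Reasoning) renaming (subst to ≡-subst; subst₂ to ≡-subst₂)
open import Relation.Binary.Rewriting using (Confluent)
open import Relation.Binary.Structures using (IsPreorder)
open import Relation.Nullary.Decidable.Core using (does; proof; yes; no; False; toWitnessFalse)
open import Relation.Nullary.Negation.Core using (¬_; contradiction)
open import Relation.Nullary.Reflects using (ofʸ; ofⁿ)
open import Relation.Unary using (Pred)
open import Defs

-- Functions as sets

-- Two features of the theory decide which sets are needed. The type `o` is impredicative: `Π̇KT`
-- may quantify over `η o` and lands in `o` again. This is harmless because {∅} is closed under
-- products over any set, and because the truth value of a product is computed in 𝓑, however large
-- the domain.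
--
-- The type `type` is closed under dependent products, yet simple types suffice for it. The
-- interpretation is causal: component `j` of a value uses only the components up to `j` of its
-- arguments (`Ext`). The first two components of an element of `η x` or `ε x` are always ∅, so a
-- family of members of `U₀` over such a domain is constant. Causality also orders the universes:
-- products at component 1 are indexed by sets already built at component 0, so plain inductive
-- types of codes are enough.
--
-- The induction on levels starts from a syntactic fact: on typed terms `D 0` only tells kinds from
-- other terms, and conversion cannot identify a kind with anything else.

module _ {ℓ : Level} where

  private
    V : Set _
    V = 𝕍 ℓ

  ∅ one : V
  ∅ = sup ⊥ₗ λ ()
  one = sup ⊤ₗ λ _ → ∅

  ｛_｝ : V → V
  ｛ a ｝ = sup ⊤ₗ λ _ → a

  infix 4 _≐_ _∈̇_

  -- Opaque copies of _≈_ and _∈ˢ_, whose arguments can be inferred.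
  opaque

    _≐_ _∈̇_ : V → V → Set ℓ
    _≐_ = _≈_
    _∈̇_ = _∈ˢ_

    ≈⇒≐ : {a b : V} → a ≈ b → a ≐ b
    ≈⇒≐ e = e

    ≐⇒≈ : {a b : V} → a ≐ b → a ≈ b
    ≐⇒≈ e = e

    ∈ˢ⇒∈̇ : {a b : V} → a ∈ˢ b → a ∈̇ b
    ∈ˢ⇒∈̇ e = e

    ∈̇⇒∈ˢ : {a b : V} → a ∈̇ b → a ∈ˢ b
    ∈̇⇒∈ˢ e = e

    index : {a X : V} → a ∈̇ X → ∃[ i ] a ≐ elem X i
    index p = p

    element : {a X : V} → ∃[ i ] a ≐ elem X i → a ∈̇ X
    element p = p

    sup-cong⁻ : {I J : Set ℓ} {f : I → V} {g : J → V} → sup I f ≐ sup J g →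
                (∀ i → ∃[ j ] f i ≐ g j) × (∀ j → ∃[ i ] f i ≐ g j)
    sup-cong⁻ e = e


    ≐-refl : {a : V} → a ≐ a
    ≐-refl {sup I f} = (λ i → i , ≐-refl) , (λ i → i , ≐-refl)

    ≐-sym : {a b : V} → a ≐ b → b ≐ a
    ≐-sym {sup I f} {sup J g} (p , q) =
      (λ j → let i , e = q j in i , ≐-sym e) ,
      (λ i → let j , e = p i in j , ≐-sym e)

    ≐-trans : {a b c : V} → a ≐ b → b ≐ c → a ≐ c
    ≐-trans {sup I f} {sup J g} {sup K h} (p , q) (r , s) =
      (λ i → let j , e = p i ; k , e′ = r j in k , ≐-trans e e′) ,
      (λ k → let j , e = s k ; i , e′ = q j in i , ≐-trans e′ e)

    ≐⇒⊆ : {a b : V} → a ≐ b → ∀ i → elem a i ∈̇ b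
    ≐⇒⊆ {sup I f} {sup J g} = proj₁

    ⊆-antisym : {a b : V} → (∀ i → elem a i ∈̇ b) → (∀ i → elem b i ∈̇ a) → a ≐ b
    ⊆-antisym {sup I f} {sup J g} p q = p , λ j → let i , e = q j in i , ≐-sym e

    ∈-resp : {x y a b : V} → x ≐ y → a ≐ b → x ∈̇ a → y ∈̇ b
    ∈-resp e e′ (i , e″) =
      let j , e‴ = ≐⇒⊆ e′ i in j , ≐-trans (≐-sym e) (≐-trans e″ e‴)

    elem∈ : (a : V) (i : Index a) → elem a i ∈̇ a
    elem∈ a i = i , ≐-refl

    ∈one : {a : V} → a ∈̇ one → a ≐ ∅
    ∈one = proj₂

    ∅∈one : ∅ ∈̇ one
    ∅∈one = _ , ≐-refl

    ｛｝-cong : {a b : V} → a ≐ b → ｛ a ｝ ≐ ｛ b ｝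
    ｛｝-cong e = (λ i → i , e) , (λ i → i , e)

    -- Description: ⋃ { f i | P i }, which is f i whenever P i holds and f is
    -- constant on P.
    the : {I : Set ℓ} → (I → Set ℓ) → (I → V) → V
    the {I} P f = sup (Σ[ i ∈ I ] P i × Index (f i)) λ (i , _ , k) → elem (f i) k

    the-unique : {I : Set ℓ} {P : I → Set ℓ} {f : I → V} {i : I} →
                 P i → (∀ {j} → P j → f j ≐ f i) → the P f ≐ f i
    the-unique {i = i} p u = ⊆-antisym
      (λ (j , q , k) → ≐⇒⊆ (u q) k)
      (λ k → (i , p , k) , ≐-refl)

    the-cong : {I J : Set ℓ} {P : I → Set ℓ} {Q : J → Set ℓ} {f : I → V} {g : J → V} →
               (∀ {i} → P i → ∃[ j ] Q j × f i ≐ g j) →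
               (∀ {j} → Q j → ∃[ i ] P i × f i ≐ g j) → the P f ≐ the Q g
    the-cong h h′ = ⊆-antisym
      (λ (i , p , k) → let j , q , e = h p ; k′ , e′ = ≐⇒⊆ e k in (j , q , k′) , e′)
      (λ (j , q , k) → let i , p , e = h′ q ; k′ , e′ = ≐⇒⊆ (≐-sym e) k in (i , p , k′) , e′)

    -- Unordered pairs and Kuratowski pairs

    pick : V → V → Bool → V
    pick a b false = a
    pick a b true  = b

    upair : V → V → V
    upair a b = sup (Lift ℓ Bool) λ (lift i) → pick a b i

    pair : V → V → V
    pair a b = upair (upair a a) (upair a b)

    pick-cong : ∀ {a b c d} → a ≐ c → b ≐ d → ∀ i → pick a b i ≐ pick c d i
    pick-cong e e′ false = e
    pick-cong e e′ true  = e′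

    upair-cong : ∀ {a b c d} → a ≐ c → b ≐ d → upair a b ≐ upair c d
    upair-cong e e′ = (λ (lift i) → lift i , pick-cong e e′ i) , (λ (lift i) → lift i , pick-cong e e′ i)

    pair-cong : ∀ {a b c d} → a ≐ c → b ≐ d → pair a b ≐ pair c d
    pair-cong e e′ = upair-cong (upair-cong e e) (upair-cong e e′)

    ∈upair : ∀ {a b c} → c ∈̇ upair a b → c ≐ a ⊎ c ≐ b
    ∈upair (lift false , e) = inj₁ e
    ∈upair (lift true  , e) = inj₂ e

    upair-injˡ : ∀ {a c d} → upair a a ≐ upair c d → a ≐ c × a ≐ d
    upair-injˡ (_ , q) with q (lift false) | q (lift true)
    ... | lift false , e | lift false , e′ = e , e′
    ... | lift false , e | lift true  , e′ = e , e′
    ... | lift true  , e | lift false , e′ = e , e′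
    ... | lift true  , e | lift true  , e′ = e , e′

    pair-inj₁ : ∀ {a b c d} → pair a b ≐ pair c d → a ≐ c
    pair-inj₁ {a} {b} {c} {d} e with ∈upair (≐⇒⊆ e (lift false))
    ... | inj₁ e′ = proj₁ (upair-injˡ {a} {c} {c} e′)
    ... | inj₂ e′ = proj₁ (upair-injˡ {a} {c} {d} e′)

    upair-inj₂ : ∀ {a b c d} → a ≐ c → upair a b ≐ upair c d → b ≐ d
    upair-inj₂ e e′ with ∈upair (≐⇒⊆ e′ (lift true))
    ... | inj₂ b≐d = b≐d
    ... | inj₁ b≐c with ∈upair (≐⇒⊆ (≐-sym e′) (lift true))
    ...   | inj₁ d≐a = ≐-trans b≐c (≐-sym (≐-trans d≐a e))
    ...   | inj₂ d≐b = ≐-sym d≐b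

    -- In the degenerate case `upair a b` equals `upair c c`, so `a`, `b` and `c` coincide, and `d`
    -- is recovered from the converse inclusion. No decidable equality is involved, since membership
    -- in an unordered pair already yields the case.
    pair-inj₂ : ∀ {a b c d} → pair a b ≐ pair c d → b ≐ d
    pair-inj₂ {a} {b} {c} {d} e
      with pair-inj₁ {a} {b} {c} {d} e | ∈upair (≐⇒⊆ e (lift true))
    ... | a≐c | inj₂ e′ = upair-inj₂ a≐c e′
    ... | a≐c | inj₁ e′ with upair-injˡ {c} {a} {b} (≐-sym e′) | ∈upair (≐⇒⊆ (≐-sym e) (lift true))
    ...   | c≐a , c≐b | inj₁ e″ = ≐-sym (≐-trans
            (≐-sym (proj₂ (upair-injˡ {a} {c} {d} (≐-sym e″)))) (≐-trans a≐c c≐b))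
    ...   | c≐a , c≐b | inj₂ e″ = ≐-sym (upair-inj₂ (≐-sym a≐c) e″)

    -- A function f on X is the set of pairs (x , z) with z ∈ f x.  Thus the
    -- function that is ∅ everywhere is ∅, and the set of functions from X to
    -- {∅} is {∅}.

    Lam : (X : V) → (Index X → V) → V
    Lam X f = sup (Σ[ i ∈ Index X ] Index (f i)) λ (i , k) → pair (elem X i) (elem (f i) k)

    -- The possible values must be indexed by a set at level `ℓ`. In a Kuratowski pair `pair a z` in
    -- `f`, `z` is an element of an element of the pair, so the search ranges over these.
    App : V → V → V
    App f a = sup (Σ[ i ∈ Index f ] Σ[ j ∈ Index (elem f i) ]
                   Σ[ k ∈ Index (elem (elem f i) j) ]
                     pair a (elem (elem (elem f i) j) k) ≐ elem f i)
                  λ (i , j , k , _) → elem (elem (elem f i) j) k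

    ∈App⇒ : ∀ f a {z} → z ∈̇ App f a → pair a z ∈̇ f
    ∈App⇒ f a ((i , j , k , e) , e′) = i , ≐-trans (pair-cong ≐-refl e′) e

    ⇒∈App : ∀ f a {z} → pair a z ∈̇ f → z ∈̇ App f a
    ⇒∈App f a {z} (i , e) =
      let j , e₁ = ≐⇒⊆ e (lift true)
          k , e₂ = ≐⇒⊆ e₁ (lift true)
      in (i , j , k , ≐-trans (pair-cong {a} ≐-refl (≐-sym e₂)) e) , e₂

    App-cong : ∀ {f g a b} → f ≐ g → a ≐ b → App f a ≐ App g b
    App-cong {f} {g} {a} {b} e e′ = ⊆-antisym
      (λ i → ⇒∈App g b (∈-resp (pair-cong e′ ≐-refl) e (∈App⇒ f a (elem∈ (App f a) i))))
      (λ i → ⇒∈App f a (∈-resp (pair-cong (≐-sym e′) ≐-refl) (≐-sym e) (∈App⇒ g b (elem∈ (App g b) i))))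

    Lam-⊆ : ∀ {X Y f g} → (∀ i → elem X i ∈̇ Y) → (∀ i j → elem X i ≐ elem Y j → f i ≐ g j) →
            ∀ i → elem (Lam X f) i ∈̇ Lam Y g
    Lam-⊆ e h (i , k) =
      let j , e₁ = e i
          l , e₂ = ≐⇒⊆ (h i j e₁) k
      in (j , l) , pair-cong e₁ e₂

    Lam-cong : ∀ {X Y f g} → X ≐ Y → (∀ i j → elem X i ≐ elem Y j → f i ≐ g j) →
               Lam X f ≐ Lam Y g
    Lam-cong {X} {Y} {f} {g} e h = ⊆-antisym
      (Lam-⊆ {X} {Y} {f} {g} (≐⇒⊆ e) h)
      (Lam-⊆ {Y} {X} {g} {f} (≐⇒⊆ (≐-sym e)) (λ j i e′ → ≐-sym (h i j (≐-sym e′))))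

    App-Lam : ∀ {X f a} i → (∀ j → elem X i ≐ elem X j → f i ≐ f j) → a ≐ elem X i →
              App (Lam X f) a ≐ f i
    App-Lam {X} {f} {a} i ext e = ⊆-antisym
      (λ k → let z = elem (App (Lam X f) a) k
                 (j , l) , e′ = ∈App⇒ (Lam X f) a (elem∈ (App (Lam X f) a) k)
             in ∈-resp {x = elem (f j) l} (≐-sym (pair-inj₂ {a} {z} e′))
                  (≐-sym (ext j (≐-trans (≐-sym e) (pair-inj₁ {a} {z} e′)))) (elem∈ (f j) l))
      (λ k → ⇒∈App (Lam X f) a ((i , k) , pair-cong e ≐-refl))

    -- Several indices of `X` may denote the same element, so a choice of values counts as a
    -- function only if it respects `≐`; otherwise its graph would be multivalued and `App-Lam`
    -- would fail.
    Pi : (X : V) → (Index X → V) → V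
    Pi X F = sup
      (Σ[ g ∈ (∀ i → Index (F i)) ]
        (∀ i j → elem X i ≐ elem X j → elem (F i) (g i) ≐ elem (F j) (g j)))
      λ (g , _) → Lam X λ i → elem (F i) (g i)

    Lam∈Pi : ∀ {X F f} → (∀ i j → elem X i ≐ elem X j → f i ≐ f j) →
             (∀ i → f i ∈̇ F i) → Lam X f ∈̇ Pi X F
    Lam∈Pi {X} {F} {f} ext h =
      ((λ i → proj₁ (h i)) ,
       (λ i j e → ≐-trans (≐-sym (proj₂ (h i))) (≐-trans (ext i j e) (proj₂ (h j))))) ,
      Lam-cong {X} {X} {f} {λ i → elem (F i) (proj₁ (h i))} ≐-refl
        (λ i j e → ≐-trans (ext i j e) (proj₂ (h j)))

    App∈ : ∀ {X F f a} i → f ∈̇ Pi X F → a ≐ elem X i → App f a ∈̇ F i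
    App∈ {X} {F} {f} {a} i ((g , ext) , e) e′ =
      g i , ≐-trans (App-cong e (≐-refl {a})) (App-Lam {X} i (ext i) e′)

    -- A function on the indices of `X` is moved to those of `Y` along `back`, which picks an equal
    -- element of `X`; since the function respects `≐`, the pick does not matter.
    Pi-⊆ : ∀ {X Y F G} → X ≐ Y → (∀ i j → elem X i ≐ elem Y j → F i ≐ G j) →
           ∀ i → elem (Pi X F) i ∈̇ Pi Y G
    Pi-⊆ {X} {Y} {F} {G} e h (g , ext) = (g′ , ext′) , Lam-cong {X} {Y} e same
      where
      back : ∀ j → elem Y j ∈̇ X
      back = ≐⇒⊆ (≐-sym e)
      image : ∀ j → elem (F (proj₁ (back j))) (g (proj₁ (back j))) ∈̇ G j
      image j = ≐⇒⊆ (h _ j (≐-sym (proj₂ (back j)))) _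
      g′ : ∀ j → Index (G j)
      g′ j = proj₁ (image j)
      same : ∀ i j → elem X i ≐ elem Y j → elem (F i) (g i) ≐ elem (G j) (g′ j)
      same i j e′ = ≐-trans (ext i _ (≐-trans e′ (proj₂ (back j)))) (proj₂ (image j))
      ext′ : ∀ i j → elem Y i ≐ elem Y j → elem (G i) (g′ i) ≐ elem (G j) (g′ j)
      ext′ i j e′ = ≐-trans (≐-sym (same (proj₁ (back i)) i (≐-sym (proj₂ (back i)))))
                      (same (proj₁ (back i)) j (≐-trans (≐-sym (proj₂ (back i))) e′))

    Pi-cong : ∀ {X Y F G} → X ≐ Y → (∀ i j → elem X i ≐ elem Y j → F i ≐ G j) →
              Pi X F ≐ Pi Y G
    Pi-cong {X} {Y} {F} {G} e h = ⊆-antisym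
      (Pi-⊆ {X} {Y} {F} {G} e h)
      (Pi-⊆ {Y} {X} {G} {F} (≐-sym e) (λ j i e′ → ≐-sym (h i j (≐-sym e′))))

    ∅∈Pi : ∀ {X F} → (∀ i → ∅ ∈̇ F i) → ∅ ∈̇ Pi X F
    ∅∈Pi {X} {F} h =
      ∈-resp {x = Lam X λ _ → ∅} {a = Pi X F} {b = Pi X F} ((λ ()) , (λ ())) (≐-refl {Pi X F})
        (Lam∈Pi {X} {F} {λ _ → ∅} (λ _ _ _ → ≐-refl) h)

    Pi-one : ∀ {X F} → (∀ i → F i ≐ one) → Pi X F ≐ one
    Pi-one {X} {F} h = ⊆-antisym
      (λ (g , _) → _ , ((λ (i , k) → absurd i (g i) k) , (λ ())))
      (λ _ → ∅∈Pi {X} {F} λ i → ∈-resp {x = ∅} ≐-refl (≐-sym (h i)) ∅∈one)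
      where
      absurd : ∀ {A : Set ℓ} i g → Index (elem (F i) g) → A
      absurd i g k = ⊥ₗ-elim (proj₁ (≐⇒⊆ (proj₂ (≐⇒⊆ (h i) g)) k))

-- Substitution

rename-rename : ∀ {l m n} {ρ : Fin m → Fin n} {ρ′ : Fin l → Fin m} {ρ″ : Fin l → Fin n} →
                (∀ i → ρ (ρ′ i) ≡ ρ″ i) → ∀ t → rename ρ (rename ρ′ t) ≡ rename ρ″ t
rename-rename h (bound i) = cong bound (h i)
rename-rename h (var x)   = refl
rename-rename h (sort s)  = refl
rename-rename h (pi A B)  = cong₂ pi (rename-rename h A)
  (rename-rename (λ { zero → refl ; (suc i) → cong suc (h i) }) B)
rename-rename h (lam A t) = cong₂ lam (rename-rename h A)
  (rename-rename (λ { zero → refl ; (suc i) → cong suc (h i) }) t)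
rename-rename h (app t u) = cong₂ app (rename-rename h t) (rename-rename h u)

rename-weaken : ∀ {m n} (ρ : Fin m → Fin n) t → rename (ext ρ) (weaken t) ≡ weaken (rename ρ t)
rename-weaken ρ t = trans (rename-rename (λ _ → refl) t) (sym (rename-rename (λ _ → refl) t))

rename-subst : ∀ {l m n} {ρ : Fin m → Fin n} {θ : Name → Term m} {σ : Fin l → Term m} {θ′ σ′} →
               (∀ x → rename ρ (θ x) ≡ θ′ x) → (∀ i → rename ρ (σ i) ≡ σ′ i) →
               ∀ t → rename ρ (subst θ σ t) ≡ subst θ′ σ′ t
rename-subst-binder : ∀ {l m n} {ρ : Fin m → Fin n} {θ : Name → Term m} {σ : Fin l → Term m} {θ′ σ′} →
               (∀ x → rename ρ (θ x) ≡ θ′ x) → (∀ i → rename ρ (σ i) ≡ σ′ i) →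
               ∀ t → rename (ext ρ) (subst (weaken ∘ θ) (exts σ) t) ≡ subst (weaken ∘ θ′) (exts σ′) t
rename-subst h k (bound i) = k i
rename-subst h k (var x)   = h x
rename-subst h k (sort s)  = refl
rename-subst h k (pi A B)  = cong₂ pi (rename-subst h k A) (rename-subst-binder h k B)
rename-subst h k (lam A t) = cong₂ lam (rename-subst h k A) (rename-subst-binder h k t)
rename-subst h k (app t u) = cong₂ app (rename-subst h k t) (rename-subst h k u)
rename-subst-binder h k = rename-subst
  (λ x → trans (rename-weaken _ _) (cong weaken (h x)))
  (λ { zero → refl ; (suc i) → trans (rename-weaken _ _) (cong weaken (k i)) })

subst-rename : ∀ {l m n} {θ : Name → Term n} {σ : Fin m → Term n} {ρ : Fin l → Fin m} {σ′} →
               (∀ i → σ (ρ i) ≡ σ′ i) → ∀ t → subst θ σ (rename ρ t) ≡ subst θ σ′ t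
subst-rename-binder : ∀ {l m n} {θ : Name → Term n} {σ : Fin m → Term n} {ρ : Fin l → Fin m} {σ′} →
               (∀ i → σ (ρ i) ≡ σ′ i) →
               ∀ t → subst (weaken ∘ θ) (exts σ) (rename (ext ρ) t) ≡ subst (weaken ∘ θ) (exts σ′) t
subst-rename h (bound i) = h i
subst-rename h (var x)   = refl
subst-rename h (sort s)  = refl
subst-rename h (pi A B)  = cong₂ pi (subst-rename h A) (subst-rename-binder h B)
subst-rename h (lam A t) = cong₂ lam (subst-rename h A) (subst-rename-binder h t)
subst-rename h (app t u) = cong₂ app (subst-rename h t) (subst-rename h u)
subst-rename-binder h = subst-rename λ { zero → refl ; (suc i) → cong weaken (h i) }

subst-weaken : ∀ {m n} (θ : Name → Term n) (σ : Fin m → Term n) t →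
               subst (weaken ∘ θ) (exts σ) (weaken t) ≡ weaken (subst θ σ t)
subst-weaken θ σ t =
  trans (subst-rename (λ _ → refl) t) (sym (rename-subst (λ _ → refl) (λ _ → refl) t))

subst-subst : ∀ {l m n} {θ : Name → Term n} {σ : Fin m → Term n}
              {θ′ : Name → Term m} {σ′ : Fin l → Term m} {θ″ σ″} →
              (∀ x → subst θ σ (θ′ x) ≡ θ″ x) → (∀ i → subst θ σ (σ′ i) ≡ σ″ i) →
              ∀ t → subst θ σ (subst θ′ σ′ t) ≡ subst θ″ σ″ t
subst-subst-binder : ∀ {l m n} {θ : Name → Term n} {σ : Fin m → Term n}
              {θ′ : Name → Term m} {σ′ : Fin l → Term m} {θ″ σ″} →
              (∀ x → subst θ σ (θ′ x) ≡ θ″ x) → (∀ i → subst θ σ (σ′ i) ≡ σ″ i) →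
              ∀ t → subst (weaken ∘ θ) (exts σ) (subst (weaken ∘ θ′) (exts σ′) t) ≡
                    subst (weaken ∘ θ″) (exts σ″) t
subst-subst h k (bound i) = k i
subst-subst h k (var x)   = h x
subst-subst h k (sort s)  = refl
subst-subst h k (pi A B)  = cong₂ pi (subst-subst h k A) (subst-subst-binder h k B)
subst-subst h k (lam A t) = cong₂ lam (subst-subst h k A) (subst-subst-binder h k t)
subst-subst h k (app t u) = cong₂ app (subst-subst h k t) (subst-subst h k u)
subst-subst-binder {θ′ = θ′} {σ′ = σ′} h k = subst-subst
  (λ x → trans (subst-weaken _ _ (θ′ x)) (cong weaken (h x)))
  (λ { zero → refl ; (suc i) → trans (subst-weaken _ _ (σ′ i)) (cong weaken (k i)) })

subst-id : ∀ {n} {θ : Name → Term n} {σ : Fin n → Term n} →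
           (∀ x → θ x ≡ var x) → (∀ i → σ i ≡ bound i) → ∀ t → subst θ σ t ≡ t
subst-id-binder : ∀ {n} {θ : Name → Term n} {σ : Fin n → Term n} →
           (∀ x → θ x ≡ var x) → (∀ i → σ i ≡ bound i) →
           ∀ t → subst (weaken ∘ θ) (exts σ) t ≡ t
subst-id h k (bound i) = k i
subst-id h k (var x)   = h x
subst-id h k (sort s)  = refl
subst-id h k (pi A B)  = cong₂ pi (subst-id h k A) (subst-id-binder h k B)
subst-id h k (lam A t) = cong₂ lam (subst-id h k A) (subst-id-binder h k t)
subst-id h k (app t u) = cong₂ app (subst-id h k t) (subst-id h k u)
subst-id-binder h k = subst-id (cong weaken ∘ h) λ { zero → refl ; (suc i) → cong weaken (k i) }

-- A named form of the anonymous function inside `instantiate`, so that equations can mention it.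
single : ∀ {n} → Term n → Fin (suc n) → Term n
single u zero    = u
single u (suc i) = bound i

instantiate≡ : ∀ {n} t (u : Term n) → instantiate t u ≡ subst var (single u) t
instantiate≡ t u = subst-cong (λ { zero → refl ; (suc i) → refl }) t
  where
  subst-cong : ∀ {m n} {θ : Name → Term n} {σ σ′ : Fin m → Term n} →
               (∀ i → σ i ≡ σ′ i) → ∀ t → subst θ σ t ≡ subst θ σ′ t
  subst-cong h (bound i) = h i
  subst-cong h (var x)   = refl
  subst-cong h (sort s)  = refl
  subst-cong h (pi A B)  = cong₂ pi (subst-cong h A)
    (subst-cong (λ { zero → refl ; (suc i) → cong weaken (h i) }) B)
  subst-cong h (lam A t) = cong₂ lam (subst-cong h A)
    (subst-cong (λ { zero → refl ; (suc i) → cong weaken (h i) }) t)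
  subst-cong h (app t u) = cong₂ app (subst-cong h t) (subst-cong h u)

↦-self : ∀ {n} x (u : Term n) → (x ↦ u) x ≡ u
↦-self x u with does (x ≟ x) | proof (x ≟ x)
... | _ | ofʸ _ = refl
... | _ | ofⁿ x≢x = contradiction refl x≢x

↦-other : ∀ {n x y} (u : Term n) → y ≢ x → (x ↦ u) y ≡ var y
↦-other {x = x} {y} u y≢x with does (y ≟ x) | proof (y ≟ x)
... | _ | ofʸ y≡x = contradiction y≡x y≢x
... | _ | ofⁿ _   = refl

instantiate-close : ∀ x t u → instantiate (close x t) u ≡ t [ u / x ]
instantiate-close x t u = trans (instantiate≡ (close x t) u) (subst-subst lemma (λ ()) t)
  where
  lemma : ∀ y → subst var (single u) ((x ↦ bound zero) y) ≡ (x ↦ u) y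
  lemma y with does (y ≟ x)
  ... | true  = refl
  ... | false = refl

[/]-self : ∀ x t → t [ var x / x ] ≡ t
[/]-self x t = subst-id lemma (λ ()) t
  where
  lemma : ∀ y → (x ↦ var x) y ≡ var y
  lemma y with does (y ≟ x) | proof (y ≟ x)
  ... | _ | ofʸ refl = refl
  ... | _ | ofⁿ _    = refl

close-open : ∀ x t → instantiate (close x t) (var x) ≡ t
close-open x t = trans (instantiate-close x t (var x)) ([/]-self x t)

subst-instantiate : ∀ {m n} (σ : Fin m → Term n) t u →
                    subst var σ (instantiate t u) ≡ instantiate (subst var (exts σ) t) (subst var σ u)
subst-instantiate σ t u = begin
  subst var σ (instantiate t u)
    ≡⟨ cong (subst var σ) (instantiate≡ t u) ⟩
  subst var σ (subst var (single u) t)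
    ≡⟨ subst-subst (λ _ → refl) (λ { zero → refl ; (suc i) → refl }) t ⟩
  subst var (λ { zero → subst var σ u ; (suc i) → σ i }) t
    ≡⟨ subst-subst (λ _ → refl) (λ { zero → refl ; (suc i) → cancel (σ i) }) t ⟨
  subst var (single (subst var σ u)) (subst var (exts σ) t)
    ≡⟨ instantiate≡ (subst var (exts σ) t) (subst var σ u) ⟨
  instantiate (subst var (exts σ) t) (subst var σ u)  ∎
  where
  open ≡-Reasoning
  cancel : ∀ t → subst var (single (subst var σ u)) (weaken t) ≡ t
  cancel t = trans (subst-rename (λ _ → refl) t) (subst-id (λ _ → refl) (λ _ → refl) t)

-- Reduction

module _ {R : Pred Rule 0ℓ} where

  Step-subst : ∀ {m n} (σ : Fin m → Term n) {t u} → Step (βR R) t u →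
               Step (βR R) (subst var σ t) (subst var σ u)
  Step-subst σ (root (inj₁ (beta {A} {t} {u}))) =
    root (inj₁ (≡-subst (β _) (sym (subst-instantiate σ t u)) beta))
  Step-subst σ (root (inj₂ (rewrites {ρ} Rρ θ fixed))) =
    root (inj₂ (≡-subst₂ (Rewrite R)
      (sym (subst-subst (λ _ → refl) (λ ()) (Rule.lhs ρ)))
      (sym (subst-subst (λ _ → refl) (λ ()) (Rule.rhs ρ)))
      (rewrites Rρ (subst var σ ∘ θ) (λ c∉ → cong (subst var σ) (fixed c∉)))))
  Step-subst σ (piˡ s)  = piˡ (Step-subst σ s)
  Step-subst σ (piʳ s)  = piʳ (Step-subst (exts σ) s)
  Step-subst σ (lamˡ s) = lamˡ (Step-subst σ s)
  Step-subst σ (lamʳ s) = lamʳ (Step-subst (exts σ) s)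
  Step-subst σ (appˡ s) = appˡ (Step-subst σ s)
  Step-subst σ (appʳ s) = appʳ (Step-subst σ s)

  Step-instantiate : ∀ {n} {t t′ : Term (suc n)} u → Step (βR R) t t′ →
                     Step (βR R) (instantiate t u) (instantiate t′ u)
  Step-instantiate u s = Step-subst _ s

-- No variable, abstraction or application has type `Kind`, so kinds are visible in the syntax as
-- iterated products ending in a sort. `kindlike⇒Kind` and `Kind⇒kindlike` make this precise.
kindlike : ∀ {n} → Term n → Bool
kindlike (sort s) = true
kindlike (pi A B) = kindlike B
kindlike _        = false

kindlike-rename : ∀ {m n} (ρ : Fin m → Fin n) t → kindlike (rename ρ t) ≡ kindlike t
kindlike-rename ρ (bound i) = refl
kindlike-rename ρ (var x)   = refl
kindlike-rename ρ (sort s)  = refl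
kindlike-rename ρ (pi A B)  = kindlike-rename (ext ρ) B
kindlike-rename ρ (lam A t) = refl
kindlike-rename ρ (app t u) = refl

-- Typing

open CalculusOf CoC

Rules : Pred Rule 0ℓ
Rules = _∈ CoCRules

-- Free variables and declared names

fv-rename : ∀ {m n} (ρ : Fin m → Fin n) t {x} → x ∈ fv (rename ρ t) → x ∈ fv t
fv-rename ρ (var x) p = p
fv-rename ρ (pi A B) p with ∈-++⁻ (fv (rename ρ A)) p
... | inj₁ q = ∈-++⁺ˡ (fv-rename ρ A q)
... | inj₂ q = ∈-++⁺ʳ (fv A) (fv-rename (ext ρ) B q)
fv-rename ρ (lam A t) p with ∈-++⁻ (fv (rename ρ A)) p
... | inj₁ q = ∈-++⁺ˡ (fv-rename ρ A q)
... | inj₂ q = ∈-++⁺ʳ (fv A) (fv-rename (ext ρ) t q)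
fv-rename ρ (app t u) p with ∈-++⁻ (fv (rename ρ t)) p
... | inj₁ q = ∈-++⁺ˡ (fv-rename ρ t q)
... | inj₂ q = ∈-++⁺ʳ (fv t) (fv-rename ρ u q)

fv-subst : ∀ {m n} (θ : Name → Term n) (σ : Fin m → Term n) t {x} → x ∈ fv (subst θ σ t) →
           (∃[ y ] y ∈ fv t × x ∈ fv (θ y)) ⊎ (∃[ i ] x ∈ fv (σ i))
fv-subst-binder : ∀ {m n} (θ : Name → Term n) (σ : Fin m → Term n) t {x} →
                  x ∈ fv (subst (weaken ∘ θ) (exts σ) t) →
                  (∃[ y ] y ∈ fv t × x ∈ fv (θ y)) ⊎ (∃[ i ] x ∈ fv (σ i))
fv-subst₂ : ∀ {m n k} (θ : Name → Term n) (σ : Fin m → Term n) t (u : Term k) {x} (us : List Name) →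
            x ∈ fv (subst θ σ t) ++ us →
            (x ∈ us → (∃[ y ] y ∈ fv u × x ∈ fv (θ y)) ⊎ (∃[ i ] x ∈ fv (σ i))) →
            (∃[ y ] y ∈ fv t ++ fv u × x ∈ fv (θ y)) ⊎ (∃[ i ] x ∈ fv (σ i))
fv-subst θ σ (bound i) p = inj₂ (i , p)
fv-subst θ σ (var y)   p = inj₁ (y , here refl , p)
fv-subst θ σ (pi A B)  p = fv-subst₂ θ σ A B _ p (fv-subst-binder θ σ B)
fv-subst θ σ (lam A t) p = fv-subst₂ θ σ A t _ p (fv-subst-binder θ σ t)
fv-subst θ σ (app t u) p = fv-subst₂ θ σ t u _ p (fv-subst θ σ u)
fv-subst-binder θ σ t p with fv-subst _ _ t p
... | inj₁ (y , q , r) = inj₁ (y , q , fv-rename suc (θ y) r)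
... | inj₂ (suc i , r) = inj₂ (i , fv-rename suc (σ i) r)
fv-subst₂ θ σ t u us p h with ∈-++⁻ (fv (subst θ σ t)) p
fv-subst₂ θ σ t u us p h | inj₁ q with fv-subst θ σ t q
... | inj₁ (y , r , s) = inj₁ (y , ∈-++⁺ˡ r , s)
... | inj₂ r = inj₂ r
fv-subst₂ θ σ t u us p h | inj₂ q with h q
... | inj₁ (y , r , s) = inj₁ (y , ∈-++⁺ʳ (fv t) r , s)
... | inj₂ r = inj₂ r

fv-subst-var : ∀ {m n} (σ : Fin m → Term n) t {x} → x ∈ fv t → x ∈ fv (subst var σ t)
fv-subst-var σ (var x) p = p
fv-subst-var σ (pi A B) p with ∈-++⁻ (fv A) p
... | inj₁ q = ∈-++⁺ˡ (fv-subst-var σ A q)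
... | inj₂ q = ∈-++⁺ʳ (fv (subst var σ A)) (fv-subst-var (exts σ) B q)
fv-subst-var σ (lam A t) p with ∈-++⁻ (fv A) p
... | inj₁ q = ∈-++⁺ˡ (fv-subst-var σ A q)
... | inj₂ q = ∈-++⁺ʳ (fv (subst var σ A)) (fv-subst-var (exts σ) t q)
fv-subst-var σ (app t u) p with ∈-++⁻ (fv t) p
... | inj₁ q = ∈-++⁺ˡ (fv-subst-var σ t q)
... | inj₂ q = ∈-++⁺ʳ (fv (subst var σ t)) (fv-subst-var σ u q)

fv-close : ∀ x t {y} → y ∈ fv (close x t) → y ∈ fv t × y ≢ x
fv-close x t p with fv-subst _ _ t p
... | inj₁ (y , q , r) = lemma y q r
  where
  lemma : ∀ y {z} → y ∈ fv t → z ∈ fv ((x ↦ bound {1} zero) y) → z ∈ fv t × z ≢ x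
  lemma y q r with does (y ≟ x) | proof (y ≟ x)
  lemma y q () | _ | ofʸ _
  lemma y q (here refl) | _ | ofⁿ y≢x = q , y≢x

⊢⇒wf : ∀ {Γ t A} → Γ ⊢ t ∶ A → WellFormed Γ
⊢⇒wf (sorting w)           = w
⊢⇒wf (variable′ w _)       = w
⊢⇒wf (product ⊢A _)        = ⊢⇒wf ⊢A
⊢⇒wf (abstraction ⊢A _ _)  = ⊢⇒wf ⊢A
⊢⇒wf (application ⊢t _)    = ⊢⇒wf ⊢t
⊢⇒wf (conversion ⊢A _ _ _) = ⊢⇒wf ⊢A

∈⇒dom : ∀ {Γ : Context} {x A} → (x , A) ∈ Γ → x ∈ dom Γ
∈⇒dom = ∈-map⁺ proj₁

dom-++⁻ : ∀ Γ {x} → x ∈ dom (signature ⨾ Γ) → x ∈ dom Γ ⊎ x ∈ dom signature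
dom-++⁻ Γ p = ∈-++⁻ (dom Γ) (≡-subst (_ ∈_) (map-++ proj₁ Γ signature) p)

dom-++⁺ʳ : ∀ Γ {x} → x ∈ dom signature → x ∈ dom (signature ⨾ Γ)
dom-++⁺ʳ Γ p = ≡-subst (_ ∈_) (sym (map-++ proj₁ Γ signature)) (∈-++⁺ʳ (dom Γ) p)

dom-++⁺ˡ : ∀ Γ {x} → x ∈ dom Γ → x ∈ dom (signature ⨾ Γ)
dom-++⁺ˡ Γ p = ≡-subst (_ ∈_) (sym (map-++ proj₁ Γ signature)) (∈-++⁺ˡ p)

fv-declared : ∀ {Γ t A} → Γ ⊢ t ∶ A → ∀ {x} → x ∈ fv t → x ∈ dom (signature ⨾ Γ)
fv-declared-binder : ∀ {Γ x A t B} → Γ ▸ x ∶ A ⊢ t ∶ B → ∀ {y} → y ∈ fv (close x t) →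
                     y ∈ dom (signature ⨾ Γ)
fv-declared (variable′ w x∈) (here refl) = ∈⇒dom x∈
fv-declared (product {A = A} ⊢A ⊢B) p with ∈-++⁻ (fv A) p
... | inj₁ q = fv-declared ⊢A q
... | inj₂ q = fv-declared-binder ⊢B q
fv-declared (abstraction {A = A} ⊢A _ ⊢t) p with ∈-++⁻ (fv A) p
... | inj₁ q = fv-declared ⊢A q
... | inj₂ q = fv-declared-binder ⊢t q
fv-declared (application {t = t} ⊢t ⊢u) p with ∈-++⁻ (fv t) p
... | inj₁ q = fv-declared ⊢t q
... | inj₂ q = fv-declared ⊢u q
fv-declared (conversion _ _ ⊢t _) p = fv-declared ⊢t p
fv-declared-binder {x = x} {t = t} ⊢t p with fv-close x t p
... | q , y≢x with fv-declared ⊢t q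
...   | here y≡x = contradiction y≡x y≢x
...   | there r = r

fresh-constants : ∀ {Γ x A} → WellFormed Γ → (x , A) ∈ Γ → x ∉ dom signature
fresh-constants {Γ = _ ∷ Γ} (declaration ⊢A x∉) (here refl) p = x∉ (dom-++⁺ʳ Γ p)
fresh-constants (declaration ⊢A x∉) (there q) = fresh-constants (⊢⇒wf ⊢A) q

fv-context : ∀ {Γ x A} → WellFormed Γ → (x , A) ∈ Γ → ∀ {y} → y ∈ fv A → y ∈ dom (signature ⨾ Γ)
fv-context (declaration ⊢A x∉) (here refl) p = there (fv-declared ⊢A p)
fv-context (declaration ⊢A x∉) (there q) p = there (fv-context (⊢⇒wf ⊢A) q p)

-- Kinds in typing derivations

Kind-untyped : ∀ {Γ A} → ¬ Γ ⊢ Kind ∶ A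
Kind-untyped (conversion _ _ ⊢Kind _) = Kind-untyped ⊢Kind

kindlike-subst : ∀ {m n} {θ : Name → Term n} {σ : Fin m → Term n} →
                 (∀ x → kindlike (θ x) ≡ false) → (∀ i → kindlike (σ i) ≡ false) →
                 ∀ t → kindlike (subst θ σ t) ≡ kindlike t
kindlike-subst h k (bound i) = k i
kindlike-subst h k (var x)   = h x
kindlike-subst h k (sort s)  = refl
kindlike-subst {θ = θ} {σ} h k (pi A B) = kindlike-subst
  (λ x → trans (kindlike-rename suc (θ x)) (h x))
  (λ { zero → refl ; (suc i) → trans (kindlike-rename suc (σ i)) (k i) }) B
kindlike-subst h k (lam A t) = refl
kindlike-subst h k (app t u) = refl

kindlike-↦ : ∀ {n} x {u : Term n} → kindlike u ≡ false → ∀ y → kindlike ((x ↦ u) y) ≡ false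
kindlike-↦ x p y with does (y ≟ x)
... | true  = p
... | false = refl

kindlike-[/] : ∀ x {n} {u : Term n} → kindlike u ≡ false → ∀ t → kindlike (t ⟪ x ↦ u ⟫) ≡ kindlike t
kindlike-[/] x p t = kindlike-subst (kindlike-↦ x p) (λ ()) t

kindlike⇒Kind : ∀ {Γ t A} → Γ ⊢ t ∶ A → kindlike t ≡ true → A ≡ Kind
kindlike⇒Kind (sorting _) _ = refl
kindlike⇒Kind (product {x = x} {B = B} ⊢A ⊢B) p =
  kindlike⇒Kind ⊢B (trans (sym (kindlike-[/] x refl B)) p)
kindlike⇒Kind (conversion ⊢A _ ⊢t _) p with kindlike⇒Kind ⊢t p
... | refl = contradiction ⊢A Kind-untyped

Type⇒¬kindlike : ∀ {Γ t} → Γ ⊢ t ∶ Type → kindlike t ≡ false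
Type⇒¬kindlike {t = t} ⊢t with kindlike t in eq
... | false = refl
... | true with kindlike⇒Kind ⊢t eq
...   | ()

-- An invariant of typing, by which the domains of products and the arguments of
-- functions are not kinds; it avoids a proof that all types are typed.
Stratified : ∀ {n} → Term n → Set
Stratified (bound i) = ⊤
Stratified (var x)   = ⊤
Stratified Type      = ⊤
Stratified Kind      = ⊥
Stratified (pi A B)  = IsTrue (not (kindlike A)) × Stratified A × Stratified B
Stratified (lam A t) = Stratified A × Stratified t
Stratified (app t u) = Stratified t × Stratified u

Stratified-rename : ∀ {m n} (ρ : Fin m → Fin n) t → Stratified t → Stratified (rename ρ t)
Stratified-rename ρ (bound i) _ = _
Stratified-rename ρ (var x) _   = _
Stratified-rename ρ Type _      = _
Stratified-rename ρ (pi A B)  (d , p , q) =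
  ≡-subst (IsTrue ∘ not) (sym (kindlike-rename ρ A)) d ,
  Stratified-rename ρ A p , Stratified-rename (ext ρ) B q
Stratified-rename ρ (lam A t) (p , q) = Stratified-rename ρ A p , Stratified-rename (ext ρ) t q
Stratified-rename ρ (app t u) (p , q) = Stratified-rename ρ t p , Stratified-rename ρ u q

Object : ∀ {n} → Term n → Set
Object t = kindlike t ≡ false × Stratified t

Object-weaken : ∀ {n} (t : Term n) → Object t → Object (weaken t)
Object-weaken t (p , q) = trans (kindlike-rename suc t) p , Stratified-rename suc t q

Stratified-subst : ∀ {m n} {θ : Name → Term n} {σ : Fin m → Term n} →
                   (∀ x → Object (θ x)) → (∀ i → Object (σ i)) →
                   ∀ t → Stratified t → Stratified (subst θ σ t)
Stratified-subst-binder : ∀ {m n} {θ : Name → Term n} {σ : Fin m → Term n} →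
                   (∀ x → Object (θ x)) → (∀ i → Object (σ i)) →
                   ∀ t → Stratified t → Stratified (subst (weaken ∘ θ) (exts σ) t)
Stratified-subst h k (bound i) _ = proj₂ (k i)
Stratified-subst h k (var x) _   = proj₂ (h x)
Stratified-subst h k Type _      = _
Stratified-subst h k (pi A B)  (d , p , q) =
  ≡-subst (IsTrue ∘ not) (sym (kindlike-subst (proj₁ ∘ h) (proj₁ ∘ k) A)) d ,
  Stratified-subst h k A p , Stratified-subst-binder h k B q
Stratified-subst h k (lam A t) (p , q) = Stratified-subst h k A p , Stratified-subst-binder h k t q
Stratified-subst h k (app t u) (p , q) = Stratified-subst h k t p , Stratified-subst h k u q
Stratified-subst-binder {θ = θ} {σ} h k = Stratified-subst
  (λ x → Object-weaken (θ x) (h x))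
  (λ { zero → refl , _ ; (suc i) → Object-weaken (σ i) (k i) })

Stratified-subst⁻ : ∀ {m n} {θ : Name → Term n} {σ : Fin m → Term n} →
                    (∀ x → kindlike (θ x) ≡ false) → (∀ i → kindlike (σ i) ≡ false) →
                    ∀ t → Stratified (subst θ σ t) → Stratified t
Stratified-subst-binder⁻ : ∀ {m n} {θ : Name → Term n} {σ : Fin m → Term n} →
                    (∀ x → kindlike (θ x) ≡ false) → (∀ i → kindlike (σ i) ≡ false) →
                    ∀ t → Stratified (subst (weaken ∘ θ) (exts σ) t) → Stratified t
Stratified-subst⁻ h k (bound i) _ = _
Stratified-subst⁻ h k (var x) _   = _
Stratified-subst⁻ h k Type _      = _
Stratified-subst⁻ h k (pi A B)  (d , p , q) =
  ≡-subst (IsTrue ∘ not) (kindlike-subst h k A) d ,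
  Stratified-subst⁻ h k A p , Stratified-subst-binder⁻ h k B q
Stratified-subst⁻ h k (lam A t) (p , q) = Stratified-subst⁻ h k A p , Stratified-subst-binder⁻ h k t q
Stratified-subst⁻ h k (app t u) (p , q) = Stratified-subst⁻ h k t p , Stratified-subst⁻ h k u q
Stratified-subst-binder⁻ {θ = θ} {σ} h k = Stratified-subst⁻
  (λ x → trans (kindlike-rename suc (θ x)) (h x))
  (λ { zero → refl ; (suc i) → trans (kindlike-rename suc (σ i)) (k i) })

Object-↦ : ∀ {n} x {u : Term n} → Object u → ∀ y → Object ((x ↦ u) y)
Object-↦ x p y with does (y ≟ x)
... | true  = p
... | false = refl , _

Stratified-[/] : ∀ x {n} {u : Term n} → Object u → ∀ t → Stratified t → Stratified (t ⟪ x ↦ u ⟫)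
Stratified-[/] x p t = Stratified-subst (Object-↦ x p) (λ ()) t

Stratified-close⁻ : ∀ x t → Stratified (close x t) → Stratified t
Stratified-close⁻ x t = Stratified-subst⁻ (kindlike-↦ x refl) (λ ()) t

Stratified-close : ∀ x t → Stratified t → Stratified (close x t)
Stratified-close x t = Stratified-[/] x (refl , _) t

signature-Stratified : ∀ {c A} → (c , A) ∈ signature → Stratified A
signature-Stratified (here refl) = _
signature-Stratified (there (here refl)) = _
signature-Stratified (there (there (here refl))) = _
signature-Stratified (there (there (there (here refl)))) = _
signature-Stratified (there (there (there (there (here refl))))) = _
signature-Stratified (there (there (there (there (there (here refl)))))) = _
signature-Stratified (there (there (there (there (there (there (here refl))))))) = _
signature-Stratified (there (there (there (there (there (there (there (here refl)))))))) = _

private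
  AllStratified : Context → Set
  AllStratified Γ = ∀ {x A} → (x , A) ∈ signature ⨾ Γ → Stratified A

  -- The invariant is proved for term, type and context together: a variable takes it from the
  -- context, an application from the type of the function.
  stratified : ∀ {Γ t A} → Γ ⊢ t ∶ A → Stratified t × (A ≡ Kind ⊎ Stratified A) × AllStratified Γ
  wf-allStratified : ∀ {Γ} → WellFormed Γ → AllStratified Γ
  stratified (sorting w) = _ , inj₁ refl , wf-allStratified w
  stratified (variable′ w x∈) = _ , inj₂ (wf-allStratified w x∈) , wf-allStratified w
  stratified (product {x = x} {B = B} {s} ⊢A ⊢B) with stratified ⊢A | stratified ⊢B
  ... | p , _ , h | q , _ =
    (≡-subst (IsTrue ∘ not) (sym (Type⇒¬kindlike ⊢A)) _ , p , Stratified-close x B q) ,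
    sort-Stratified s , h
    where
    sort-Stratified : ∀ s → sort {0} s ≡ Kind ⊎ Stratified (sort {0} s)
    sort-Stratified ⋆ = inj₂ _
    sort-Stratified □ = inj₁ refl
  stratified (abstraction {x = x} {B = B} {t} ⊢A ⊢B ⊢t) with stratified ⊢A | stratified ⊢B | stratified ⊢t
  ... | p , _ , h | q , _ | r , _ =
    (p , Stratified-close x t r) ,
    inj₂ (≡-subst (IsTrue ∘ not) (sym (Type⇒¬kindlike ⊢A)) _ , p , Stratified-close x B q) , h
  stratified (application {x = x} {B = B} {u = u} ⊢t ⊢u) with stratified ⊢t | stratified ⊢u
  ... | p , inj₂ (_ , q₀ , q) , h | r , _ =
    (p , r) , inj₂ (Stratified-[/] x (object , r) B (Stratified-close⁻ x B q)) , h
    where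
    -- A kind as argument would force the domain to be `Kind`, which is not stratified.
    object : kindlike u ≡ false
    object with kindlike u in eq
    ... | false = refl
    ... | true with kindlike⇒Kind ⊢u eq
    ...   | refl = ⊥-elim q₀
  stratified (conversion _ ⊢B ⊢t _) with stratified ⊢B | stratified ⊢t
  ... | q , _ | p , _ , h = p , inj₂ q , h
  wf-allStratified empty = signature-Stratified
  wf-allStratified (declaration ⊢A _) (here refl) = proj₁ (stratified ⊢A)
  wf-allStratified (declaration ⊢A _) (there x∈)  = proj₂ (proj₂ (stratified ⊢A)) x∈

⊢-Stratified : ∀ {Γ t A} → Γ ⊢ t ∶ A → Stratified t × (A ≡ Kind ⊎ Stratified A)
⊢-Stratified ⊢t with stratified ⊢t
... | p , q , _ = p , q

wf-Stratified : ∀ {Γ x A} → WellFormed Γ → (x , A) ∈ signature ⨾ Γ → Stratified A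
wf-Stratified w x∈ = wf-allStratified w x∈

kind-domain : ∀ {Γ t A T} → Γ ⊢ t ∶ pi A T → kindlike A ≡ false
kind-domain {A = A} ⊢t with ⊢-Stratified ⊢t
... | _ , inj₂ (d , _) with kindlike A
...   | false = refl

object-domain : ∀ {Γ t A T u} → Γ ⊢ t ∶ pi A T → Γ ⊢ u ∶ A → kindlike u ≡ false
object-domain {u = u} ⊢t ⊢u with kindlike u in eq
... | false = refl
... | true with kindlike⇒Kind ⊢u eq | kind-domain ⊢t
...   | refl | ()

-- Types of variables, and instances of codomains of typed functions, are stratified, whereas `Kind`
-- is not; this rules out the variable and application cases.
Kind⇒kindlike : ∀ {Γ t A} → Γ ⊢ t ∶ A → A ≡ Kind → kindlike t ≡ true
Kind⇒kindlike (sorting _) _ = refl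
Kind⇒kindlike (variable′ w x∈) refl = ⊥-elim (wf-Stratified w x∈)
Kind⇒kindlike (product {x = x} {B = B} ⊢A ⊢B) p =
  trans (kindlike-[/] x refl B) (Kind⇒kindlike ⊢B p)
Kind⇒kindlike (application {x = x} {B = B} ⊢t ⊢u) p with ⊢-Stratified ⊢t
... | _ , inj₂ (_ , _ , q) = ⊥-elim (≡-subst Stratified p (Stratified-[/] x
  (object-domain ⊢t ⊢u , proj₁ (⊢-Stratified ⊢u)) B (Stratified-close⁻ x B q)))
Kind⇒kindlike (conversion _ ⊢B _ _) refl = contradiction ⊢B Kind-untyped

sort-unique : ∀ {Γ t s s′} → Γ ⊢ t ∶ sort s → Γ ⊢ t ∶ sort s′ → s ≡ s′
sort-unique {s = ⋆} {⋆} _ _ = refl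
sort-unique {s = □} {□} _ _ = refl
sort-unique {s = ⋆} {□} p q with kindlike⇒Kind p (Kind⇒kindlike q refl)
... | ()
sort-unique {s = □} {⋆} p q with kindlike⇒Kind q (Kind⇒kindlike p refl)
... | ()

type-of : ∀ {Γ t s} → Γ ⊢ t ∶ sort s → kindlike t ≡ false → Γ ⊢ t ∶ Type
type-of {s = ⋆} ⊢t _ = ⊢t
type-of {s = □} ⊢t p with trans (sym p) (Kind⇒kindlike ⊢t refl)
... | ()

-- Conversion and subject reduction

_⟶*_ : ∀ {n} → Rel (Term n) 0ℓ
_⟶*_ = Star (Step (βR Rules))

_≡*_ : ∀ {n} → Rel (Term n) 0ℓ
_≡*_ = EqClosure (Step (βR Rules))

⟶*⇒≡* : ∀ {n} {t u : Term n} → t ⟶* u → t ≡* u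
⟶*⇒≡* = gmap id fwd

≡*-sym : ∀ {n} {t u : Term n} → t ≡* u → u ≡* t
≡*-sym = reverse (SymClosure.symmetric _)

-- Every left-hand side is an application. Hence a product reduces only inside its two parts, which
-- is the source of the injectivity of products.
Rewrite-¬pi : ∀ {n} {t u A B} → Rewrite Rules {n} t u → t ≢ pi A B
Rewrite-¬pi (rewrites (here refl) θ _) ()
Rewrite-¬pi (rewrites (there (here refl)) θ _) ()
Rewrite-¬pi (rewrites (there (there (here refl))) θ _) ()
Rewrite-¬pi (rewrites (there (there (there (here refl)))) θ _) ()

pi-⟶* : ∀ {n} {A B} {t u : Term n} → t ⟶* u → t ≡ pi A B →
        ∃[ A′ ] ∃[ B′ ] (u ≡ pi A′ B′ × A ⟶* A′ × B ⟶* B′)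
pi-⟶* ε* refl = _ , _ , refl , ε* , ε*
pi-⟶* (root (inj₁ ()) ◅ ss) refl
pi-⟶* (root (inj₂ r) ◅ ss) eq = contradiction eq (Rewrite-¬pi r)
pi-⟶* (piˡ s ◅ ss) refl with pi-⟶* ss refl
... | _ , _ , eq , r , r′ = _ , _ , eq , s ◅ r , r′
pi-⟶* (piʳ s ◅ ss) refl with pi-⟶* ss refl
... | _ , _ , eq , r , r′ = _ , _ , eq , r , s ◅ r′

signature-type : Name → Maybe (Term 0)
signature-type = look signature
  where
  look : Context → Name → Maybe (Term 0)
  look [] c = nothing
  look ((c′ , A) ∷ Γ) c = if does (c′ ≟ c) then just A else look Γ c

∈⇒signature-type : ∀ {c A} → (c , A) ∈ signature → signature-type c ≡ just A
∈⇒signature-type (here refl) = refl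
∈⇒signature-type (there (here refl)) = refl
∈⇒signature-type (there (there (here refl))) = refl
∈⇒signature-type (there (there (there (here refl)))) = refl
∈⇒signature-type (there (there (there (there (here refl))))) = refl
∈⇒signature-type (there (there (there (there (there (here refl)))))) = refl
∈⇒signature-type (there (there (there (there (there (there (here refl))))))) = refl
∈⇒signature-type (there (there (there (there (there (there (there (here refl)))))))) = refl

constant-type : ∀ {Γ c A B} → WellFormed Γ → (c , A) ∈ signature → (c , B) ∈ signature ⨾ Γ → A ≡ B
constant-type {Γ} w c∈ c∈′ with ∈-++⁻ Γ c∈′
... | inj₁ p = contradiction (∈⇒dom c∈) (fresh-constants w p)
... | inj₂ p = just-injective (trans (sym (∈⇒signature-type c∈)) (∈⇒signature-type p))

module Metatheory (confluent : Confluent _⟶_) (preservation : SubjectReduction) where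

  church-rosser : ∀ {t u} → t ≡βR u → ∃[ v ] (t ⟶* v × u ⟶* v)
  church-rosser ε* = _ , ε* , ε*
  church-rosser (fwd s ◅ ss) with church-rosser ss
  ... | v , p , q = v , s ◅ p , q
  church-rosser (bwd s ◅ ss) with church-rosser ss
  ... | v , p , q with confluent (s ◅ ε*) p
  ...   | w , r , r′ = w , r , q ◅◅ r′

  preservation* : ∀ {Γ t u A} → Γ ⊢ t ∶ A → t ⟶* u → Γ ⊢ u ∶ A
  preservation* ⊢t ε* = ⊢t
  preservation* ⊢t (s ◅ ss) = preservation* (preservation ⊢t s) ss

  pi-injective : ∀ {A A′ B B′} → pi A B ≡βR pi A′ B′ → A ≡* A′ × B ≡* B′
  pi-injective e with church-rosser e
  ... | _ , p , q with pi-⟶* p refl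
  ...   | _ , _ , refl , a , b with pi-⟶* q refl
  ...     | _ , _ , refl , a′ , b′ =
    (⟶*⇒≡* a ◅◅ ≡*-sym (⟶*⇒≡* a′)) , (⟶*⇒≡* b ◅◅ ≡*-sym (⟶*⇒≡* b′))

  ≡*-instantiate : ∀ {t t′ : Term 1} u → t ≡* t′ → instantiate t u ≡* instantiate t′ u
  ≡*-instantiate u = gmap (λ t → instantiate t u) λ where
    (fwd s) → fwd (Step-instantiate u s)
    (bwd s) → bwd (Step-instantiate u s)

  -- The case `same` is separate because `Kind` has no sort, and because inversion would otherwise
  -- need a sort for the type at which it starts.
  data _⊢_≃_ (Γ : Context) (A B : Term 0) : Set where
    same  : A ≡ B → Γ ⊢ A ≃ B
    equal : ∀ {s} → Γ ⊢ A ∶ sort s → Γ ⊢ B ∶ sort s → A ≡βR B → Γ ⊢ A ≃ B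

  ≃-sym : ∀ {Γ A B} → Γ ⊢ A ≃ B → Γ ⊢ B ≃ A
  ≃-sym (same e) = same (sym e)
  ≃-sym (equal p q e) = equal q p (≡*-sym e)

  ≃-trans : ∀ {Γ A B C} → Γ ⊢ A ≃ B → Γ ⊢ B ≃ C → Γ ⊢ A ≃ C
  ≃-trans (same refl) e = e
  ≃-trans e (same refl) = e
  ≃-trans (equal p q e) (equal p′ q′ e′) with sort-unique q p′
  ... | refl = equal p q′ (e ◅◅ e′)

  convert : ∀ {Γ t A B} → Γ ⊢ t ∶ A → Γ ⊢ A ≃ B → Γ ⊢ t ∶ B
  convert ⊢t (same refl) = ⊢t
  convert ⊢t (equal p q e) = conversion p q ⊢t e

  inversion-pi : ∀ {Γ A T C} → Γ ⊢ pi A T ∶ C →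
    ∃[ x ] ∃[ B ] ∃[ s ] (Γ ⊢ A ∶ Type × Γ ▸ x ∶ A ⊢ B ∶ sort s × T ≡ close x B)
  inversion-pi (product {x = x} {B = B} ⊢A ⊢B) = x , B , _ , ⊢A , ⊢B , refl
  inversion-pi (conversion _ _ ⊢pi _) = inversion-pi ⊢pi

  inversion-lam : ∀ {Γ A T C} → Γ ⊢ lam A T ∶ C →
    ∃[ x ] ∃[ B ] ∃[ t ] (Γ ⊢ A ∶ Type × Γ ▸ x ∶ A ⊢ t ∶ B × T ≡ close x t ×
                          Γ ⊢ Π[ x ∶ A ] B ≃ C)
  inversion-lam (abstraction {x = x} {B = B} {t} ⊢A ⊢B ⊢t) = x , B , t , ⊢A , ⊢t , refl , same refl
  inversion-lam (conversion p q ⊢lam e) with inversion-lam ⊢lam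
  ... | x , B , t , ⊢A , ⊢t , eq , e′ = x , B , t , ⊢A , ⊢t , eq , ≃-trans e′ (equal p q e)

  inversion-app : ∀ {Γ t u C} → Γ ⊢ app t u ∶ C →
    ∃[ x ] ∃[ A ] ∃[ B ] (Γ ⊢ t ∶ Π[ x ∶ A ] B × Γ ⊢ u ∶ A × Γ ⊢ B [ u / x ] ≃ C)
  inversion-app (application {x = x} {A} {B} ⊢t ⊢u) = x , A , B , ⊢t , ⊢u , same refl
  inversion-app (conversion p q ⊢app e) with inversion-app ⊢app
  ... | x , A , B , ⊢t , ⊢u , e′ = x , A , B , ⊢t , ⊢u , ≃-trans e′ (equal p q e)

  inversion-constant : ∀ {Γ c A C} → (c , A) ∈ signature → Γ ⊢ var c ∶ C → Γ ⊢ A ≃ C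
  inversion-constant c∈ (variable′ w c∈′) = same (constant-type w c∈ c∈′)
  inversion-constant c∈ (conversion p q ⊢c e) = ≃-trans (inversion-constant c∈ ⊢c) (equal p q e)

  ≃-domain : ∀ {Γ A A′ T T′} → Γ ⊢ pi A T ≃ pi A′ T′ → Γ ⊢ A ≃ A′
  ≃-domain (same refl) = same refl
  ≃-domain (equal p q e) with inversion-pi p | inversion-pi q
  ... | _ , _ , _ , ⊢A , _ | _ , _ , _ , ⊢A′ , _ = equal ⊢A ⊢A′ (proj₁ (pi-injective e))

  -- By subject reduction, as instantiate T u is a reduct of (λ x:A. T) u.
  instantiate-typed : ∀ {Γ A T u} → Γ ⊢ pi A T ∶ Type → Γ ⊢ u ∶ A → Γ ⊢ instantiate T u ∶ Type
  instantiate-typed {Γ} {A} {T} {u} ⊢pi ⊢u with inversion-pi ⊢pi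
  ... | x , B , s , ⊢A , ⊢B , refl =
    preservation
      (application {x = x} {B = Type} (abstraction ⊢A (sorting (⊢⇒wf ⊢B)) ⊢B∶Type) ⊢u)
      (root (inj₁ beta))
    where
    ⊢B∶Type : Γ ▸ x ∶ A ⊢ B ∶ Type
    ⊢B∶Type = type-of ⊢B (trans (sym (kindlike-[/] x refl B)) (Type⇒¬kindlike ⊢pi))

  -- Kinds are excluded as codomains because `instantiate-typed` forms an abstraction with the
  -- codomain as body, and an abstraction over a kind has no type.
  ≃-codomain : ∀ {Γ A A′ T T′ u} → kindlike T ≡ false → Γ ⊢ pi A T ≃ pi A′ T′ → Γ ⊢ u ∶ A′ →
               Γ ⊢ instantiate T u ≃ instantiate T′ u
  ≃-codomain _ (same refl) ⊢u = same refl
  ≃-codomain {u = u} T-type e@(equal p q c) ⊢u with sort-unique p (type-of p T-type)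
  ... | refl = equal (instantiate-typed p (convert ⊢u (≃-sym (≃-domain e)))) (instantiate-typed q ⊢u)
    (≡*-instantiate u (proj₂ (pi-injective c)))

  redex-argument : ∀ {Γ A T u C} → Γ ⊢ app (lam A T) u ∶ C → Γ ⊢ u ∶ A
  redex-argument ⊢app with inversion-app ⊢app
  ... | _ , _ , _ , ⊢lam , ⊢u , _ with inversion-lam ⊢lam
  ...   | _ , _ , _ , _ , _ , _ , e = convert ⊢u (≃-sym (≃-domain e))

  -- Inversion types the arguments only against some product convertible to the declared type of
  -- `c`; injectivity of products, applied once per argument, leads back to the declared domains. A
  -- rewrite rule is sound in the model only for such arguments.
  constant-arguments : ∀ {Γ c P Q R t u C} → (c , pi P (pi Q R)) ∈ signature → kindlike R ≡ false →
    Γ ⊢ app (app (var c) t) u ∶ C → Γ ⊢ t ∶ P × Γ ⊢ u ∶ instantiate Q t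
  constant-arguments {R = R} {t} c∈ R-type ⊢ctu with inversion-app ⊢ctu
  ... | _ , _ , _ , ⊢ct , ⊢u , _ with inversion-app ⊢ct
  ...   | x , A , B , ⊢c , ⊢t , e =
    convert ⊢t (≃-sym (≃-domain K≃)) ,
    convert ⊢u (≃-sym (≃-domain (≃-trans (≃-codomain R-type K≃ ⊢t)
      (≃-trans (same (instantiate-close x B t)) e))))
    where K≃ = inversion-constant c∈ ⊢c

  -- A typed term and its reducts share a type, and each of them is kindlike exactly if that type is
  -- `Kind`.
  ≡-kindlike : ∀ {Γ A B C D} → Γ ⊢ A ∶ C → Γ ⊢ B ∶ D → A ≡βR B → kindlike A ≡ kindlike B
  ≡-kindlike {A = A} {B} ⊢A ⊢B e with church-rosser e
  ... | w , p , q = trans (reduct ⊢A p) (sym (reduct ⊢B q))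
    where
    true-unique : ∀ {a b} → (a ≡ true → b ≡ true) → (b ≡ true → a ≡ true) → a ≡ b
    true-unique {true}  {true}  f g = refl
    true-unique {false} {false} f g = refl
    true-unique {true}  {false} f g = sym (f refl)
    true-unique {false} {true}  f g = g refl
    reduct : ∀ {Γ t u C} → Γ ⊢ t ∶ C → t ⟶* u → kindlike t ≡ kindlike u
    reduct ⊢t s = true-unique
      (λ k → Kind⇒kindlike (preservation* ⊢t s) (kindlike⇒Kind ⊢t k))
      (λ k → Kind⇒kindlike ⊢t (kindlike⇒Kind (preservation* ⊢t s) k))

-- The model

module Interpretation {ℓ : Level} (𝔅 : ΠAlgebra ℓ) (full : Full 𝔅) where
  open ΠAlgebra 𝔅

  V : Set _
  V = 𝕍 ℓ

  -- Truth values as objects.  The additional element ∅, which is read as ⊤̃,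
  -- makes ∅ an element of all values of types in U₁, so that products of such
  -- values are inhabited without choice.

  B⁺ : V
  B⁺ = sup (Maybe Carrier) (maybe (λ a → ｛ ⟨ a ⟩ ｝) ∅)

  truth : Maybe Carrier → V
  truth a = ⟨ fromMaybe ⊤̃ a ⟩

  decode : V → V
  decode c = the (λ i → c ≐ elem B⁺ i) truth

  -- Truth values enter `B⁺` as singletons because an element of 𝓑 may itself be the empty set; this
  -- keeps them apart from the additional element.
  truth-cong : ∀ i j → elem B⁺ i ≐ elem B⁺ j → truth i ≐ truth j
  truth-cong nothing  nothing  e = ≐-refl
  truth-cong (just a) (just b) e = proj₂ (proj₁ (sup-cong⁻ e) ttₗ)
  truth-cong (just a) nothing  e with proj₁ (sup-cong⁻ e) ttₗ
  ... | () , _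
  truth-cong nothing  (just b) e with proj₂ (sup-cong⁻ e) ttₗ
  ... | () , _

  decode-elem : ∀ {c} i → c ≐ elem B⁺ i → decode c ≐ truth i
  decode-elem {c} i e = the-unique {P = λ i → c ≐ elem B⁺ i} {truth} {i} e
    (λ {j} e′ → truth-cong j i (≐-trans (≐-sym e′) e))

  decode-cong : ∀ {c d} → c ≐ d → decode c ≐ decode d
  decode-cong {c} {d} e = the-cong {P = λ i → c ≐ elem B⁺ i} {λ i → d ≐ elem B⁺ i} {truth} {truth}
    (λ {i} e′ → i , ≐-trans (≐-sym e) e′ , ≐-refl)
    (λ {i} e′ → i , ≐-trans e e′ , ≐-refl)

  decode∈ : ∀ {c} → c ∈̇ B⁺ → decode c ∈̇ 𝓑
  decode∈ p = let i , e = index p in element (_ , decode-elem i e)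

  ｛｝∈B⁺ : ∀ {v} → v ∈̇ 𝓑 → ｛ v ｝ ∈̇ B⁺
  ｛｝∈B⁺ p = let a , e = index p in element (just a , ｛｝-cong e)

  decode-｛｝ : ∀ {v} → v ∈̇ 𝓑 → decode ｛ v ｝ ≐ v
  decode-｛｝ p = let a , e = index p in ≐-trans (decode-elem (just a) (｛｝-cong e)) (≐-sym e)

  -- By description, `Π̃` becomes an operation on arbitrary sets, so that `PI` can be defined
  -- without a proof that its arguments lie in 𝓑 and 𝓐.
  Π̂ : V → V → V
  Π̂ v S = the {I = Σ[ a ∈ Carrier ] 𝓐 S} (λ (a , _) → v ≐ ⟨ a ⟩) (λ (a , p) → ⟨ Π̃ a S p ⟩)

  Π̂≈ : ∀ {v S a} (p : 𝓐 S) → v ≐ ⟨ a ⟩ → Π̂ v S ≐ ⟨ Π̃ a S p ⟩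
  Π̂≈ {v} {S} {a} p e = the-unique
    {I = Σ[ a ∈ Carrier ] 𝓐 S} {λ (a , _) → v ≐ ⟨ a ⟩} {λ (a , p) → ⟨ Π̃ a S p ⟩} {a , p} e
    (λ {(a′ , p′)} e′ → ≈⇒≐ (Π̃-cong p′ p (≐⇒≈ (≐-trans (≐-sym e′) e)) (≐⇒≈ ≐-refl)))

  Π̂-cong : ∀ {v w S T} → v ≐ w → S ≐ T → Π̂ v S ≐ Π̂ w T
  Π̂-cong {v} {w} {S} {T} e e′ = the-cong
    {I = Σ[ a ∈ Carrier ] 𝓐 S} {Σ[ a ∈ Carrier ] 𝓐 T} {λ (a , _) → v ≐ ⟨ a ⟩} {λ (a , _) → w ≐ ⟨ a ⟩}
    {λ (a , p) → ⟨ Π̃ a S p ⟩} {λ (a , p) → ⟨ Π̃ a T p ⟩}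
    (λ {(a , p)} q → let p′ = 𝓐-resp (≐⇒≈ e′) p in
      (a , p′) , ≐-trans (≐-sym e) q , ≈⇒≐ (Π̃-cong p p′ (≐⇒≈ ≐-refl) (≐⇒≈ e′)))
    (λ {(a , p)} q → let p′ = 𝓐-resp (≐⇒≈ (≐-sym e′)) p in
      (a , p′) , ≐-trans e q , ≈⇒≐ (Π̃-cong p′ p (≐⇒≈ ≐-refl) (≐⇒≈ e′)))

  -- Codes for the values of types

  data Code₀ : Set ℓ where
    truth₀ unit₀ : Code₀
    arrow₀       : Code₀ → Code₀ → Code₀

  El₀ : Code₀ → V
  El₀ truth₀       = B⁺
  El₀ unit₀        = one
  -- This is the shape of `PI` at component 1 for a domain whose component 0 is {∅}.
  El₀ (arrow₀ a b) = Pi one λ _ → Pi (El₀ a) λ _ → El₀ b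

  U₀ : V
  U₀ = sup Code₀ El₀

  data Code₂ : Sort → Set ℓ where
    unit₂ u₀ : Code₂ ⋆
    u₁       : Code₂ □
    arrow₂   : ∀ {s} → Code₂ ⋆ → Code₂ s → Code₂ s

  -- The parameter stands for `U₁ ⋆`, whose codes refer to `El₂` and which is therefore defined
  -- later. Codes of sort `⋆` never contain `u₁`, so for them the placeholder ∅ is immaterial.
  El₂ : V → ∀ {s} → Code₂ s → V
  El₂ U unit₂        = one
  El₂ U u₀           = U₀
  El₂ U u₁           = U
  El₂ U (arrow₂ a b) = Pi (El₂ ∅ a) λ _ → El₂ U b

  -- In `pi₁` the first domain comes from the finished codes `Code₂`, so no induction-recursion
  -- arises. The body varies with the first argument only, because by causality component 1 of a
  -- body ignores component 2 of its argument.
  data Code₁ : Sort → Set ℓ where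
    truth₁ unit₁ : Code₁ ⋆
    algebra₁     : Code₁ □
    pi₁          : ∀ {s} (d : Code₂ ⋆) → Code₁ ⋆ → (Index (El₂ ∅ d) → Code₁ s) → Code₁ s

  El₁ : ∀ {s} → Code₁ s → V
  El₁ truth₁      = B⁺
  El₁ unit₁       = one
  El₁ algebra₁    = 𝓑
  El₁ (pi₁ d a b) = Pi (El₂ ∅ d) λ i → Pi (El₁ a) λ _ → El₁ (b i)

  U₁ U₂ : Sort → V
  U₁ s = sup (Code₁ s) El₁
  U₂ ⋆ = sup (Code₂ ⋆) (El₂ ∅)
  U₂ □ = sup (Code₂ □) (El₂ (U₁ ⋆))

  U₀⊆U₁ : ∀ {v} → v ∈̇ U₀ → v ∈̇ U₁ ⋆
  U₀⊆U₁ p = let a , e = index p ; b , e′ = embed a in element (b , ≐-trans e e′)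
    where
    embed : ∀ a → ∃[ b ] El₀ a ≐ El₁ {⋆} b
    embed truth₀ = truth₁ , ≐-refl
    embed unit₀  = unit₁ , ≐-refl
    embed (arrow₀ a b) =
      let a′ , e = embed a ; b′ , e′ = embed b in
      pi₁ unit₂ a′ (λ _ → b′) , Pi-cong ≐-refl (λ _ _ _ → Pi-cong e (λ _ _ _ → e′))

  ∅∈El₁ : (a : Code₁ ⋆) → ∅ ∈̇ El₁ a
  ∅∈El₁ truth₁      = element (nothing , ≐-refl)
  ∅∈El₁ unit₁       = ∅∈one
  ∅∈El₁ (pi₁ d a b) = ∅∈Pi λ i → ∅∈Pi λ _ → ∅∈El₁ (b i)

  El₂-nonempty : (d : Code₂ ⋆) → ∃[ v ] v ∈̇ El₂ ∅ d
  El₂-nonempty unit₂        = ∅ , ∅∈one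
  El₂-nonempty u₀           = one , element (unit₀ , ≐-refl)
  El₂-nonempty (arrow₂ a b) =
    let v , p = El₂-nonempty b in _ , Lam∈Pi {f = λ _ → v} (λ _ _ _ → ≐-refl) (λ _ → p)

  U₁-nonempty : ∀ {v} → v ∈̇ U₁ ⋆ → Index v
  U₁-nonempty p = let a , e = index p in
    proj₁ (index (∈-resp ≐-refl (≐-sym e) (∅∈El₁ a)))

  U₂-nonempty : ∀ {v} → v ∈̇ U₂ ⋆ → Index v
  U₂-nonempty p = let d , e = index p in
    proj₁ (index (∈-resp ≐-refl (≐-sym e) (proj₂ (El₂-nonempty d))))

  -- The component c j of the value c of a term t is D (suc j) t.

  T : Set _
  T = ℕ → V

  infixr 5 _∷ᵀ_
  _∷ᵀ_ : V → T → T
  (Z ∷ᵀ A) zero    = Z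
  (Z ∷ᵀ A) (suc j) = A j

  infix 4 _≈[_]_ _∈⟨_⟩_ _∈⟨_∣_⟩_
  _≈[_]_ : T → ℕ → T → Set ℓ
  c ≈[ m ] d = ∀ j → j < m → c j ≐ d j

  _∈⟨_∣_⟩_ : T → ℕ → V → T → Set ℓ
  c ∈⟨ m ∣ Z ⟩ A = ∀ j → j < m → c j ∈̇ (Z ∷ᵀ A) j

  _∈⟨_⟩_ : T → ℕ → T → Set ℓ
  c ∈⟨ m ⟩ A = c ∈⟨ m ∣ one ⟩ A

  ⟪_,_⟫ : V → V → T
  ⟪ c , d ⟫ = ∅ ∷ᵀ c ∷ᵀ d ∷ᵀ λ _ → ∅

  -- Causality: component `j` of the result uses no component of the argument beyond `j`.
  Ext : (T → T) → Set _
  Ext F = ∀ {j c d} → c ≈[ suc j ] d → F c j ≐ F d j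

  ∈₁ : ∀ {c d A} → ⟪ c , d ⟫ ∈⟨ 1 ⟩ A
  ∈₁ zero _ = ∅∈one
  ∈₁ (suc _) (s≤s ())

  ∈₂ : ∀ {c d A} → c ∈̇ A 0 → ⟪ c , d ⟫ ∈⟨ 2 ⟩ A
  ∈₂ p zero _ = ∅∈one
  ∈₂ p (suc zero) _ = p
  ∈₂ p (suc (suc _)) (s≤s (s≤s ()))

  ∈₃ : ∀ {c d A} → c ∈̇ A 0 → d ∈̇ A 1 → ⟪ c , d ⟫ ∈⟨ 3 ⟩ A
  ∈₃ p q zero _ = ∅∈one
  ∈₃ p q (suc zero) _ = p
  ∈₃ p q (suc (suc zero)) _ = q
  ∈₃ p q (suc (suc (suc _))) (s≤s (s≤s (s≤s ())))

  ≈₁ : {c d : T} → c 0 ≐ d 0 → c ≈[ 1 ] d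
  ≈₁ p zero _ = p
  ≈₁ p (suc _) (s≤s ())

  ≈₂ : {c d : T} → c 0 ≐ d 0 → c 1 ≐ d 1 → c ≈[ 2 ] d
  ≈₂ p q zero _ = p
  ≈₂ p q (suc zero) _ = q
  ≈₂ p q (suc (suc _)) (s≤s (s≤s ()))

  ≈₃ : {c d : T} → c 0 ≐ d 0 → c 1 ≐ d 1 → c 2 ≐ d 2 → c ≈[ 3 ] d
  ≈₃ p q r zero _ = p
  ≈₃ p q r (suc zero) _ = q
  ≈₃ p q r (suc (suc zero)) _ = r
  ≈₃ p q r (suc (suc (suc _))) (s≤s (s≤s (s≤s ())))

  -- The level 0 value of a variable of type A : Type ranges over {∅}, hence
  -- the arguments ⟪ c , d ⟫ below.  Only the levels j < 3 are meaningful.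

  range : T → (T → T) → V
  range A F = sup (Index (A 0) × Index (A 1)) λ (i , k) → F ⟪ elem (A 0) i , elem (A 1) k ⟫ 2

  -- Components 0 and 1 are function sets: component `j` contains the components `j + 1` of the
  -- functions, which take the components 1 to `j + 1` of the argument. The body is used at
  -- component `j`, so it ignores the last of these.
  PI : T → (T → T) → T
  PI A F 0 = Pi (A 0) λ _ → F ⟪ ∅ , ∅ ⟫ 0
  PI A F 1 = Pi (A 0) λ i → Pi (A 1) λ _ → F ⟪ elem (A 0) i , ∅ ⟫ 1
  PI A F 2 = Π̂ (A 2) (range A F)
  PI A F _ = ∅

  LAM : T → (T → T) → T
  LAM A F 0 = F ⟪ ∅ , ∅ ⟫ 0
  LAM A F 1 = Lam (A 0) λ i → F ⟪ elem (A 0) i , ∅ ⟫ 1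
  LAM A F 2 = Lam (A 0) λ i → Lam (A 1) λ k → F ⟪ elem (A 0) i , elem (A 1) k ⟫ 2
  LAM A F _ = ∅

  APP : T → T → T
  APP f a 0 = f 0
  APP f a 1 = App (f 1) (a 1)
  APP f a 2 = App (App (f 2) (a 1)) (a 2)
  APP f a _ = ∅

  sortᵀ : Sort → T
  sortᵀ s = U₁ s ∷ᵀ 𝓑 ∷ᵀ ⟨ ⊤̃ ⟩ ∷ᵀ λ _ → ∅

  PI-cong : ∀ j {A A′ F F′} → A ≈[ suc j ] A′ →
            (∀ c d → c ∈⟨ suc j ⟩ A → c ≈[ suc j ] d → F c j ≐ F′ d j) → PI A F j ≐ PI A′ F′ j
  PI-cong 0 e h = Pi-cong (e _ z<s) λ _ _ _ → h _ _ ∈₁ (≈₁ ≐-refl)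
  PI-cong 1 {A} {A′} {F} {F′} e h = Pi-cong (e _ z<s) λ i k e′ → Pi-cong (e _ (s<s z<s)) λ _ _ _ →
    h ⟪ elem (A 0) i , ∅ ⟫ ⟪ elem (A′ 0) k , ∅ ⟫ (∈₂ (elem∈ _ i)) (≈₂ ≐-refl e′)
  PI-cong 2 {A} {A′} {F} {F′} e h = Π̂-cong {A 2} {A′ 2} (e _ (s<s (s<s z<s))) (⊆-antisym
    (λ (i , k) → let i′ , e′ = index (≐⇒⊆ (e _ z<s) i) ; k′ , e″ = index (≐⇒⊆ (e _ (s<s z<s)) k) in
      element ((i′ , k′) , h ⟪ elem (A 0) i , elem (A 1) k ⟫ ⟪ elem (A′ 0) i′ , elem (A′ 1) k′ ⟫
        (∈₃ (elem∈ _ i) (elem∈ _ k)) (≈₃ ≐-refl e′ e″)))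
    (λ (i , k) → let i′ , e′ = index (≐⇒⊆ (≐-sym (e _ z<s)) i)
                     k′ , e″ = index (≐⇒⊆ (≐-sym (e _ (s<s z<s))) k) in
      element ((i′ , k′) , ≐-sym (h ⟪ elem (A 0) i′ , elem (A 1) k′ ⟫ ⟪ elem (A′ 0) i , elem (A′ 1) k ⟫
        (∈₃ (elem∈ _ i′) (elem∈ _ k′)) (≈₃ ≐-refl (≐-sym e′) (≐-sym e″))))))
  PI-cong (suc (suc (suc _))) e h = ≐-refl {a = ∅}

  LAM-cong : ∀ j {A A′ F F′} → A ≈[ suc j ] A′ →
             (∀ c d → c ∈⟨ suc j ⟩ A → c ≈[ suc j ] d → F c j ≐ F′ d j) → LAM A F j ≐ LAM A′ F′ j
  LAM-cong 0 e h = h _ _ ∈₁ (≈₁ ≐-refl)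
  LAM-cong 1 {A} {A′} e h = Lam-cong (e _ z<s) λ i k e′ →
    h ⟪ elem (A 0) i , ∅ ⟫ ⟪ elem (A′ 0) k , ∅ ⟫ (∈₂ (elem∈ _ i)) (≈₂ ≐-refl e′)
  LAM-cong 2 {A} {A′} e h = Lam-cong (e _ z<s) λ i i′ e′ → Lam-cong (e _ (s<s z<s)) λ k k′ e″ →
    h ⟪ elem (A 0) i , elem (A 1) k ⟫ ⟪ elem (A′ 0) i′ , elem (A′ 1) k′ ⟫
      (∈₃ (elem∈ _ i) (elem∈ _ k)) (≈₃ ≐-refl e′ e″)
  LAM-cong (suc (suc (suc _))) e h = ≐-refl {a = ∅}

  APP-cong : ∀ j {f f′ a a′} → f ≈[ suc j ] f′ → a ≈[ suc j ] a′ → APP f a j ≐ APP f′ a′ j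
  APP-cong 0 e e′ = e _ z<s
  APP-cong 1 e e′ = App-cong (e _ (s<s z<s)) (e′ _ (s<s z<s))
  APP-cong 2 e e′ = App-cong (App-cong (e _ (s<s (s<s z<s))) (e′ _ (s<s z<s))) (e′ _ (s<s (s<s z<s)))
  APP-cong (suc (suc (suc _))) e e′ = ≐-refl {a = ∅}

  LAM∈ : ∀ j {Z A F G} → j < 3 → Ext F → Ext G →
         (∀ c → c ∈⟨ suc j ⟩ A → F c j ∈̇ (Z ∷ᵀ G c) j) → LAM A F j ∈̇ (Z ∷ᵀ PI A G) j
  LAM∈ 0 _ extF extG h = h _ ∈₁
  LAM∈ 1 {A = A} {F} {G} _ extF extG h = Lam∈Pi
    (λ i k e → extF {1} {⟪ elem (A 0) i , ∅ ⟫} {⟪ elem (A 0) k , ∅ ⟫} (≈₂ ≐-refl e))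
    (λ i → ∈-resp {b = G ⟪ ∅ , ∅ ⟫ 0} ≐-refl (extG {0} {⟪ elem (A 0) i , ∅ ⟫} (≈₁ ≐-refl))
      (h ⟪ elem (A 0) i , ∅ ⟫ (∈₂ (elem∈ _ i))))
  LAM∈ 2 {A = A} {F} {G} _ extF extG h = Lam∈Pi
    (λ i i′ e → Lam-cong ≐-refl λ k k′ e′ →
      extF {2} {⟪ elem (A 0) i , elem (A 1) k ⟫} {⟪ elem (A 0) i′ , elem (A 1) k′ ⟫} (≈₃ ≐-refl e e′))
    (λ i → Lam∈Pi
      (λ k k′ e → extF {2} {⟪ elem (A 0) i , elem (A 1) k ⟫} {⟪ elem (A 0) i , elem (A 1) k′ ⟫}
        (≈₃ ≐-refl ≐-refl e))
      (λ k → ∈-resp {b = G ⟪ elem (A 0) i , ∅ ⟫ 1} ≐-refl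
        (extG {1} {⟪ elem (A 0) i , elem (A 1) k ⟫} (≈₂ ≐-refl ≐-refl))
        (h ⟪ elem (A 0) i , elem (A 1) k ⟫ (∈₃ (elem∈ _ i) (elem∈ _ k)))))
  LAM∈ (suc (suc (suc _))) (s≤s (s≤s (s≤s ())))

  APP∈ : ∀ j {A G f a} → j < 2 → Ext G → f (suc j) ∈̇ PI A G j → a ∈⟨ suc (suc j) ⟩ A →
         APP f a (suc j) ∈̇ G a j
  APP∈ 0 {A} {G} {f} {a} _ extG p q = let i , e = index (q _ (s<s z<s)) in
    ∈-resp {a = G ⟪ ∅ , ∅ ⟫ 0} ≐-refl (extG (≈₁ (≐-sym (∈one (q _ z<s)))))
      (App∈ {X = A 0} {F = λ _ → G ⟪ ∅ , ∅ ⟫ 0} {f 1} {a 1} i p e)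
  APP∈ 1 {A} {G} {f} {a} _ extG p q =
    let i , e = index (q _ (s<s z<s)) ; k , e′ = index (q _ (s<s (s<s z<s))) in
    ∈-resp {a = G ⟪ elem (A 0) i , ∅ ⟫ 1} ≐-refl (extG (≈₂ (≐-sym (∈one (q _ z<s))) (≐-sym e)))
      (App∈ {X = A 1} {F = λ _ → G ⟪ elem (A 0) i , ∅ ⟫ 1} {App (f 2) (a 1)} {a 2} k
        (App∈ {X = A 0} {F = λ i → Pi (A 1) λ _ → G ⟪ elem (A 0) i , ∅ ⟫ 1} {f 2} {a 1} i p e) e′)
  APP∈ (suc (suc _)) (s≤s (s≤s ()))

  APP-LAM : ∀ j {A F a} → j < 3 → Ext F → a ∈⟨ suc j ⟩ A → APP (LAM A F) a j ≐ F a j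
  -- Membership in `one` identifies component 0 of the argument with the ∅ inserted by `LAM`.
  APP-LAM 0 _ extF p = extF (≈₁ (≐-sym (∈one (p _ z<s))))
  APP-LAM 1 {A} {F} {a} _ extF p = let i , e = index (p _ (s<s z<s)) in
    ≐-trans
      (App-Lam {X = A 0} {f = λ i → F ⟪ elem (A 0) i , ∅ ⟫ 1} i
        (λ k e′ → extF {1} {⟪ elem (A 0) i , ∅ ⟫} {⟪ elem (A 0) k , ∅ ⟫} (≈₂ ≐-refl e′)) e)
      (extF (≈₂ (≐-sym (∈one (p _ z<s))) (≐-sym e)))
  APP-LAM 2 {A} {F} {a} _ extF p =
    let i , e = index (p _ (s<s z<s)) ; k , e′ = index (p _ (s<s (s<s z<s))) in
    ≐-trans
      (App-cong
        (App-Lam {X = A 0} {f = λ i → Lam (A 1) λ k → F ⟪ elem (A 0) i , elem (A 1) k ⟫ 2} i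
          (λ i′ e″ → Lam-cong ≐-refl λ k k′ e‴ →
            extF {2} {⟪ elem (A 0) i , elem (A 1) k ⟫} {⟪ elem (A 0) i′ , elem (A 1) k′ ⟫}
              (≈₃ ≐-refl e″ e‴)) e)
        ≐-refl)
      (≐-trans
        (App-Lam {X = A 1} {f = λ k → F ⟪ elem (A 0) i , elem (A 1) k ⟫ 2} k
          (λ k′ e″ → extF {2} {⟪ elem (A 0) i , elem (A 1) k ⟫} {⟪ elem (A 0) i , elem (A 1) k′ ⟫}
            (≈₃ ≐-refl ≐-refl e″)) e′)
        (extF (≈₃ (≐-sym (∈one (p _ z<s))) (≐-sym e) (≐-sym e′))))
  APP-LAM (suc (suc (suc _))) (s≤s (s≤s (s≤s ())))

  -- Fullness leaves only non-emptiness to check, which holds because every member of `U₂ ⋆` and of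
  -- `U₁ ⋆` is inhabited.
  range-𝓐 : ∀ {A F} → A ∈⟨ 2 ∣ U₂ ⋆ ⟩ sortᵀ ⋆ → (∀ c → c ∈⟨ 3 ⟩ A → F c 2 ∈̇ 𝓑) → 𝓐 (range A F)
  range-𝓐 {A} p h = full
    ( (λ (i , k) → ∈̇⇒∈ˢ (h ⟪ elem (A 0) i , elem (A 1) k ⟫ (∈₃ (elem∈ _ i) (elem∈ _ k))))
    , U₂-nonempty (p _ z<s) , U₁-nonempty (p _ (s<s z<s)))

  PI∈ : ∀ j {s A F} → j < 3 → Ext F → A ∈⟨ suc j ∣ U₂ ⋆ ⟩ sortᵀ ⋆ →
        (∀ c → c ∈⟨ suc j ⟩ A → F c j ∈̇ (U₂ s ∷ᵀ sortᵀ s) j) → PI A F j ∈̇ (U₂ s ∷ᵀ sortᵀ s) j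
  PI∈ 0 {⋆} _ extF p h = let a , e = index (p _ z<s) ; b , e′ = index (h _ ∈₁) in
    element (arrow₂ a b , Pi-cong e λ _ _ _ → e′)
  PI∈ 0 {□} _ extF p h = let a , e = index (p _ z<s) ; b , e′ = index (h _ ∈₁) in
    element (arrow₂ a b , Pi-cong e λ _ _ _ → e′)
  PI∈ 1 {s} {A} {F} _ extF p h = let d , e = index (p _ z<s) ; a , e′ = index (p _ (s<s z<s)) in
    element (pi₁ d a (λ i → proj₁ (code d e i)) ,
      Pi-cong e λ i k e″ → Pi-cong e′ λ _ _ _ →
        ≐-trans (extF {1} {⟪ elem (A 0) i , ∅ ⟫} {⟪ elem (El₂ ∅ d) k , ∅ ⟫} (≈₂ ≐-refl e″))
          (proj₂ (code d e k)))
    where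
    code : ∀ d → A 0 ≐ El₂ ∅ d → ∀ i → ∃[ c ] F ⟪ elem (El₂ ∅ d) i , ∅ ⟫ 1 ≐ El₁ {s} c
    code d e i = index (h ⟪ elem (El₂ ∅ d) i , ∅ ⟫ (∈₂ (≐⇒⊆ (≐-sym e) i)))
  PI∈ 2 {A = A} {F} _ extF p h = element (_ , Π̂≈
    (range-𝓐 {A} {F} (λ _ q → p _ (<-≤-trans q (s≤s (s≤s z≤n)))) h) (proj₂ (index (p _ (s<s (s<s z<s))))))
  PI∈ (suc (suc (suc _))) (s≤s (s≤s (s≤s ())))

  ≈ᵀ-refl : ∀ {m c} → c ≈[ m ] c
  ≈ᵀ-refl _ _ = ≐-refl

  ≈ᵀ-sym : ∀ {m c d} → c ≈[ m ] d → d ≈[ m ] c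
  ≈ᵀ-sym e i p = ≐-sym (e i p)

  ≈ᵀ-trans : ∀ {m c d e} → c ≈[ m ] d → d ≈[ m ] e → c ≈[ m ] e
  ≈ᵀ-trans e e′ i p = ≐-trans (e i p) (e′ i p)

  restrict : ∀ {i m c d} → i < m → c ≈[ m ] d → c ≈[ suc i ] d
  restrict p e k q = e k (<-≤-trans q p)

  restrict∈ : ∀ {i m Z c A} → i < m → c ∈⟨ m ∣ Z ⟩ A → c ∈⟨ suc i ∣ Z ⟩ A
  restrict∈ p e k q = e k (<-≤-trans q p)

  Ext⇒≈ : ∀ {F m c d} → Ext F → c ≈[ m ] d → F c ≈[ m ] F d
  Ext⇒≈ extF e i p = extF (restrict p e)

  PI-≈ : ∀ {m A A′ F F′} → A ≈[ m ] A′ →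
         (∀ i → i < m → ∀ c d → c ∈⟨ suc i ⟩ A → c ≈[ suc i ] d → F c i ≐ F′ d i) →
         PI A F ≈[ m ] PI A′ F′
  PI-≈ e h i p = PI-cong i (restrict p e) (h i p)

  LAM-≈ : ∀ {m A A′ F F′} → A ≈[ m ] A′ →
          (∀ i → i < m → ∀ c d → c ∈⟨ suc i ⟩ A → c ≈[ suc i ] d → F c i ≐ F′ d i) →
          LAM A F ≈[ m ] LAM A′ F′
  LAM-≈ e h i p = LAM-cong i (restrict p e) (h i p)

  APP-≈ : ∀ {m f f′ a a′} → f ≈[ m ] f′ → a ≈[ m ] a′ → APP f a ≈[ m ] APP f′ a′
  APP-≈ e e′ i p = APP-cong i (restrict p e) (restrict p e′)

  APP∈⟨⟩ : ∀ {m A G f a} → m ≤ 3 → Ext G → f ∈⟨ m ⟩ PI A G → a ∈⟨ m ⟩ A → APP f a ∈⟨ m ⟩ G a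
  APP∈⟨⟩ m≤3 extG p q zero    i<m = p zero i<m
  APP∈⟨⟩ {m} {A} {G} m≤3 extG p q (suc i) i<m with <-≤-trans i<m m≤3
  ... | s≤s i<2 = APP∈ i {A} {G} i<2 extG (p (suc i) i<m) (restrict∈ i<m q)

  -- Interpretation of terms

  infixr 5 _∷ᵉ_
  _∷ᵉ_ : ∀ {n} → T → (Fin n → T) → Fin (suc n) → T
  (c ∷ᵉ β) zero    = c
  (c ∷ᵉ β) (suc i) = β i

  ⟦_⟧ᵀ : ∀ {n} → Term n → (Name → T) → (Fin n → T) → T
  ⟦ bound i ⟧ᵀ ρ β = β i
  ⟦ var x ⟧ᵀ   ρ β = ρ x
  ⟦ sort s ⟧ᵀ  ρ β = sortᵀ s
  ⟦ pi A B ⟧ᵀ  ρ β = PI (⟦ A ⟧ᵀ ρ β) λ c → ⟦ B ⟧ᵀ ρ (c ∷ᵉ β)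
  ⟦ lam A t ⟧ᵀ ρ β = LAM (⟦ A ⟧ᵀ ρ β) λ c → ⟦ t ⟧ᵀ ρ (c ∷ᵉ β)
  ⟦ app t u ⟧ᵀ ρ β = APP (⟦ t ⟧ᵀ ρ β) (⟦ u ⟧ᵀ ρ β)

  ∷ᵉ-≈ : ∀ {m n c d} {β β′ : Fin n → T} → c ≈[ m ] d → (∀ i → β i ≈[ m ] β′ i) →
         ∀ i → (c ∷ᵉ β) i ≈[ m ] (d ∷ᵉ β′) i
  ∷ᵉ-≈ e h zero    = e
  ∷ᵉ-≈ e h (suc i) = h i

  -- Generality in `m` is essential: at component `i`, the body of a binder is compared for bound
  -- values that agree only up to `i`, so the environments are restricted to the same bound.
  ⟦⟧-ext : ∀ {m n} (t : Term n) {ρ ρ′ β β′} → (∀ x → x ∈ fv t → ρ x ≈[ m ] ρ′ x) →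
           (∀ i → β i ≈[ m ] β′ i) → ⟦ t ⟧ᵀ ρ β ≈[ m ] ⟦ t ⟧ᵀ ρ′ β′
  ⟦⟧-ext (bound i) h k = k i
  ⟦⟧-ext (var x)   h k = h x (here refl)
  ⟦⟧-ext (sort s)  h k = ≈ᵀ-refl
  ⟦⟧-ext (pi A B)  h k = PI-≈ (⟦⟧-ext A (λ x p → h x (∈-++⁺ˡ p)) k)
    λ i p c d _ e → ⟦⟧-ext B (λ x q → restrict p (h x (∈-++⁺ʳ (fv A) q)))
                             (∷ᵉ-≈ e (λ l → restrict p (k l))) i ≤-refl
  ⟦⟧-ext (lam A t) h k = LAM-≈ (⟦⟧-ext A (λ x p → h x (∈-++⁺ˡ p)) k)
    λ i p c d _ e → ⟦⟧-ext t (λ x q → restrict p (h x (∈-++⁺ʳ (fv A) q)))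
                             (∷ᵉ-≈ e (λ l → restrict p (k l))) i ≤-refl
  ⟦⟧-ext (app t u) h k = APP-≈ (⟦⟧-ext t (λ x p → h x (∈-++⁺ˡ p)) k)
                               (⟦⟧-ext u (λ x p → h x (∈-++⁺ʳ (fv t) p)) k)

  Ext-⟦⟧ : ∀ {n} (t : Term (suc n)) {ρ β} → Ext (λ c → ⟦ t ⟧ᵀ ρ (c ∷ᵉ β))
  Ext-⟦⟧ t e = ⟦⟧-ext t (λ _ _ → ≈ᵀ-refl) (∷ᵉ-≈ e (λ _ → ≈ᵀ-refl)) _ ≤-refl

  ⟦⟧-rename : ∀ {m n k} (r : Fin n → Fin k) (t : Term n) {ρ ρ′ β β′} → (∀ x → ρ x ≈[ m ] ρ′ x) →
              (∀ i → β (r i) ≈[ m ] β′ i) → ⟦ rename r t ⟧ᵀ ρ β ≈[ m ] ⟦ t ⟧ᵀ ρ′ β′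
  ⟦⟧-rename r (bound i) h k = k i
  ⟦⟧-rename r (var x)   h k = h x
  ⟦⟧-rename r (sort s)  h k = ≈ᵀ-refl
  ⟦⟧-rename r (pi A B)  h k = PI-≈ (⟦⟧-rename r A h k)
    λ i p c d _ e → ⟦⟧-rename (ext r) B (λ x → restrict p (h x))
                      (λ { zero → e ; (suc l) → restrict p (k l) }) i ≤-refl
  ⟦⟧-rename r (lam A t) h k = LAM-≈ (⟦⟧-rename r A h k)
    λ i p c d _ e → ⟦⟧-rename (ext r) t (λ x → restrict p (h x))
                      (λ { zero → e ; (suc l) → restrict p (k l) }) i ≤-refl
  ⟦⟧-rename r (app t u) h k = APP-≈ (⟦⟧-rename r t h k) (⟦⟧-rename r u h k)

  ⟦⟧-weaken : ∀ {m n} (t : Term n) {ρ β c} → ⟦ weaken t ⟧ᵀ ρ (c ∷ᵉ β) ≈[ m ] ⟦ t ⟧ᵀ ρ β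
  ⟦⟧-weaken t = ⟦⟧-rename suc t (λ _ → ≈ᵀ-refl) (λ _ → ≈ᵀ-refl)

  ⟦⟧-subst : ∀ {m n k} (θ : Name → Term k) (σ : Fin n → Term k) (t : Term n) {ρ ρ′ β β′} →
             (∀ x → ⟦ θ x ⟧ᵀ ρ β ≈[ m ] ρ′ x) → (∀ i → ⟦ σ i ⟧ᵀ ρ β ≈[ m ] β′ i) →
             ⟦ subst θ σ t ⟧ᵀ ρ β ≈[ m ] ⟦ t ⟧ᵀ ρ′ β′
  ⟦⟧-subst-binder : ∀ {m n k} (θ : Name → Term k) (σ : Fin n → Term k) (t : Term (suc n)) {ρ ρ′ β β′} →
             (∀ x → ⟦ θ x ⟧ᵀ ρ β ≈[ m ] ρ′ x) → (∀ i → ⟦ σ i ⟧ᵀ ρ β ≈[ m ] β′ i) →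
             ∀ i → i < m → ∀ c d → c ≈[ suc i ] d →
             ⟦ subst (weaken ∘ θ) (exts σ) t ⟧ᵀ ρ (c ∷ᵉ β) i ≐ ⟦ t ⟧ᵀ ρ′ (d ∷ᵉ β′) i
  ⟦⟧-subst θ σ (bound i) h k = k i
  ⟦⟧-subst θ σ (var x)   h k = h x
  ⟦⟧-subst θ σ (sort s)  h k = ≈ᵀ-refl
  ⟦⟧-subst θ σ (pi A B)  h k = PI-≈ (⟦⟧-subst θ σ A h k)
    λ i p c d _ → ⟦⟧-subst-binder θ σ B h k i p c d
  ⟦⟧-subst θ σ (lam A t) h k = LAM-≈ (⟦⟧-subst θ σ A h k)
    λ i p c d _ → ⟦⟧-subst-binder θ σ t h k i p c d
  ⟦⟧-subst θ σ (app t u) h k = APP-≈ (⟦⟧-subst θ σ t h k) (⟦⟧-subst θ σ u h k)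
  ⟦⟧-subst-binder θ σ t h k i p c d e = ⟦⟧-subst (weaken ∘ θ) (exts σ) t
    (λ x → ≈ᵀ-trans (⟦⟧-weaken (θ x)) (restrict p (h x)))
    (λ { zero → e ; (suc l) → ≈ᵀ-trans (⟦⟧-weaken (σ l)) (restrict p (k l)) }) i ≤-refl

  -- Values of the constants

  typeᵀ oᵀ : T
  typeᵀ = U₀ ∷ᵀ B⁺ ∷ᵀ ⟨ ⊤̃ ⟩ ∷ᵀ λ _ → ∅
  -- Component 2 names ⊤̃, so that `η o` has truth value ⊤̃; the validity of the declared types
  -- ending in `η o` depends on this.
  oᵀ    = ∅ ∷ᵀ B⁺ ∷ᵀ ｛ ⟨ ⊤̃ ⟩ ｝ ∷ᵀ λ _ → ∅

  ηdec εdec : T → T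
  ηdec c = one ∷ᵀ c 1 ∷ᵀ decode (c 2) ∷ᵀ λ _ → ∅
  εdec c = one ∷ᵀ one ∷ᵀ decode (c 2) ∷ᵀ λ _ → ∅

  ηᵀ εᵀ : T
  ηᵀ = LAM typeᵀ ηdec
  εᵀ = LAM (APP ηᵀ oᵀ) εdec

  -- Right inverses of `ηdec` and `εdec` on small values, with which the Π̇ symbols return names of
  -- products. `εname` can discard component 1, which is {∅} for every proposition.
  ηname εname : T → T
  ηname v = ∅ ∷ᵀ v 1 ∷ᵀ ｛ v 2 ｝ ∷ᵀ λ _ → ∅
  εname v = ∅ ∷ᵀ ∅ ∷ᵀ ｛ v 2 ｝ ∷ᵀ λ _ → ∅

  ηdec-ext : Ext ηdec
  ηdec-ext {0} e = ≐-refl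
  ηdec-ext {1} e = e 1 ≤-refl
  ηdec-ext {2} e = decode-cong (e 2 ≤-refl)
  ηdec-ext {suc (suc (suc _))} e = ≐-refl

  εdec-ext : Ext εdec
  εdec-ext {0} e = ≐-refl
  εdec-ext {1} e = ≐-refl
  εdec-ext {2} e = decode-cong (e 2 ≤-refl)
  εdec-ext {suc (suc (suc _))} e = ≐-refl

  ηname-ext : Ext ηname
  ηname-ext {0} e = ≐-refl
  ηname-ext {1} e = e 1 ≤-refl
  ηname-ext {2} e = ｛｝-cong (e 2 ≤-refl)
  ηname-ext {suc (suc (suc _))} e = ≐-refl

  εname-ext : Ext εname
  εname-ext {0} e = ≐-refl
  εname-ext {1} e = ≐-refl
  εname-ext {2} e = ｛｝-cong (e 2 ≤-refl)
  εname-ext {suc (suc (suc _))} e = ≐-refl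

  -- Bounds on the values of `η` and `ε`. Component 0 is exactly {∅}, not just any member of `U₂ ⋆`;
  -- this is what keeps products over small types simple.
  ηsmall εsmall : T
  ηsmall = ｛ one ｝ ∷ᵀ U₀ ∷ᵀ 𝓑 ∷ᵀ λ _ → ∅
  εsmall = ｛ one ｝ ∷ᵀ ｛ one ｝ ∷ᵀ 𝓑 ∷ᵀ λ _ → ∅

  _∈small[_]_ : T → ℕ → T → Set ℓ
  v ∈small[ m ] S = ∀ j → j < m → v j ∈̇ S j

  a∈｛a｝ : ∀ {a : V} → a ∈̇ ｛ a ｝
  a∈｛a｝ = element (_ , ≐-refl)

  ∈｛｝ : ∀ {a b : V} → a ∈̇ ｛ b ｝ → a ≐ b
  ∈｛｝ p = proj₂ (index p)

  ⊤∈𝓑 : ⟨ ⊤̃ ⟩ ∈̇ 𝓑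
  ⊤∈𝓑 = element (_ , ≐-refl)

  too-large : ∀ {j m} → suc (suc (suc j)) < m → ¬ m ≤ 3
  too-large q m≤3 with <-≤-trans q m≤3
  ... | s≤s (s≤s (s≤s ()))

  small-type : ∀ {m v} → m ≤ 3 → v ∈small[ m ] ηsmall → v ∈⟨ m ∣ U₂ ⋆ ⟩ sortᵀ ⋆
  small-type m≤3 p 0 q = element (unit₂ , ∈｛｝ (p 0 q))
  small-type m≤3 p 1 q = U₀⊆U₁ (p 1 q)
  small-type m≤3 p 2 q = p 2 q
  small-type m≤3 p (suc (suc (suc _))) q = ⊥-elim (too-large q m≤3)

  -- The four Π̇ symbols differ in the universes of their arguments: carrier and
  -- op interpret type and η, or η o and ε.
  record Universe : Set (Level.suc ℓ) where
    field
      carrier small : T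
      dec name      : T → T
      carrier-type  : carrier ∈⟨ 3 ∣ U₂ ⋆ ⟩ sortᵀ ⋆
      dec-ext       : Ext dec
      name-ext      : Ext name
      small⊆        : ∀ {m v} → v ∈small[ m ] small → v ∈small[ m ] ηsmall
      dec∈          : ∀ {m c} → m ≤ 3 → c ∈⟨ m ⟩ carrier → dec c ∈small[ m ] small
      name∈         : ∀ {m v} → m ≤ 3 → v ∈small[ m ] small → name v ∈⟨ m ⟩ carrier
      dec-name      : ∀ {m v} → m ≤ 3 → v ∈small[ m ] small → dec (name v) ≈[ m ] v
      PI-small      : ∀ j {A F} → j < 3 → A ∈small[ suc j ] ηsmall → Ext F →
                      (∀ c → c ∈⟨ suc j ⟩ A → F c j ∈̇ small j) → PI A F j ∈̇ small j

    op : T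
    op = LAM carrier dec

    op∈PI : op ∈⟨ 3 ∣ U₂ ⋆ ⟩ PI carrier λ _ → sortᵀ ⋆
    op∈PI j j<3 = LAM∈ j {U₂ ⋆} {carrier} {dec} {λ _ → sortᵀ ⋆} j<3 dec-ext (λ _ → ≐-refl)
      λ c p → small-type j<3 (small⊆ (dec∈ j<3 p)) j ≤-refl

    op≈dec : ∀ {m c} → m ≤ 3 → c ∈⟨ m ⟩ carrier → APP op c ≈[ m ] dec c
    op≈dec m≤3 p i i<m = APP-LAM i (<-≤-trans i<m m≤3) dec-ext (restrict∈ i<m p)

    op∈ : ∀ {m c} → m ≤ 3 → c ∈⟨ m ⟩ carrier → APP op c ∈small[ m ] small
    op∈ m≤3 p i i<m = ∈-resp (≐-sym (op≈dec m≤3 p i i<m)) ≐-refl (dec∈ m≤3 p i i<m)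

    op-type : ∀ {m c} → m ≤ 3 → c ∈⟨ m ⟩ carrier → APP op c ∈⟨ m ∣ U₂ ⋆ ⟩ sortᵀ ⋆
    op-type m≤3 p = small-type m≤3 (small⊆ (op∈ m≤3 p))

  PI-𝓑 : ∀ {A F} → A ∈⟨ 3 ∣ U₂ ⋆ ⟩ sortᵀ ⋆ → Ext F → (∀ c → c ∈⟨ 3 ⟩ A → F c 2 ∈̇ 𝓑) → PI A F 2 ∈̇ 𝓑
  PI-𝓑 {A} {F} p extF h = PI∈ 2 {⋆} {A} {F} ≤-refl extF p h

  types : Universe
  types = record
    { carrier = typeᵀ ; small = ηsmall ; dec = ηdec ; name = ηname
    ; carrier-type = λ where
        0 _ → element (u₀ , ≐-refl)
        1 _ → element (truth₁ , ≐-refl)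
        2 _ → ⊤∈𝓑
        (suc (suc (suc _))) (s≤s (s≤s (s≤s ())))
    ; dec-ext = ηdec-ext ; name-ext = ηname-ext
    ; small⊆ = λ p → p
    ; dec∈ = λ where
        m≤3 p 0 q → a∈｛a｝
        m≤3 p 1 q → p 1 q
        m≤3 p 2 q → decode∈ (p 2 q)
        m≤3 p (suc (suc (suc _))) q → ⊥-elim (too-large q m≤3)
    ; name∈ = λ where
        m≤3 p 0 q → ∅∈one
        m≤3 p 1 q → p 1 q
        m≤3 p 2 q → ｛｝∈B⁺ (p 2 q)
        m≤3 p (suc (suc (suc _))) q → ⊥-elim (too-large q m≤3)
    ; dec-name = λ where
        m≤3 p 0 q → ≐-sym (∈｛｝ (p 0 q))
        m≤3 p 1 q → ≐-refl
        m≤3 p 2 q → decode-｛｝ (p 2 q)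
        m≤3 p (suc (suc (suc _))) q → ⊥-elim (too-large q m≤3)
    ; PI-small = λ where
        0 j<3 p extF h → element (_ , Pi-one (λ _ → ∈｛｝ (h _ ∈₁)))
        1 j<3 p extF h → PI-U₀ p extF h
        2 j<3 p extF h → PI-𝓑 (small-type ≤-refl p) extF h
        (suc (suc (suc _))) (s≤s (s≤s (s≤s ())))
    }
    where
    -- Component 0 of the domain is {∅}, so component 1 of the body is evaluated at ∅ alone and a
    -- single code `b`, found there, serves the whole family.
    PI-U₀ : ∀ {A F} → A ∈small[ 2 ] ηsmall → Ext F →
            (∀ c → c ∈⟨ 2 ⟩ A → F c 1 ∈̇ U₀) → PI A F 1 ∈̇ U₀
    PI-U₀ {A} {F} p extF h =
      let ∅∈A0 = ∈-resp ≐-refl (≐-sym (∈｛｝ (p 0 z<s))) ∅∈one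
          a , e = index (p 1 ≤-refl) ; b , e′ = index (h ⟪ ∅ , ∅ ⟫ (∈₂ ∅∈A0))
      in element (arrow₀ a b , Pi-cong (∈｛｝ (p 0 z<s)) λ i k e″ → Pi-cong e λ _ _ _ →
        ≐-trans (extF {1} {⟪ elem (A 0) i , ∅ ⟫} {⟪ ∅ , ∅ ⟫} (≈₂ ≐-refl e″)) e′)

  o∈type : oᵀ ∈⟨ 3 ⟩ typeᵀ
  o∈type 0 _ = ∅∈one
  o∈type 1 _ = element (truth₀ , ≐-refl)
  o∈type 2 _ = ｛｝∈B⁺ ⊤∈𝓑
  o∈type (suc (suc (suc _))) (s≤s (s≤s (s≤s ())))

  ηo≈ : APP ηᵀ oᵀ ≈[ 3 ] one ∷ᵀ B⁺ ∷ᵀ ⟨ ⊤̃ ⟩ ∷ᵀ λ _ → ∅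
  ηo≈ = ≈ᵀ-trans (Universe.op≈dec types ≤-refl o∈type) λ where
    0 _ → ≐-refl
    1 _ → ≐-refl
    2 _ → decode-｛｝ ⊤∈𝓑
    (suc (suc (suc _))) (s≤s (s≤s (s≤s ())))

  -- The carrier is left as `APP ηᵀ oᵀ`, the literal value of the term `η o`, so that interpreted
  -- types match definitionally; `ηo≈` supplies the evaluated form where needed.
  propositions : Universe
  propositions = record
    { carrier = APP ηᵀ oᵀ ; small = εsmall ; dec = εdec ; name = εname
    ; carrier-type = Universe.op-type types ≤-refl o∈type
    ; dec-ext = εdec-ext ; name-ext = εname-ext
    ; small⊆ = λ where
        p 0 q → p 0 q
        -- The code `unit₀` serves this purpose: types of proofs become small types, hence
        -- admissible domains for `Π̇TK`.
        p 1 q → element (unit₀ , ∈｛｝ (p 1 q))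
        p 2 q → p 2 q
        p (suc (suc (suc j))) q → p (suc (suc (suc j))) q
    ; dec∈ = λ where
        m≤3 p 0 q → a∈｛a｝
        m≤3 p 1 q → a∈｛a｝
        m≤3 p 2 q → decode∈ (∈-resp ≐-refl (ηo≈ 1 (s≤s (s≤s z≤n))) (p 2 q))
        m≤3 p (suc (suc (suc _))) q → ⊥-elim (too-large q m≤3)
    ; name∈ = λ where
        m≤3 p 0 q → ∅∈one
        m≤3 p 1 q → ∈-resp ≐-refl (≐-sym (ηo≈ 0 z<s)) ∅∈one
        m≤3 p 2 q → ∈-resp ≐-refl (≐-sym (ηo≈ 1 (s≤s (s≤s z≤n)))) (｛｝∈B⁺ (p 2 q))
        m≤3 p (suc (suc (suc _))) q → ⊥-elim (too-large q m≤3)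
    ; dec-name = λ where
        m≤3 p 0 q → ≐-sym (∈｛｝ (p 0 q))
        m≤3 p 1 q → ≐-sym (∈｛｝ (p 1 q))
        m≤3 p 2 q → decode-｛｝ (p 2 q)
        m≤3 p (suc (suc (suc _))) q → ⊥-elim (too-large q m≤3)
    ; PI-small = λ where
        0 j<3 p extF h → element (_ , Pi-one (λ _ → ∈｛｝ (h _ ∈₁)))
        1 {A} j<3 p extF h → element (_ , Pi-one (λ i → Pi-one λ _ →
          ∈｛｝ (h ⟪ elem (A 0) i , ∅ ⟫ (∈₂ (elem∈ _ i)))))
        2 j<3 p extF h → PI-𝓑 (small-type ≤-refl p) extF h
        (suc (suc (suc _))) (s≤s (s≤s (s≤s ())))
    }

  module Dot (P R : Universe) where
    private
      module P = Universe P
      module R = Universe R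

    domain : T → T
    domain x = PI (APP P.op x) λ _ → R.carrier

    body : T → T → T
    body x y = PI (APP P.op x) λ z → APP R.op (APP y z)

    dot : T
    dot = LAM P.carrier λ x → LAM (domain x) λ y → R.name (body x y)

    dotType : T
    dotType = PI P.carrier λ x → PI (domain x) λ _ → R.carrier

    domain-≈ : ∀ {m x x′} → x ≈[ m ] x′ → domain x ≈[ m ] domain x′
    domain-≈ e = PI-≈ (APP-≈ ≈ᵀ-refl e) λ _ _ _ _ _ _ → ≐-refl

    body-≈ : ∀ {m x x′ y y′} → x ≈[ m ] x′ → y ≈[ m ] y′ → body x y ≈[ m ] body x′ y′
    body-≈ e e′ = PI-≈ (APP-≈ ≈ᵀ-refl e) λ i p _ _ _ e″ →
      APP-≈ {m = suc i} ≈ᵀ-refl (APP-≈ (restrict p e′) e″) i ≤-refl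

    name-body-≈ : ∀ {m x x′ y y′} → x ≈[ m ] x′ → y ≈[ m ] y′ →
                  R.name (body x y) ≈[ m ] R.name (body x′ y′)
    name-body-≈ e e′ = Ext⇒≈ R.name-ext (body-≈ e e′)

    inner-ext : ∀ {x} → Ext (λ y → R.name (body x y))
    inner-ext e = name-body-≈ ≈ᵀ-refl e _ ≤-refl

    outer-ext : Ext (λ x → LAM (domain x) λ y → R.name (body x y))
    outer-ext e = LAM-≈ (domain-≈ e) (λ i p _ _ _ e′ → name-body-≈ (restrict p e) e′ i ≤-refl) _ ≤-refl

    codomain-ext : Ext (λ x → PI (domain x) λ _ → R.carrier)
    codomain-ext e = PI-≈ (domain-≈ e) (λ _ _ _ _ _ _ → ≐-refl) _ ≤-refl

    body-small : ∀ {m x y} → m ≤ 3 → x ∈⟨ m ⟩ P.carrier → y ∈⟨ m ⟩ domain x → body x y ∈small[ m ] R.small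
    body-small {m} {x} {y} m≤3 p q i i<m = R.PI-small i i<3
      (P.small⊆ (P.op∈ i<3 (restrict∈ i<m p)))
      (λ e → APP-≈ ≈ᵀ-refl (APP-≈ ≈ᵀ-refl e) _ ≤-refl)
      (λ z r → R.op∈ i<3
        (APP∈⟨⟩ {A = APP P.op x} {λ _ → R.carrier} {y} i<3 (λ _ → ≐-refl) (restrict∈ i<m q) r) i ≤-refl)
      where
      i<3 : i < 3
      i<3 = <-≤-trans i<m m≤3

    dot∈ : dot ∈⟨ 3 ⟩ dotType
    dot∈ j j<3 = LAM∈ j {one} {P.carrier} {_} {λ x → PI (domain x) λ _ → R.carrier} j<3 outer-ext codomain-ext
      λ x p → LAM∈ j {one} {domain x} {_} {λ _ → R.carrier} j<3 inner-ext (λ _ → ≐-refl)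
        λ y q → R.name∈ j<3 (body-small j<3 p q) j ≤-refl

    -- Two β-steps in the model leave the decoding of a name of `body x y`, the value of the
    -- right-hand side. As `body x y` is small, decoding gives it back.
    dot-rule : ∀ {m x y} → m ≤ 3 → x ∈⟨ m ⟩ P.carrier → y ∈⟨ m ⟩ domain x →
               APP R.op (APP (APP dot x) y) ≈[ m ] body x y
    dot-rule {m} {x} {y} m≤3 p q = ≈ᵀ-trans
      (APP-≈ ≈ᵀ-refl (≈ᵀ-trans
        (APP-≈ (λ i i<m → APP-LAM i {P.carrier} (<-≤-trans i<m m≤3) outer-ext (restrict∈ i<m p)) ≈ᵀ-refl)
        (λ i i<m → APP-LAM i {domain x} (<-≤-trans i<m m≤3) inner-ext (restrict∈ i<m q))))
      (≈ᵀ-trans (R.op≈dec m≤3 (R.name∈ m≤3 small)) (R.dec-name m≤3 small))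
      where small = body-small m≤3 p q

    domain-type : ∀ {x} → x ∈⟨ 3 ⟩ P.carrier → domain x ∈⟨ 3 ∣ U₂ ⋆ ⟩ sortᵀ ⋆
    domain-type p j j<3 = PI∈ j {⋆} j<3 (λ _ → ≐-refl) (restrict∈ j<3 (P.op-type ≤-refl p))
      (λ _ _ → R.carrier-type j j<3)

  module KK = Dot types types
  module TT = Dot propositions propositions
  module KT = Dot types propositions
  module TK = Dot propositions types

  constantᵀ : Name → T → T
  constantᵀ 0 _ = typeᵀ
  constantᵀ 1 _ = oᵀ
  constantᵀ 2 _ = ηᵀ
  constantᵀ 3 _ = εᵀ
  constantᵀ 4 _ = KK.dot
  constantᵀ 5 _ = TT.dot
  constantᵀ 6 _ = KT.dot
  constantᵀ 7 _ = TK.dot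
  constantᵀ _ c = c

  env : Valuations ℓ → Name → T
  env φ x = constantᵀ x λ j → φ j x

  -- Component 0 of a value does not vary with arguments, so no function sets are needed here and
  -- only the target of a product counts.
  D₀ : ∀ {n} → Term n → V
  D₀ (sort s) = U₂ s
  D₀ (pi A B) = D₀ B
  D₀ _        = one

  none : Fin 0 → T
  none ()

  ⟦_⟧₀ : Term 0 → Valuations ℓ → T
  ⟦ t ⟧₀ φ = ⟦ t ⟧ᵀ (env φ) none

  𝔻 : ℕ → Term 0 → Valuations ℓ → V
  𝔻 j t φ = (D₀ t ∷ᵀ ⟦ t ⟧₀ φ) j

  -- The declared types are closed and evaluate definitionally to the products for which the
  -- memberships were proved.
  constant∈ : ∀ {c A φ} → (c , A) ∈ signature → ∀ j → j < 3 → 𝔻 (suc j) (var c) φ ∈̇ 𝔻 j A φ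
  constant∈ (here refl) = TK.dot∈
  constant∈ (there (here refl)) = KT.dot∈
  constant∈ (there (there (here refl))) = TT.dot∈
  constant∈ (there (there (there (here refl)))) = KK.dot∈
  constant∈ (there (there (there (there (here refl))))) = Universe.op∈PI propositions
  constant∈ (there (there (there (there (there (here refl)))))) = Universe.op∈PI types
  constant∈ (there (there (there (there (there (there (here refl))))))) = o∈type
  constant∈ (there (there (there (there (there (there (there (here refl)))))))) = Universe.carrier-type types

-- Soundness of typing

module Soundness {ℓ : Level} (𝔅 : ΠAlgebra ℓ) (full : Full 𝔅)
  (confluent : Confluent _⟶_) (preservation : SubjectReduction) where
  open ΠAlgebra 𝔅
  open Interpretation 𝔅 full
  open Metatheory confluent preservation

  constantᵀ-fresh : ∀ {x c} → x ∉ dom signature → constantᵀ x c ≡ c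
  constantᵀ-fresh {0} x∉ = contradiction (there (there (there (there (there (there (there (here refl)))))))) x∉
  constantᵀ-fresh {1} x∉ = contradiction (there (there (there (there (there (there (here refl))))))) x∉
  constantᵀ-fresh {2} x∉ = contradiction (there (there (there (there (there (here refl)))))) x∉
  constantᵀ-fresh {3} x∉ = contradiction (there (there (there (there (here refl))))) x∉
  constantᵀ-fresh {4} x∉ = contradiction (there (there (there (here refl)))) x∉
  constantᵀ-fresh {5} x∉ = contradiction (there (there (here refl))) x∉
  constantᵀ-fresh {6} x∉ = contradiction (there (here refl)) x∉
  constantᵀ-fresh {7} x∉ = contradiction (here refl) x∉
  constantᵀ-fresh {suc (suc (suc (suc (suc (suc (suc (suc x)))))))} x∉ = refl

  constantᵀ-constant : ∀ {x c d} → x ∈ dom signature → constantᵀ x c ≡ constantᵀ x d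
  constantᵀ-constant (here refl) = refl
  constantᵀ-constant (there (here refl)) = refl
  constantᵀ-constant (there (there (here refl))) = refl
  constantᵀ-constant (there (there (there (here refl)))) = refl
  constantᵀ-constant (there (there (there (there (here refl))))) = refl
  constantᵀ-constant (there (there (there (there (there (here refl)))))) = refl
  constantᵀ-constant (there (there (there (there (there (there (here refl))))))) = refl
  constantᵀ-constant (there (there (there (there (there (there (there (here refl)))))))) = refl

  D₀-object : ∀ {n} (t : Term n) → kindlike t ≡ false → D₀ t ≡ one
  D₀-object (bound i) _ = refl
  D₀-object (var x)   _ = refl
  D₀-object (pi A B)  p = D₀-object B p
  D₀-object (lam A t) _ = refl
  D₀-object (app t u) _ = refl

  D₀-kind : ∀ {n} (t : Term n) → kindlike t ≡ true → Stratified t → D₀ t ≡ U₂ ⋆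
  D₀-kind Type p _ = refl
  D₀-kind (pi A B) p (_ , _ , q) = D₀-kind B p q

  D₀-rename : ∀ {m n} (ρ : Fin m → Fin n) t → D₀ (rename ρ t) ≡ D₀ t
  D₀-rename ρ (bound i) = refl
  D₀-rename ρ (var x)   = refl
  D₀-rename ρ (sort s)  = refl
  D₀-rename ρ (pi A B)  = D₀-rename (ext ρ) B
  D₀-rename ρ (lam A t) = refl
  D₀-rename ρ (app t u) = refl

  D₀-subst : ∀ {m n} {θ : Name → Term n} {σ : Fin m → Term n} →
             (∀ x → D₀ (θ x) ≡ one) → (∀ i → D₀ (σ i) ≡ one) → ∀ t → D₀ (subst θ σ t) ≡ D₀ t
  D₀-subst h k (bound i) = k i
  D₀-subst h k (var x)   = h x
  D₀-subst h k (sort s)  = refl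
  D₀-subst {θ = θ} {σ} h k (pi A B) = D₀-subst
    (λ x → trans (D₀-rename suc (θ x)) (h x))
    (λ { zero → refl ; (suc i) → trans (D₀-rename suc (σ i)) (k i) }) B
  D₀-subst h k (lam A t) = refl
  D₀-subst h k (app t u) = refl

  D₀-[/] : ∀ x {n} {u : Term n} → kindlike u ≡ false → ∀ t → D₀ (t ⟪ x ↦ u ⟫) ≡ D₀ t
  D₀-[/] x p t = D₀-subst (λ y → D₀-object ((x ↦ _) y) (kindlike-↦ x p y)) (λ ()) t

  ≡⇒≈ᵀ : ∀ {m} {c d : T} → c ≡ d → c ≈[ m ] d
  ≡⇒≈ᵀ refl = ≈ᵀ-refl

  ≡⇒≐ : {a b : V} → a ≡ b → a ≐ b
  ≡⇒≐ refl = ≐-refl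

  _⊩[_]_ : Valuations ℓ → ℕ → Context → Set ℓ
  φ ⊩[ m ] Γ = ∀ {x A} → (x , A) ∈ Γ → ∀ j → j < m → φ j x ∈̇ 𝔻 j A φ

  restrict⊩ : ∀ {i m φ Γ} → i < m → φ ⊩[ m ] Γ → φ ⊩[ suc i ] Γ
  restrict⊩ p h x∈ k q = h x∈ k (<-≤-trans q p)

  env-cong : ∀ {m φ ψ} x → (x ∉ dom signature → ∀ j → j < m → φ j x ≐ ψ j x) → env φ x ≈[ m ] env ψ x
  env-cong {φ = φ} {ψ} x h with x ∈? dom signature
  ... | yes x∈ = ≡⇒≈ᵀ (constantᵀ-constant x∈)
  ... | no  x∉ = ≈ᵀ-trans (≡⇒≈ᵀ (constantᵀ-fresh x∉))
                   (≈ᵀ-trans (h x∉) (≡⇒≈ᵀ (sym (constantᵀ-fresh x∉))))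

  ≔-same : ∀ (φ : Valuations ℓ) x c j → (φ ⟨ x ≔ c ⟩) j x ≡ c j
  ≔-same φ x c j with does (x ≟ x) | proof (x ≟ x)
  ... | _ | ofʸ _   = refl
  ... | _ | ofⁿ x≢x = contradiction refl x≢x

  ≔-other : ∀ (φ : Valuations ℓ) x c j {y} → y ≢ x → (φ ⟨ x ≔ c ⟩) j y ≡ φ j y
  ≔-other φ x c j {y} y≢x with does (y ≟ x) | proof (y ≟ x)
  ... | _ | ofʸ y≡x = contradiction y≡x y≢x
  ... | _ | ofⁿ _   = refl

  env-≔-same : ∀ {m x} φ c → x ∉ dom signature → env (φ ⟨ x ≔ c ⟩) x ≈[ m ] c
  env-≔-same {x = x} φ c x∉ =
    ≈ᵀ-trans (≡⇒≈ᵀ (constantᵀ-fresh x∉)) (λ j _ → ≡⇒≐ (≔-same φ x c j))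

  env-≔-other : ∀ {m x y} φ c → y ≢ x → env (φ ⟨ x ≔ c ⟩) y ≈[ m ] env φ y
  env-≔-other {x = x} {y} φ c y≢x = env-cong {φ = φ ⟨ x ≔ c ⟩} {φ} y λ _ j _ → ≡⇒≐ (≔-other φ x c j y≢x)

  ⟦⟧-≔ : ∀ {m x} t φ c → x ∉ fv t → ⟦ t ⟧₀ (φ ⟨ x ≔ c ⟩) ≈[ m ] ⟦ t ⟧₀ φ
  ⟦⟧-≔ {x = x} t φ c x∉ = ⟦⟧-ext t (λ y y∈ → env-≔-other {x = x} {y} φ c λ { refl → x∉ y∈ }) (λ ())

  -- Constants must be excluded, since `env` ignores what a valuation assigns to them.
  ⟦⟧-[/] : ∀ {m n x} {u : Term n} {β} t φ → x ∉ dom signature →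
           ⟦ t ⟪ x ↦ u ⟫ ⟧ᵀ (env φ) β ≈[ m ] ⟦ t ⟧₀ (φ ⟨ x ≔ ⟦ u ⟧ᵀ (env φ) β ⟩)
  ⟦⟧-[/] {x = x} {u} {β} t φ x∉ = ⟦⟧-subst (x ↦ u) (λ ()) t lemma (λ ())
    where
    lemma : ∀ y → ⟦ (x ↦ u) y ⟧ᵀ (env φ) β ≈[ _ ] env (φ ⟨ x ≔ ⟦ u ⟧ᵀ (env φ) β ⟩) y
    lemma y with y ≟ x
    ... | yes refl = ≈ᵀ-trans (≡⇒≈ᵀ (cong (λ t → ⟦ t ⟧ᵀ (env φ) β) (↦-self x u)))
                       (≈ᵀ-sym (env-≔-same φ _ x∉))
    ... | no y≢x = ≈ᵀ-trans (≡⇒≈ᵀ (cong (λ t → ⟦ t ⟧ᵀ (env φ) β) (↦-other u y≢x)))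
                     (≈ᵀ-sym (env-≔-other φ _ y≢x))

  ⟦⟧-close : ∀ {m x c} t φ → x ∉ dom signature →
             ⟦ close x t ⟧ᵀ (env φ) (c ∷ᵉ none) ≈[ m ] ⟦ t ⟧₀ (φ ⟨ x ≔ c ⟩)
  ⟦⟧-close t = ⟦⟧-[/] t

  ⟦⟧-instantiate : ∀ {m n ρ β} (t : Term (suc n)) u →
                   ⟦ instantiate t u ⟧ᵀ ρ β ≈[ m ] ⟦ t ⟧ᵀ ρ (⟦ u ⟧ᵀ ρ β ∷ᵉ β)
  ⟦⟧-instantiate t u = ⟦⟧-subst var _ t (λ _ → ≈ᵀ-refl) λ { zero → ≈ᵀ-refl ; (suc i) → ≈ᵀ-refl }

  ∷ᵀ-≈ : ∀ {Z Z′ A A′ j} → Z ≡ Z′ → A ≈[ j ] A′ → (Z ∷ᵀ A) j ≐ (Z′ ∷ᵀ A′) j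
  ∷ᵀ-≈ {j = zero}  refl e = ≐-refl
  ∷ᵀ-≈ {j = suc j} refl e = e j ≤-refl

  declared-fresh : ∀ {Γ x A} → WellFormed (Γ ▸ x ∶ A) → x ∉ dom (signature ⨾ Γ)
  declared-fresh (declaration _ x∉) = x∉

  declared-¬constant : ∀ {Γ x A} → WellFormed (Γ ▸ x ∶ A) → x ∉ dom signature
  declared-¬constant {Γ} w = declared-fresh w ∘ dom-++⁺ʳ Γ

  extend⊩ : ∀ {m Γ x A φ c} → WellFormed (Γ ▸ x ∶ A) → φ ⊩[ m ] Γ →
            c ∈⟨ m ∣ D₀ A ⟩ ⟦ A ⟧₀ φ → (φ ⟨ x ≔ c ⟩) ⊩[ m ] (Γ ▸ x ∶ A)
  extend⊩ {x = x} {A} {φ} {c} (declaration ⊢A x∉) h p (here refl) j j<m =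
    ∈-resp (≡⇒≐ (sym (≔-same φ x c j)))
      (≐-sym (∷ᵀ-≈ {j = j} refl (⟦⟧-≔ A φ c (λ x∈ → x∉ (fv-declared ⊢A x∈))))) (p j j<m)
  extend⊩ {Γ = Γ} {x} {φ = φ} {c} (declaration ⊢A x∉) h p {y} {B} (there y∈) j j<m =
    ∈-resp (≡⇒≐ (sym (≔-other φ x c j λ { refl → x∉ (dom-++⁺ˡ Γ (∈⇒dom y∈)) })))
      (≐-sym (∷ᵀ-≈ {j = j} refl (⟦⟧-≔ B φ c λ x∈ → x∉ (fv-context (⊢⇒wf ⊢A) y∈ x∈)))) (h y∈ j j<m)

  -- Each level of the interpretation is invariant under conversion because
  -- the previous levels are sound for typing.

  Convertibility : ℕ → Set (Level.suc ℓ)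
  Convertibility j = ∀ {Γ A B C C′ φ} → Γ ⊢ A ∶ C → Γ ⊢ B ∶ C′ → A ≡βR B → φ ⊩[ j ] Γ →
                     𝔻 j A φ ≐ 𝔻 j B φ

  sort∈ : ∀ j → j < 3 → sortᵀ ⋆ j ∈̇ (U₂ □ ∷ᵀ sortᵀ □) j
  sort∈ 0 _ = element (u₁ , ≐-refl)
  sort∈ 1 _ = element (algebra₁ , ≐-refl)
  sort∈ 2 _ = ⊤∈𝓑
  sort∈ (suc (suc (suc _))) (s≤s (s≤s (s≤s ())))

  bind : ∀ {Γ x A φ c} → WellFormed (Γ ▸ x ∶ A) → kindlike A ≡ false → ∀ j → φ ⊩[ suc j ] Γ →
         c ∈⟨ suc j ⟩ ⟦ A ⟧₀ φ → (φ ⟨ x ≔ c ⟩) ⊩[ suc j ] (Γ ▸ x ∶ A)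
  bind {A = A} w A-type j h p = extend⊩ w h λ i i≤j →
    ∈-resp ≐-refl (∷ᵀ-≈ {j = i} (sym (D₀-object A A-type)) ≈ᵀ-refl) (p i i≤j)

  module _ {m : ℕ} (m≤3 : m ≤ 3) (conv : ∀ j → j < m → Convertibility j) where

    sound : ∀ {Γ t A φ} → Γ ⊢ t ∶ A → ∀ j → j < m → φ ⊩[ suc j ] Γ → 𝔻 (suc j) t φ ∈̇ 𝔻 j A φ

    sound∈ : ∀ {Γ t A φ} → Γ ⊢ t ∶ A → kindlike A ≡ false → ∀ j → j < m → φ ⊩[ suc j ] Γ →
             ⟦ t ⟧₀ φ ∈⟨ suc j ⟩ ⟦ A ⟧₀ φ
    sound∈ {A = A} ⊢t p j j<m h i i≤j =
      ∈-resp ≐-refl (∷ᵀ-≈ {j = i} (D₀-object A p) ≈ᵀ-refl)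
        (sound ⊢t i (<-≤-trans i≤j j<m) (restrict⊩ i≤j h))

    sound (sorting w) j j<m h = sort∈ j (<-≤-trans j<m m≤3)
    sound {Γ} {φ = φ} (variable′ {A = A} w x∈) j j<m h with ∈-++⁻ Γ x∈
    ... | inj₁ x∈Γ =
      ≡-subst (λ c → c j ∈̇ 𝔻 j A φ) (sym (constantᵀ-fresh (fresh-constants w x∈Γ))) (h x∈Γ j ≤-refl)
    ... | inj₂ x∈S = constant∈ {φ = φ} x∈S j (<-≤-trans j<m m≤3)
    sound {φ = φ} (product {x = x} {A} {B} {s} ⊢A ⊢B) j j<m h =
      PI∈ j {s} (<-≤-trans j<m m≤3) (Ext-⟦⟧ (close x B))
        (λ i i≤j → sound ⊢A i (<-≤-trans i≤j j<m) (restrict⊩ i≤j h))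
        λ c p → ∈-resp (≐-sym (⟦⟧-close B φ (declared-¬constant w) j ≤-refl)) ≐-refl
          (sound ⊢B j j<m (bind w (Type⇒¬kindlike ⊢A) j h p))
      where w = ⊢⇒wf ⊢B
    sound {φ = φ} (abstraction {x = x} {A} {B} {t} ⊢A ⊢B ⊢t) j j<m h =
      LAM∈ j {D₀ (close x B)} {⟦ A ⟧₀ φ} {λ c → ⟦ close x t ⟧ᵀ (env φ) (c ∷ᵉ none)}
        {λ c → ⟦ close x B ⟧ᵀ (env φ) (c ∷ᵉ none)}
        (<-≤-trans j<m m≤3) (Ext-⟦⟧ (close x t)) (Ext-⟦⟧ (close x B))
        λ c p → ∈-resp (≐-sym (⟦⟧-close t φ (declared-¬constant w) j ≤-refl))
          (∷ᵀ-≈ {j = j} (sym (D₀-[/] x refl B)) (≈ᵀ-sym (⟦⟧-close B φ (declared-¬constant w))))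
          (sound ⊢t j j<m (bind w (Type⇒¬kindlike ⊢A) j h p))
      where w = ⊢⇒wf ⊢B
    -- Component 0 of an application is that of the function, and `D₀` of the codomain is unchanged
    -- by substituting `u`, which is not a kind.
    sound {φ = φ} (application {x = x} {A} {B} {t} {u} ⊢t ⊢u) zero j<m h =
      ≡-subst (⟦ t ⟧₀ φ 0 ∈̇_) (trans (D₀-[/] x refl B) (sym (D₀-[/] x (object-domain ⊢t ⊢u) B)))
        (sound ⊢t 0 j<m h)
    sound {φ = φ} (application {x = x} {A} {B} {t} {u} ⊢t ⊢u) (suc j) j<m h =
      ∈-resp ≐-refl (≐-sym (≡-subst (λ C → ⟦ C ⟧₀ φ j ≐ ⟦ close x B ⟧ᵀ (env φ) (⟦ u ⟧₀ φ ∷ᵉ none) j)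
                              (instantiate-close x B u)
                              (⟦⟧-instantiate (close x B) u j ≤-refl)))
        (APP∈ j {⟦ A ⟧₀ φ} {λ c → ⟦ close x B ⟧ᵀ (env φ) (c ∷ᵉ none)} {⟦ t ⟧₀ φ} {⟦ u ⟧₀ φ}
          (j<2 (<-≤-trans j<m m≤3)) (Ext-⟦⟧ (close x B)) (sound ⊢t (suc j) j<m h)
          (sound∈ ⊢u (kind-domain ⊢t) (suc j) j<m h))
      where
      j<2 : suc j < 3 → j < 2
      j<2 (s≤s p) = p
    sound (conversion ⊢A ⊢B ⊢t e) j j<m h =
      ∈-resp ≐-refl (conv j j<m ⊢A ⊢B e (λ x∈ i i<j → h x∈ i (<-≤-trans i<j (n≤1+n j))))
        (sound ⊢t j j<m h)

    -- Invariance under reduction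

    infix 25 _⟨_⟩ˢ
    _⟨_⟩ˢ : ∀ {n} → Term n → (Fin n → Name) → Term 0
    t ⟨ σ ⟩ˢ = subst var (var ∘ σ) t

    _∷ˢ_ : ∀ {n} → Name → (Fin n → Name) → Fin (suc n) → Name
    (x ∷ˢ σ) zero    = x
    (x ∷ˢ σ) (suc i) = σ i

    -- The terms under a binder are opened with the name declared in a typing
    -- derivation.
    open-binder : ∀ {n x} (σ : Fin n → Name) (t : Term (suc n)) {b} →
                  subst (weaken ∘ var) (exts (var ∘ σ)) t ≡ close x b → t ⟨ x ∷ˢ σ ⟩ˢ ≡ b
    open-binder {x = x} σ t {b} eq = begin
      t ⟨ x ∷ˢ σ ⟩ˢ ≡⟨ subst-subst (λ _ → refl) (λ { zero → refl ; (suc i) → refl }) t ⟨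
      subst var (single (var x)) (subst (weaken ∘ var) (exts (var ∘ σ)) t)
        ≡⟨ instantiate≡ (subst (weaken ∘ var) (exts (var ∘ σ)) t) (var x) ⟨
      instantiate (subst (weaken ∘ var) (exts (var ∘ σ)) t) (var x)
        ≡⟨ cong (λ t → instantiate t (var x)) eq ⟩
      instantiate (close x b) (var x) ≡⟨ close-open x b ⟩
      b ∎
      where open ≡-Reasoning

    ⟦⟧-⟨⟩ˢ : ∀ {k n} (t : Term n) σ φ → ⟦ t ⟨ σ ⟩ˢ ⟧₀ φ ≈[ k ] ⟦ t ⟧ᵀ (env φ) (env φ ∘ σ)
    ⟦⟧-⟨⟩ˢ t σ φ = ⟦⟧-subst var (var ∘ σ) t (λ _ → ≈ᵀ-refl) (λ _ → ≈ᵀ-refl)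

    ⟦⟧-under : ∀ {k n x c} (t : Term (suc n)) σ φ → x ∉ dom signature → x ∉ fv t → (∀ i → σ i ≢ x) →
               ⟦ t ⟧ᵀ (env φ) (c ∷ᵉ env φ ∘ σ) ≈[ k ]
               ⟦ t ⟧ᵀ (env (φ ⟨ x ≔ c ⟩)) (env (φ ⟨ x ≔ c ⟩) ∘ (x ∷ˢ σ))
    ⟦⟧-under {x = x} {c} t σ φ x∉S x∉t x∉σ = ⟦⟧-ext t
      (λ y y∈ → ≈ᵀ-sym (env-≔-other {x = x} {y} φ c λ { refl → x∉t y∈ }))
      λ { zero → ≈ᵀ-sym (env-≔-same φ c x∉S) ; (suc i) → ≈ᵀ-sym (env-≔-other {x = x} {σ i} φ c (x∉σ i)) }

    Declares : ∀ {n} → Context → (Fin n → Name) → Set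
    Declares Γ σ = ∀ i → σ i ∈ dom Γ

    Declares-∷ : ∀ {n Γ x A} {σ : Fin n → Name} → Declares Γ σ → Declares (Γ ▸ x ∶ A) (x ∷ˢ σ)
    Declares-∷ h zero    = here refl
    Declares-∷ h (suc i) = there (h i)

    argument∈ : ∀ {n Γ A u φ} (σ : Fin n → Name) → Γ ⊢ u ⟨ σ ⟩ˢ ∶ A ⟨ σ ⟩ˢ → kindlike (A ⟨ σ ⟩ˢ) ≡ false →
                ∀ j → j < m → φ ⊩[ suc j ] Γ →
                ⟦ u ⟧ᵀ (env φ) (env φ ∘ σ) ∈⟨ suc j ⟩ ⟦ A ⟧ᵀ (env φ) (env φ ∘ σ)
    argument∈ {A = A} {u} {φ} σ ⊢u p j j<m h i i≤j =
      ∈-resp (⟦⟧-⟨⟩ˢ u σ φ i ≤-refl) (∷ᵀ-≈ {j = i} refl (⟦⟧-⟨⟩ˢ A σ φ)) (sound∈ ⊢u p j j<m h i i≤j)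

    -- As `x` is fresh, giving the bound variable the value `c` amounts to opening the binder with
    -- `x` and assigning `c` to `x`; the induction hypothesis then applies to a valuation of the
    -- extended context.
    under : ∀ {n Γ x φ} {A : Term n} {b b′ : Term (suc n)} σ → Declares Γ σ → WellFormed (Γ ▸ x ∶ A ⟨ σ ⟩ˢ) →
            kindlike (A ⟨ σ ⟩ˢ) ≡ false → x ∉ fv b → x ∉ fv b′ → ∀ j → φ ⊩[ suc j ] Γ →
            (∀ {ψ} → ψ ⊩[ suc j ] (Γ ▸ x ∶ A ⟨ σ ⟩ˢ) →
              ⟦ b ⟧ᵀ (env ψ) (env ψ ∘ (x ∷ˢ σ)) j ≐ ⟦ b′ ⟧ᵀ (env ψ) (env ψ ∘ (x ∷ˢ σ)) j) →
            ∀ c d → c ∈⟨ suc j ⟩ ⟦ A ⟧ᵀ (env φ) (env φ ∘ σ) → c ≈[ suc j ] d →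
            ⟦ b ⟧ᵀ (env φ) (c ∷ᵉ env φ ∘ σ) j ≐ ⟦ b′ ⟧ᵀ (env φ) (d ∷ᵉ env φ ∘ σ) j
    under {Γ = Γ} {x} {φ} {A} {b} {b′} σ σ∈ w A-type x∉b x∉b′ j h ih c d p e =
      ≐-trans (⟦⟧-under b σ φ x∉S x∉b x∉σ j ≤-refl)
        (≐-trans
          (ih (bind w A-type j h λ i i≤j →
            ∈-resp ≐-refl (∷ᵀ-≈ {j = i} refl (≈ᵀ-sym (⟦⟧-⟨⟩ˢ A σ φ))) (p i i≤j)))
          (≐-trans (≐-sym (⟦⟧-under b′ σ φ x∉S x∉b′ x∉σ j ≤-refl)) (Ext-⟦⟧ b′ e)))
      where
      x∉S : x ∉ dom signature
      x∉S = declared-¬constant w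
      x∉σ : ∀ i → σ i ≢ x
      x∉σ i refl = declared-fresh w (dom-++⁺ˡ Γ (σ∈ i))

    binder-fresh : ∀ {n Γ x A} {us : List Name} (σ : Fin (suc n) → Term 1) (b : Term (suc n)) →
                   WellFormed (Γ ▸ x ∶ A) →
                   (∀ {y} → y ∈ us ++ fv (subst var σ b) → y ∈ dom (signature ⨾ Γ)) → x ∉ fv b
    binder-fresh {us = us} σ b w h x∈ = declared-fresh w (h (∈-++⁺ʳ us (fv-subst-var σ b x∈)))

    -- The data of a rule rewriting `g (c x y)` to the product over `z : h x` of `g (y z)`, where
    -- `c` has type `pi A (pi B C)`.
    record IsDot (P R : Universe) (g h c : Name) (A : Term 0) (B : Term 1) (C : Term 2) :
                 Set (Level.suc ℓ) where
      field
        declared  : (c , pi A (pi B C)) ∈ signature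
        codomain  : kindlike C ≡ false
        A-object  : kindlike A ≡ false
        B-object  : ∀ X → kindlike (instantiate B X) ≡ false
        g≡        : ∀ φ → env φ g ≡ Universe.op R
        h≡        : ∀ φ → env φ h ≡ Universe.op P
        c≡        : ∀ φ → env φ c ≡ Dot.dot P R
        A≡        : ∀ φ → ⟦ A ⟧₀ φ ≡ Universe.carrier P
        B≡        : ∀ X φ → ⟦ instantiate B X ⟧₀ φ ≡ Dot.domain P R (⟦ X ⟧₀ φ)

    -- The substitution of a rule fixes constants only up to a proof of equality, so the heads are
    -- terms `G`, `H`, `K` accompanied by equations.
    rewrite-dot : ∀ {P R g h c A B C} → IsDot P R g h c A B C →
      ∀ {n Γ D φ} {G H K X Y : Term n} σ → G ≡ var g → H ≡ var h → K ≡ var c →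
      Γ ⊢ app G (app (app K X) Y) ⟨ σ ⟩ˢ ∶ D → ∀ j → j < m → φ ⊩[ suc j ] Γ →
      ⟦ app G (app (app K X) Y) ⟧ᵀ (env φ) (env φ ∘ σ) j ≐
      ⟦ pi (app H X) (app (weaken G) (app (weaken Y) (bound zero))) ⟧ᵀ (env φ) (env φ ∘ σ) j
    rewrite-dot {P} {R} is {n} {φ = φ} {X = X} {Y} σ refl refl refl ⊢t j j<m h
      with inversion-app ⊢t
    ... | _ , _ , _ , _ , ⊢cXY , _
      with constant-arguments (IsDot.declared is) (IsDot.codomain is) ⊢cXY
    ... | ⊢X , ⊢Y =
      ≐-trans
        (APP-≈ {m = suc j} (≡⇒≈ᵀ (g≡ φ)) (APP-≈ (APP-≈ {a = X̂} (≡⇒≈ᵀ (c≡ φ)) ≈ᵀ-refl) (≈ᵀ-refl {c = Ŷ})) j ≤-refl)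
        (≐-trans (Dot.dot-rule P R (<-≤-trans j<m m≤3) x∈ y∈ j ≤-refl)
          (PI-≈ {m = suc j} (APP-≈ {a = X̂} (≡⇒≈ᵀ (sym (h≡ φ))) ≈ᵀ-refl) (λ i i≤j c d _ e →
            APP-≈ {m = suc i} (≡⇒≈ᵀ (sym (g≡ φ))) (APP-≈ (≈ᵀ-sym (⟦⟧-weaken Y)) e) i ≤-refl) j ≤-refl))
      where
      open IsDot is
      X̂ Ŷ : T
      X̂ = ⟦ X ⟧ᵀ (env φ) (env φ ∘ σ)
      Ŷ = ⟦ Y ⟧ᵀ (env φ) (env φ ∘ σ)
      x∈ : X̂ ∈⟨ suc j ⟩ Universe.carrier P
      x∈ i i≤j = ∈-resp (⟦⟧-⟨⟩ˢ X σ φ i ≤-refl) (∷ᵀ-≈ {j = i} refl (≡⇒≈ᵀ (A≡ φ)))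
        (sound∈ ⊢X A-object j j<m h i i≤j)
      y∈ : Ŷ ∈⟨ suc j ⟩ Dot.domain P R X̂
      y∈ i i≤j = ∈-resp (⟦⟧-⟨⟩ˢ Y σ φ i ≤-refl)
        (∷ᵀ-≈ {j = i} refl (≈ᵀ-trans (≡⇒≈ᵀ (B≡ (X ⟨ σ ⟩ˢ) φ)) (Dot.domain-≈ P R (⟦⟧-⟨⟩ˢ X σ φ))))
        (sound∈ ⊢Y (B-object (X ⟨ σ ⟩ˢ)) j j<m h i i≤j)
    KK-dot : IsDot types types 2 2 4 _ _ _
    KK-dot = record
      { declared = there (there (there (here refl))) ; codomain = refl ; A-object = refl
      ; B-object = λ _ → refl ; g≡ = λ _ → refl ; h≡ = λ _ → refl ; c≡ = λ _ → refl
      ; A≡ = λ _ → refl ; B≡ = λ _ _ → refl }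

    TT-dot : IsDot propositions propositions 3 3 5 _ _ _
    TT-dot = record
      { declared = there (there (here refl)) ; codomain = refl ; A-object = refl
      ; B-object = λ _ → refl ; g≡ = λ _ → refl ; h≡ = λ _ → refl ; c≡ = λ _ → refl
      ; A≡ = λ _ → refl ; B≡ = λ _ _ → refl }

    KT-dot : IsDot types propositions 3 2 6 _ _ _
    KT-dot = record
      { declared = there (here refl) ; codomain = refl ; A-object = refl
      ; B-object = λ _ → refl ; g≡ = λ _ → refl ; h≡ = λ _ → refl ; c≡ = λ _ → refl
      ; A≡ = λ _ → refl ; B≡ = λ _ _ → refl }

    TK-dot : IsDot propositions types 2 3 7 _ _ _
    TK-dot = record
      { declared = here refl ; codomain = refl ; A-object = refl
      ; B-object = λ _ → refl ; g≡ = λ _ → refl ; h≡ = λ _ → refl ; c≡ = λ _ → refl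
      ; A≡ = λ _ → refl ; B≡ = λ _ _ → refl }

    ∉-rule-context : ∀ c {_ : False (c ∈? 9 ∷ 8 ∷ [])} → c ∉ 9 ∷ 8 ∷ []
    ∉-rule-context c {c∉} = toWitnessFalse c∉

    -- A redex may lie under binders, where typing does not apply directly; `σ` replaces the
    -- dangling variables by declared names, so that the hypothesis can be a typing judgement.
    step : ∀ {n} {t u : Term n} → Step (βR Rules) t u → ∀ {Γ C φ} σ → Declares Γ σ →
           Γ ⊢ t ⟨ σ ⟩ˢ ∶ C → ∀ j → j < m → φ ⊩[ suc j ] Γ →
           ⟦ t ⟧ᵀ (env φ) (env φ ∘ σ) j ≐ ⟦ u ⟧ᵀ (env φ) (env φ ∘ σ) j
    step (root (inj₁ (beta {A} {t} {u}))) {φ = φ} σ σ∈ ⊢app j j<m h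
      with inversion-app ⊢app
    ... | _ , _ , _ , ⊢lam , _ with inversion-lam ⊢lam
    ...   | _ , _ , _ , ⊢A , _ =
      ≐-trans
        (APP-LAM j {⟦ A ⟧ᵀ (env φ) (env φ ∘ σ)} (<-≤-trans j<m m≤3) (Ext-⟦⟧ t)
          (argument∈ {A = A} {u} σ (redex-argument ⊢app) (Type⇒¬kindlike ⊢A) j j<m h))
        (≐-sym (⟦⟧-instantiate t u j ≤-refl))
    step (root (inj₂ (rewrites (here refl) θ fixed))) σ σ∈ ⊢t =
      -- The names 8 and 9 are the variables of the rule; all others are fixed by `θ`.
      rewrite-dot KK-dot {H = θ 2} {X = θ 8} {θ 9} σ
        (fixed (∉-rule-context 2)) (fixed (∉-rule-context 2)) (fixed (∉-rule-context 4)) ⊢t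
    step (root (inj₂ (rewrites (there (here refl)) θ fixed))) σ σ∈ ⊢t =
      rewrite-dot TT-dot {H = θ 3} {X = θ 8} {θ 9} σ
        (fixed (∉-rule-context 3)) (fixed (∉-rule-context 3)) (fixed (∉-rule-context 5)) ⊢t
    step (root (inj₂ (rewrites (there (there (here refl))) θ fixed))) σ σ∈ ⊢t =
      rewrite-dot KT-dot {H = θ 2} {X = θ 8} {θ 9} σ
        (fixed (∉-rule-context 3)) (fixed (∉-rule-context 2)) (fixed (∉-rule-context 6)) ⊢t
    step (root (inj₂ (rewrites (there (there (there (here refl)))) θ fixed))) σ σ∈ ⊢t =
      rewrite-dot TK-dot {H = θ 3} {X = θ 8} {θ 9} σ
        (fixed (∉-rule-context 2)) (fixed (∉-rule-context 3)) (fixed (∉-rule-context 7)) ⊢t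
    step (piˡ {A} {A′} {B} s) {φ = φ} σ σ∈ ⊢pi j j<m h with inversion-pi ⊢pi
    ... | _ , _ , _ , ⊢A , _ = PI-cong j
      (λ i i≤j → step s σ σ∈ ⊢A i (<-≤-trans i≤j j<m) (restrict⊩ i≤j h)) (λ c d _ e → Ext-⟦⟧ B e)
    step (piʳ {A} {B} {B′} s) {Γ} {φ = φ} σ σ∈ ⊢pi j j<m h with inversion-pi ⊢pi
    ... | x , B₀ , _ , ⊢A , ⊢B , eq = PI-cong j ≈ᵀ-refl
      (under {A = A} {B} {B′} σ σ∈ (⊢⇒wf ⊢B) (Type⇒¬kindlike ⊢A)
        (binder-fresh {us = fv (A ⟨ σ ⟩ˢ)} (exts (var ∘ σ)) B (⊢⇒wf ⊢B) (fv-declared ⊢pi))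
        -- Subject reduction types the reduct in the same context, so it has no undeclared
        -- variables.
        (binder-fresh {us = fv (A ⟨ σ ⟩ˢ)} (exts (var ∘ σ)) B′ (⊢⇒wf ⊢B)
          (fv-declared (preservation ⊢pi (Step-subst (var ∘ σ) (piʳ {A = A} s))))) j h
        λ h′ → step s (x ∷ˢ σ) (Declares-∷ {A = A ⟨ σ ⟩ˢ} σ∈)
          (≡-subst (λ B → Γ ▸ x ∶ A ⟨ σ ⟩ˢ ⊢ B ∶ _) (sym (open-binder σ B eq)) ⊢B) j j<m h′)
    step (lamˡ {A} {A′} {t} s) {φ = φ} σ σ∈ ⊢lam j j<m h with inversion-lam ⊢lam
    ... | _ , _ , _ , ⊢A , _ = LAM-cong j
      (λ i i≤j → step s σ σ∈ ⊢A i (<-≤-trans i≤j j<m) (restrict⊩ i≤j h)) (λ c d _ e → Ext-⟦⟧ t e)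
    step (lamʳ {A} {t} {t′} s) {Γ} {φ = φ} σ σ∈ ⊢lam j j<m h with inversion-lam ⊢lam
    ... | x , B₀ , t₀ , ⊢A , ⊢t , eq , _ = LAM-cong j ≈ᵀ-refl
      (under {A = A} {t} {t′} σ σ∈ (⊢⇒wf ⊢t) (Type⇒¬kindlike ⊢A)
        (binder-fresh {us = fv (A ⟨ σ ⟩ˢ)} (exts (var ∘ σ)) t (⊢⇒wf ⊢t) (fv-declared ⊢lam))
        (binder-fresh {us = fv (A ⟨ σ ⟩ˢ)} (exts (var ∘ σ)) t′ (⊢⇒wf ⊢t)
          (fv-declared (preservation ⊢lam (Step-subst (var ∘ σ) (lamʳ {A = A} s))))) j h
        λ h′ → step s (x ∷ˢ σ) (Declares-∷ {A = A ⟨ σ ⟩ˢ} σ∈)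
          (≡-subst (λ t → Γ ▸ x ∶ A ⟨ σ ⟩ˢ ⊢ t ∶ B₀) (sym (open-binder σ t eq)) ⊢t) j j<m h′)
    step (appˡ {t} {t′} {u} s) σ σ∈ ⊢app j j<m h with inversion-app ⊢app
    ... | _ , _ , _ , ⊢t , _ , _ =
      APP-cong j (λ i i≤j → step s σ σ∈ ⊢t i (<-≤-trans i≤j j<m) (restrict⊩ i≤j h)) ≈ᵀ-refl
    step (appʳ {t} {u} {u′} s) σ σ∈ ⊢app j j<m h with inversion-app ⊢app
    ... | _ , _ , _ , _ , ⊢u , _ =
      APP-cong j {⟦ t ⟧ᵀ _ _} ≈ᵀ-refl (λ i i≤j → step s σ σ∈ ⊢u i (<-≤-trans i≤j j<m) (restrict⊩ i≤j h))

    ⟨⟩ˢ-closed : ∀ (σ : Fin 0 → Name) t → t ⟨ σ ⟩ˢ ≡ t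
    ⟨⟩ˢ-closed σ = subst-id (λ _ → refl) (λ ())

    steps : ∀ {Γ t u C φ} → t ⟶* u → Γ ⊢ t ∶ C → ∀ j → j < m → φ ⊩[ suc j ] Γ → ⟦ t ⟧₀ φ j ≐ ⟦ u ⟧₀ φ j
    steps ε* ⊢t j j<m h = ≐-refl
    steps {Γ} {φ = φ} (_◅_ {t} {t′} s ss) ⊢t j j<m h = ≐-trans
      (≐-trans (⟦⟧-ext t {β = none} (λ _ _ → ≈ᵀ-refl) (λ ()) j ≤-refl)
        (≐-trans
          (step s none-name (λ ())
            (≡-subst (λ t → Γ ⊢ t ∶ _) (sym (⟨⟩ˢ-closed none-name t)) ⊢t) j j<m h)
          (⟦⟧-ext t′ {β = env φ ∘ none-name} {none} (λ _ _ → ≈ᵀ-refl) (λ ()) j ≤-refl)))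
      (steps ss (preservation ⊢t s) j j<m h)
      where
      none-name : Fin 0 → Name
      none-name ()

    convertibility-suc : ∀ j → j < m → Convertibility (suc j)
    convertibility-suc j j<m ⊢A ⊢B e h with church-rosser e
    ... | _ , p , q = ≐-trans (steps p ⊢A j j<m h) (≐-sym (steps q ⊢B j j<m h))

  -- On typed terms `D₀` has only two values, `U₂ ⋆` on kinds and `one` elsewhere; `Stratified`
  -- excludes `U₂ □`.
  convertibility-zero : Convertibility 0
  convertibility-zero {A = A} {B} ⊢A ⊢B e _ = ≡⇒≐ (D₀-cong (≡-kindlike ⊢A ⊢B e))
    where
    D₀-cong : kindlike A ≡ kindlike B → D₀ A ≡ D₀ B
    D₀-cong eq with kindlike A in eqA
    ... | true = trans (D₀-kind A eqA (proj₁ (⊢-Stratified ⊢A)))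
                   (sym (D₀-kind B (sym eq) (proj₁ (⊢-Stratified ⊢B))))
    ... | false = trans (D₀-object A eqA) (sym (D₀-object B (sym eq)))

  convertibility< : ∀ m → m ≤ 4 → ∀ j → j < m → Convertibility j
  convertibility< (suc m) m<4 j j<sm with m<1+n⇒m<n∨m≡n j<sm
  ... | inj₁ j<m = convertibility< m (<⇒≤ m<4) j j<m
  convertibility< (suc zero)    _ _ _ | inj₂ refl = convertibility-zero
  convertibility< (suc (suc m)) (s≤s m<3) _ _ | inj₂ refl =
    convertibility-suc m<3 (convertibility< (suc m) (<⇒≤ (s≤s m<3))) m ≤-refl

  soundness : ∀ {Γ t A φ} → Γ ⊢ t ∶ A → ∀ j → j < 3 → φ ⊩[ suc j ] Γ → 𝔻 (suc j) t φ ∈̇ 𝔻 j A φ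
  soundness = sound ≤-refl (convertibility< 3 (s≤s (s≤s (s≤s z≤n))))

  -- Validity of the types of the constants

  Valid : V → Set ℓ
  Valid v = ∃[ a ] (v ≐ ⟨ a ⟩ × ⊤̃ ≤ᴮ a)

  Valid-resp : ∀ {v w} → v ≐ w → Valid v → Valid w
  Valid-resp e (a , e′ , p) = a , ≐-trans (≐-sym e) e′ , p

  Valid-⊤ : Valid ⟨ ⊤̃ ⟩
  Valid-⊤ = ⊤̃ , ≐-refl , ⊤̃-maximum ⊤̃

  -- By residuation it suffices that ⊤̃ ∧̃ a lies below every member of the range, and it lies below
  -- ⊤̃, which is below all of them.
  Valid-PI : ∀ {A F} → A ∈⟨ 3 ∣ U₂ ⋆ ⟩ sortᵀ ⋆ → (∀ c → c ∈⟨ 3 ⟩ A → Valid (F c 2)) → Valid (PI A F 2)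
  Valid-PI {A} {F} p h =
    let a , e = index (p 2 ≤-refl)
    in Π̃ a (range A F) S∈𝓐 , Π̂≈ S∈𝓐 e ,
       Equivalence.from (Π̃-residual S∈𝓐) λ c c∈ → let b , e′ , ⊤≤b = member c (∈ˢ⇒∈̇ c∈) in
         IsPreorder.trans isPreorder (⊤̃-maximum _)
           (IsPreorder.trans isPreorder ⊤≤b (IsPreorder.reflexive isPreorder (≐⇒≈ (≐-sym e′))))
    where
    S∈𝓐 : 𝓐 (range A F)
    S∈𝓐 = range-𝓐 {A} {F} (λ j q → p j (≤-trans q (n≤1+n 2))) λ c q →
      let b , e , _ = h c q in element (b , e)
    member : ∀ c → ⟨ c ⟩ ∈̇ range A F → Valid ⟨ c ⟩
    member c c∈ = let (i , k) , e = index c∈ in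
      Valid-resp (≐-sym e) (h ⟪ elem (A 0) i , elem (A 1) k ⟫ (∈₃ (elem∈ _ i) (elem∈ _ k)))

  Valid-dotType : ∀ P R → Valid (Universe.carrier R 2) → Valid (Dot.dotType P R 2)
  Valid-dotType P R v = Valid-PI {F = λ x → PI (Dot.domain P R x) λ _ → Universe.carrier R}
    (Universe.carrier-type P) λ x x∈ →
      Valid-PI {F = λ _ → Universe.carrier R} (Dot.domain-type P R x∈) λ _ _ → v

  Valid-propositions : Valid (Universe.carrier propositions 2)
  Valid-propositions = Valid-resp (≐-sym (ηo≈ 2 ≤-refl)) Valid-⊤

  constant-valid : ∀ {c A} → (c , A) ∈ signature → ∀ φ → Valid (⟦ A ⟧₀ φ 2)
  constant-valid (here refl) φ = Valid-dotType propositions types Valid-⊤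
  constant-valid (there (here refl)) φ = Valid-dotType types propositions Valid-propositions
  constant-valid (there (there (here refl))) φ = Valid-dotType propositions propositions Valid-propositions
  constant-valid (there (there (there (here refl)))) φ = Valid-dotType types types Valid-⊤
  constant-valid (there (there (there (there (here refl))))) φ =
    Valid-PI {F = λ _ → sortᵀ ⋆} (Universe.carrier-type propositions) λ _ _ → Valid-⊤
  constant-valid (there (there (there (there (there (here refl)))))) φ =
    Valid-PI {F = λ _ → sortᵀ ⋆} (Universe.carrier-type types) λ _ _ → Valid-⊤
  constant-valid (there (there (there (there (there (there (here refl))))))) φ = Valid-⊤
  constant-valid (there (there (there (there (there (there (there (here refl)))))))) φ = Valid-⊤

  -- The model and its properties

  model : Model CoC ℓ
  model = record
    { k = 2
    ; D = 𝔻
    ; membership = λ {_} {_} {_} {i} ⊢t i<3 h → ∈̇⇒∈ˢ (soundness ⊢t i i<3 λ x∈ j j≤i → ∈ˢ⇒∈̇ (h j≤i x∈))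
    ; locality = λ {Γ} {_} {t} {i} {φ} {φ′} d _ _ _ _ e →
        ≐⇒≈ (local Γ t i φ φ′ (fv-defined d) (λ j<i x∈t x∈Γ → ≈⇒≐ (e j<i x∈t x∈Γ)))
    ; substitution = λ {Γ} {_} {_} {_} {t} {_} {φ} d x∈ _ _ _ _ →
        -- Component 2 of a value is `D 3`, the top level.
        ≐⇒≈ (⟦⟧-[/] t φ (fresh-constants (wf-defined d) x∈) 2 ≤-refl)
    }
    where
    Defined : Context → Term 0 → Set
    Defined Γ t = WellTyped Γ t ⊎ (WellFormed Γ × t ≡ Kind)
    wf-defined : ∀ {Γ t} → Defined Γ t → WellFormed Γ
    wf-defined (inj₁ (_ , ⊢t)) = ⊢⇒wf ⊢t
    wf-defined (inj₂ (w , _))  = w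
    fv-defined : ∀ {Γ t} → Defined Γ t → ∀ {x} → x ∈ fv t → x ∈ dom (signature ⨾ Γ)
    fv-defined (inj₁ (_ , ⊢t)) = fv-declared ⊢t
    fv-defined (inj₂ (_ , refl)) ()
    local : ∀ Γ t i φ φ′ → (∀ {x} → x ∈ fv t → x ∈ dom (signature ⨾ Γ)) →
            (∀ {j x} → j < i → x ∈ fv t → x ∈ dom Γ → φ j x ≐ φ′ j x) → 𝔻 i t φ ≐ 𝔻 i t φ′
    local Γ t i φ φ′ declared e = ∷ᵀ-≈ {j = i} refl (⟦⟧-ext t
      (λ x x∈t → env-cong {φ = φ} {φ′} x λ x∉S j j<i →
        [ e j<i x∈t , (λ x∈S → contradiction x∈S x∉S) ]′ (dom-++⁻ Γ (declared x∈t)))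
      (λ ()))

  valued-in : ValuedIn model 𝔅
  valued-in = record
    { D-Kind = λ _ → ≐⇒≈ ≐-refl
    ; D-Type = λ _ → ≐⇒≈ ≐-refl
    ; ⟦Kind⟧ = λ _ → ≐⇒≈ ≐-refl
    ; ⟦Type⟧ = λ _ → ≐⇒≈ ≐-refl
    ; ⟦Π⟧    = product-value
    }
    where
    open Model model using (_⊨[_]_)
    product-value : ∀ {Γ x A B s φ} → Γ ⊢ A ∶ Type → Γ ▸ x ∶ A ⊢ B ∶ sort s → φ ⊨[ 3 ] Γ →
      Σ[ a ∈ Carrier ] Σ[ S ∈ V ] Σ[ p ∈ 𝓐 S ]
        (𝔻 3 A φ ≈ ⟨ a ⟩ × (∀ z → z ∈ˢ S ⇔ Instance model 𝔅 φ x A B z) ×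
         𝔻 3 (Π[ x ∶ A ] B) φ ≈ ⟨ Π̃ a S p ⟩)
    product-value {Γ} {x} {A} {B} {φ = φ} ⊢A ⊢B h =
      let a , e = index (A∈ 2 ≤-refl)
      in a , range Â F , S∈𝓐 , ≐⇒≈ e ,
         (λ z → mk⇔ (instance⁺ z ∘ ∈ˢ⇒∈̇) (λ (c , p , e) →
           ∈̇⇒∈ˢ (instance⁻ c (λ j j<3 → ∈ˢ⇒∈̇ (p j<3)) (≈⇒≐ e)))) ,
         ≐⇒≈ (Π̂≈ S∈𝓐 e)
      where
      w : WellFormed (Γ ▸ x ∶ A)
      w = ⊢⇒wf ⊢B
      Â : T
      Â = ⟦ A ⟧₀ φ
      F : T → T
      F c = ⟦ close x B ⟧ᵀ (env φ) (c ∷ᵉ none)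
      h′ : φ ⊩[ 3 ] Γ
      h′ x∈ j j<3 = ∈ˢ⇒∈̇ (h j<3 x∈)
      A∈ : Â ∈⟨ 3 ∣ U₂ ⋆ ⟩ sortᵀ ⋆
      A∈ j j<3 = soundness ⊢A j j<3 (restrict⊩ j<3 h′)
      A≡one : D₀ A ≡ one
      A≡one = D₀-object A (Type⇒¬kindlike ⊢A)
      F∈ : ∀ c → c ∈⟨ 3 ⟩ Â → F c 2 ∈̇ 𝓑
      F∈ c p = ∈-resp (≐-sym (⟦⟧-close B φ (declared-¬constant w) 2 ≤-refl)) ≐-refl
        (soundness ⊢B 2 ≤-refl (bind w (Type⇒¬kindlike ⊢A) 2 h′ p))
      S∈𝓐 : 𝓐 (range Â F)
      S∈𝓐 = range-𝓐 {Â} {F} (λ j q → A∈ j (≤-trans q (n≤1+n 2))) F∈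
      instance⁺ : ∀ z → z ∈̇ range Â F → Instance model 𝔅 φ x A B z
      instance⁺ z z∈ =
        let (i , k) , e = index {X = range Â F} z∈ in
        ⟪ elem (Â 0) i , elem (Â 1) k ⟫ ,
        (λ {j} j<3 → ∈̇⇒∈ˢ (∈-resp ≐-refl (∷ᵀ-≈ {j = j} (sym A≡one) ≈ᵀ-refl)
          (∈₃ {A = Â} (elem∈ _ i) (elem∈ _ k) j j<3))) ,
        ≐⇒≈ (≐-trans e (⟦⟧-close B φ (declared-¬constant w) 2 ≤-refl))
      instance⁻ : ∀ {z} c → (∀ j → j < 3 → c j ∈̇ 𝔻 j A φ) → z ≐ 𝔻 3 B (φ ⟨ x ≔ c ⟩) → z ∈̇ range Â F
      instance⁻ c p e =
        let i , e₁ = index (p 1 (s≤s (s≤s z≤n))) ; k , e₂ = index (p 2 ≤-refl)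
            -- `D 0 A` is {∅}, so `range` loses no instance by fixing component 0 to ∅.
            e₀ = ∈one (∈-resp ≐-refl (≡⇒≐ A≡one) (p 0 z<s))
        in element ((i , k) , ≐-trans e (≐-trans (≐-sym (⟦⟧-close B φ (declared-¬constant w) 2 ≤-refl))
             (Ext-⟦⟧ (close x B) (≈₃ e₀ e₁ e₂))))

  is-model : IsModelOf model 𝔅
  is-model = record
    { valued-in = valued-in
    ; validity = λ c∈ φ → let a , e , p = constant-valid c∈ φ in a , ≐⇒≈ e , p
    ; convertibility = λ {_} {_} {_} {i} (_ , ⊢A) (_ , ⊢B) e i≤3 h →
        ≐⇒≈ (convertibility< 4 ≤-refl i (s≤s i≤3) ⊢A ⊢B e λ x∈ j j<i → ∈ˢ⇒∈̇ (h j<i x∈))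
    }

mainTheorem7 : (ℓ : Level) →
    Confluent (CalculusOf._⟶_ CoC) →
    CalculusOf.SubjectReduction CoC →
    SuperConsistent ℓ CoC
mainTheorem7 ℓ confluent preservation 𝔅 full _ _ = model , is-model
  where open Soundness 𝔅 full confluent preservation
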